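{- Let $c\ge2$ and let $d$ be an integer with $1\le d\le c-1$. For every $c$-uniform unoriented hypergraph $\Gamma$ with $E\neq\varnothing$ (and no isolated vertices), with smallest normalized Laplacian eigenvalue $\lambda_1$ (which satisfies $\lambda_1<1$), the $d$-proper coloring number satisfies \[ \chi_d(\Gamma)\;\ge\;\frac{c-\lambda_1}{d-\lambda_1}. \] Moreover, the bound is sharp if and only if $d\mid c$: if equality holds for some such $\Gamma$ then $d\mid c$, and conversely if $d\mid c$ then there exists a $c$-uniform unoriented hypergraph for which equality holds.
   Context: A hypergraph has finite vertex set $V$, $|V|=N$, and edge set $E\subseteq\mathcal P(V)$; it is $c$-uniform if $|e|=c$ for all $e\in E$, and unoriented means all vertex–edge incidences have orientation $+1$. The degree $\deg v=|\{e\in E: v\in e\}|$ is assumed $\ge1$; $D=\mathrm{diag}(\deg v)$. The adjacency matrix has $A_{v,v}=0$ and $A_{v,w}=-|\{e\in E: v,w\in e\}|$ for $v\ne w$; the normalized Laplacian is $L=\mathrm{Id}-D^{ -1}A$ with real eigenvalues $\lambda_1\le\dots\le\lambda_N$. For an integer $d\ge1$, a $k$-coloring $V\to\{1,\dots,k\}$ is $d$-proper if every edge contains at most $d$ vertices of each color; $\chi_d(\Gamma)$ is the least $k$ admitting a $d$-proper $k$-coloring. -}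

module Defs where

open import Data.Bool.Base using (if_then_else_)
open import Data.Fin.Base using (Fin)
import Data.Fin.Properties as Fin
open import Data.Fin.Subset using (Subset; _∩_; ∣_∣)
open import Data.Fin.Subset.Properties using (_∈?_)
open import Data.Integer.Base as ℤ using (ℤ; +_)
open import Data.List.Base using (List; []; length; filter)
open import Data.List.Relation.Unary.All using (All)
open import Data.List.Relation.Unary.Unique.Propositional using (Unique)
open import Data.Nat.Base as ℕ using (ℕ)
import Data.Nat.Properties as ℕ
open import Data.Product.Base using (Σ; ∃; _×_; _,_)
open import Data.Rational.Base as ℚ using (ℚ; 0ℚ; 1ℚ; ½)
import Data.Rational.Properties as ℚ
open import Data.Rational.Solver using (module +-*-Solver)
open import Data.Sum.Base using (_⊎_)
open import Data.Vec.Base using (tabulate)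
import Data.Vec.Functional as Vector
open import Relation.Binary.PropositionalEquality using (_≡_; _≢_; refl; sym; trans; cong; cong₂; subst; module ≡-Reasoning)
open import Relation.Nullary.Decidable using (does; _×-dec_)

-- Real numbers are Cauchy sequences of rationals, compared by the setoid
-- equality _≈ℝ_ rather than _≡_.

Cauchy : (ℕ → ℚ) → Set
Cauchy x = ∀ ε → 0ℚ ℚ.< ε →
  ∃ λ M → ∀ m n → M ℕ.≤ m → M ℕ.≤ n → ℚ.∣ x m ℚ.- x n ∣ ℚ.≤ ε

record ℝ : Set where
  constructor mkℝ
  field
    seq    : ℕ → ℚ
    cauchy : Cauchy seq

open ℝ public

infix  4 _≈ℝ_ _≤ℝ_ _<ℝ_ _#ℝ_
infixl 6 _+ℝ_ _-ℝ_
infixl 7 _*ℝ_ _÷ℝ_⟨_⟩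

_≈ℝ_ : ℝ → ℝ → Set
x ≈ℝ y = ∀ ε → 0ℚ ℚ.< ε →
  ∃ λ M → ∀ n → M ℕ.≤ n → ℚ.∣ seq x n ℚ.- seq y n ∣ ℚ.≤ ε

_≤ℝ_ : ℝ → ℝ → Set
x ≤ℝ y = ∀ ε → 0ℚ ℚ.< ε →
  ∃ λ M → ∀ n → M ℕ.≤ n → seq x n ℚ.≤ seq y n ℚ.+ ε

_<ℝ_ : ℝ → ℝ → Set
x <ℝ y = Σ ℚ λ ε → 0ℚ ℚ.< ε ×
  ∃ λ M → ∀ n → M ℕ.≤ n → seq x n ℚ.+ ε ℚ.≤ seq y n

-- Apartness, the constructive form of x ≠ y.
_#ℝ_ : ℝ → ℝ → Set
x #ℝ y = x <ℝ y ⊎ y <ℝ x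

private
  open +-*-Solver using (solve; _:+_; _:*_; _:-_; _:=_)

  +-swap : ∀ a b c d → (a ℚ.+ b) ℚ.- (c ℚ.+ d) ≡ (a ℚ.- c) ℚ.+ (b ℚ.- d)
  +-swap = solve 4 (λ a b c d → (a :+ b) :- (c :+ d) := (a :- c) :+ (b :- d)) refl

  +-split : ∀ a b → a ≡ (a ℚ.- b) ℚ.+ b
  +-split = solve 2 (λ a b → a := (a :- b) :+ b) refl

  *-split : ∀ a b c d → a ℚ.* b ℚ.- c ℚ.* d ≡ a ℚ.* (b ℚ.- d) ℚ.+ d ℚ.* (a ℚ.- c)
  *-split = solve 4 (λ a b c d → a :* b :- c :* d := a :* (b :- d) :+ d :* (a :- c)) refl

  recip-split : ∀ a b c d → a ℚ.* (d ℚ.* b) ℚ.- b ℚ.* (c ℚ.* a) ≡ (a ℚ.* b) ℚ.* (d ℚ.- c)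
  recip-split = solve 4 (λ a b c d → a :* (d :* b) :- b :* (c :* a) := (a :* b) :* (d :- c)) refl

  *-swap : ∀ a b c → a ℚ.* (b ℚ.* c) ≡ (b ℚ.* a) ℚ.* c
  *-swap = solve 3 (λ a b c → a :* (b :* c) := (b :* a) :* c) refl

  half-pos : ∀ ε → 0ℚ ℚ.< ε → 0ℚ ℚ.< ½ ℚ.* ε
  half-pos ε 0<ε = ℚ.positive⁻¹ _ {{ℚ.pos*pos⇒pos ½ ε {{ℚ.positive 0<ε}}}}

  halves : ∀ ε → ½ ℚ.* ε ℚ.+ ½ ℚ.* ε ≡ ε
  halves ε = trans (sym (ℚ.*-distribʳ-+ ε ½ ½)) (ℚ.*-identityˡ ε)

  *-mono : ∀ {a b c d} → 0ℚ ℚ.≤ a → a ℚ.≤ b → 0ℚ ℚ.≤ c → c ℚ.≤ d → a ℚ.* c ℚ.≤ b ℚ.* d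
  *-mono {a} {b} {c} {d} 0≤a a≤b 0≤c c≤d = ℚ.≤-trans
    (ℚ.*-monoʳ-≤-nonNeg c {{ℚ.nonNegative 0≤c}} a≤b)
    (ℚ.*-monoˡ-≤-nonNeg b {{ℚ.nonNegative (ℚ.≤-trans 0≤a a≤b)}} c≤d)

  cauchy-const : ∀ q → Cauchy (λ _ → q)
  cauchy-const q ε 0<ε = 0 , λ _ _ _ _ →
    subst (λ z → ℚ.∣ z ∣ ℚ.≤ ε) (sym (ℚ.+-inverseʳ q)) (ℚ.<⇒≤ 0<ε)

  cauchy-neg : ∀ {x} → Cauchy x → Cauchy (λ n → ℚ.- x n)
  cauchy-neg {x} cx ε 0<ε with cx ε 0<ε
  ... | M , h = M , λ m n p q → subst (ℚ._≤ ε) (sym (eq m n)) (h m n p q)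
    where
    eq : ∀ m n → ℚ.∣ ℚ.- x m ℚ.- (ℚ.- x n) ∣ ≡ ℚ.∣ x m ℚ.- x n ∣
    eq m n = trans (cong ℚ.∣_∣ (sym (ℚ.neg-distrib-+ (x m) (ℚ.- x n)))) (ℚ.∣-p∣≡∣p∣ _)

  cauchy-+ : ∀ {x y} → Cauchy x → Cauchy y → Cauchy (λ n → x n ℚ.+ y n)
  cauchy-+ {x} {y} cx cy ε 0<ε
    with cx (½ ℚ.* ε) (half-pos ε 0<ε) | cy (½ ℚ.* ε) (half-pos ε 0<ε)
  ... | M , h | K , k = M ℕ.⊔ K , λ m n p q → begin
    ℚ.∣ (x m ℚ.+ y m) ℚ.- (x n ℚ.+ y n) ∣
      ≡⟨ cong ℚ.∣_∣ (+-swap (x m) (y m) (x n) (y n)) ⟩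
    ℚ.∣ (x m ℚ.- x n) ℚ.+ (y m ℚ.- y n) ∣
      ≤⟨ ℚ.∣p+q∣≤∣p∣+∣q∣ (x m ℚ.- x n) (y m ℚ.- y n) ⟩
    ℚ.∣ x m ℚ.- x n ∣ ℚ.+ ℚ.∣ y m ℚ.- y n ∣
      ≤⟨ ℚ.+-mono-≤
           (h m n (ℕ.m⊔n≤o⇒m≤o M K p) (ℕ.m⊔n≤o⇒m≤o M K q))
           (k m n (ℕ.m⊔n≤o⇒n≤o M K p) (ℕ.m⊔n≤o⇒n≤o M K q)) ⟩
    ½ ℚ.* ε ℚ.+ ½ ℚ.* ε
      ≡⟨ halves ε ⟩
    ε ∎
    where open ℚ.≤-Reasoning

  bounded : ∀ {x} → Cauchy x →
    Σ ℚ λ B → 0ℚ ℚ.< B × ∃ λ M → ∀ n → M ℕ.≤ n → ℚ.∣ x n ∣ ℚ.≤ B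
  bounded {x} cx with cx 1ℚ (ℚ.positive⁻¹ 1ℚ)
  ... | M , h = 1ℚ ℚ.+ ℚ.∣ x M ∣ , ℚ.+-mono-<-≤ (ℚ.positive⁻¹ 1ℚ) (ℚ.0≤∣p∣ (x M)) ,
    M , λ n p → begin
      ℚ.∣ x n ∣
        ≡⟨ cong ℚ.∣_∣ (+-split (x n) (x M)) ⟩
      ℚ.∣ (x n ℚ.- x M) ℚ.+ x M ∣
        ≤⟨ ℚ.∣p+q∣≤∣p∣+∣q∣ (x n ℚ.- x M) (x M) ⟩
      ℚ.∣ x n ℚ.- x M ∣ ℚ.+ ℚ.∣ x M ∣
        ≤⟨ ℚ.+-monoˡ-≤ ℚ.∣ x M ∣ (h n M p ℕ.≤-refl) ⟩
      1ℚ ℚ.+ ℚ.∣ x M ∣ ∎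
    where open ℚ.≤-Reasoning

  divide : ∀ B → 0ℚ ℚ.< B → ∀ ε → 0ℚ ℚ.< ε →
    Σ ℚ λ δ → 0ℚ ℚ.< δ × B ℚ.* δ ≡ ε
  divide B 0<B ε 0<ε = invB ℚ.* ε ,
    ℚ.positive⁻¹ _ {{ℚ.pos*pos⇒pos invB {{ℚ.1/pos⇒pos B}} ε {{ℚ.positive 0<ε}}}} ,
    trans (sym (ℚ.*-assoc B invB ε))
      (trans (cong (ℚ._* ε) (ℚ.*-inverseʳ B)) (ℚ.*-identityˡ ε))
    where
    instance
      B-pos : ℚ.Positive B
      B-pos = ℚ.positive 0<B
      B-nonZero : ℚ.NonZero B
      B-nonZero = ℚ.pos⇒nonZero B
    invB : ℚ
    invB = ℚ.1/ B

  *-estimate : ∀ a b c d {B C δ} →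
    ℚ.∣ a ∣ ℚ.≤ B → ℚ.∣ d ∣ ℚ.≤ C → ℚ.∣ b ℚ.- d ∣ ℚ.≤ δ → ℚ.∣ a ℚ.- c ∣ ℚ.≤ δ →
    ℚ.∣ a ℚ.* b ℚ.- c ℚ.* d ∣ ℚ.≤ (B ℚ.+ C) ℚ.* δ
  *-estimate a b c d {B} {C} {δ} a≤B d≤C b-d≤δ a-c≤δ = begin
    ℚ.∣ a ℚ.* b ℚ.- c ℚ.* d ∣
      ≡⟨ cong ℚ.∣_∣ (*-split a b c d) ⟩
    ℚ.∣ a ℚ.* (b ℚ.- d) ℚ.+ d ℚ.* (a ℚ.- c) ∣
      ≤⟨ ℚ.∣p+q∣≤∣p∣+∣q∣ (a ℚ.* (b ℚ.- d)) (d ℚ.* (a ℚ.- c)) ⟩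
    ℚ.∣ a ℚ.* (b ℚ.- d) ∣ ℚ.+ ℚ.∣ d ℚ.* (a ℚ.- c) ∣
      ≡⟨ cong₂ ℚ._+_ (ℚ.∣p*q∣≡∣p∣*∣q∣ a (b ℚ.- d)) (ℚ.∣p*q∣≡∣p∣*∣q∣ d (a ℚ.- c)) ⟩
    ℚ.∣ a ∣ ℚ.* ℚ.∣ b ℚ.- d ∣ ℚ.+ ℚ.∣ d ∣ ℚ.* ℚ.∣ a ℚ.- c ∣
      ≤⟨ ℚ.+-mono-≤
           (*-mono (ℚ.0≤∣p∣ a) a≤B (ℚ.0≤∣p∣ (b ℚ.- d)) b-d≤δ)
           (*-mono (ℚ.0≤∣p∣ d) d≤C (ℚ.0≤∣p∣ (a ℚ.- c)) a-c≤δ) ⟩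
    B ℚ.* δ ℚ.+ C ℚ.* δ
      ≡⟨ sym (ℚ.*-distribʳ-+ δ B C) ⟩
    (B ℚ.+ C) ℚ.* δ ∎
    where open ℚ.≤-Reasoning

  cauchy-* : ∀ {x y} → Cauchy x → Cauchy y → Cauchy (λ n → x n ℚ.* y n)
  cauchy-* {x} {y} cx cy ε 0<ε = step₁ (bounded cx) (bounded cy)
    where
    Bounded : (ℕ → ℚ) → Set
    Bounded z = Σ ℚ λ B → 0ℚ ℚ.< B × ∃ λ M → ∀ n → M ℕ.≤ n → ℚ.∣ z n ∣ ℚ.≤ B
    Goal : Set
    Goal = ∃ λ M → ∀ m n → M ℕ.≤ m → M ℕ.≤ n → ℚ.∣ x m ℚ.* y m ℚ.- x n ℚ.* y n ∣ ℚ.≤ ε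
    step₁ : Bounded x → Bounded y → Goal
    step₁ (B , 0<B , M₁ , hB) (C , 0<C , M₂ , hC) =
      step₂ (divide (B ℚ.+ C) (ℚ.+-mono-< 0<B 0<C) ε 0<ε)
      where
      step₂ : (Σ ℚ λ δ → 0ℚ ℚ.< δ × (B ℚ.+ C) ℚ.* δ ≡ ε) → Goal
      step₂ (δ , 0<δ , eq) = step₃ (cx δ 0<δ) (cy δ 0<δ)
        where
        step₃ : (∃ λ M → ∀ m n → M ℕ.≤ m → M ℕ.≤ n → ℚ.∣ x m ℚ.- x n ∣ ℚ.≤ δ) →
                (∃ λ M → ∀ m n → M ℕ.≤ m → M ℕ.≤ n → ℚ.∣ y m ℚ.- y n ∣ ℚ.≤ δ) → Goal
        step₃ (M₃ , h) (M₄ , k) = (M₁ ℕ.⊔ M₂) ℕ.⊔ (M₃ ℕ.⊔ M₄) , λ m n p q →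
          let p₁₂ = ℕ.m⊔n≤o⇒m≤o (M₁ ℕ.⊔ M₂) (M₃ ℕ.⊔ M₄) p
              p₃₄ = ℕ.m⊔n≤o⇒n≤o (M₁ ℕ.⊔ M₂) (M₃ ℕ.⊔ M₄) p
              q₁₂ = ℕ.m⊔n≤o⇒m≤o (M₁ ℕ.⊔ M₂) (M₃ ℕ.⊔ M₄) q
              q₃₄ = ℕ.m⊔n≤o⇒n≤o (M₁ ℕ.⊔ M₂) (M₃ ℕ.⊔ M₄) q
          in subst (ℚ.∣ x m ℚ.* y m ℚ.- x n ℚ.* y n ∣ ℚ.≤_) eq
               (*-estimate (x m) (y m) (x n) (y n)
                 (hB m (ℕ.m⊔n≤o⇒m≤o M₁ M₂ p₁₂))
                 (hC n (ℕ.m⊔n≤o⇒n≤o M₁ M₂ q₁₂))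
                 (k m n (ℕ.m⊔n≤o⇒n≤o M₃ M₄ p₃₄) (ℕ.m⊔n≤o⇒n≤o M₃ M₄ q₃₄))
                 (h m n (ℕ.m⊔n≤o⇒m≤o M₃ M₄ p₃₄) (ℕ.m⊔n≤o⇒m≤o M₃ M₄ q₃₄)))

  ⊔-nonZero : ∀ {ε} → 0ℚ ℚ.< ε → ∀ p → ℚ.NonZero (p ℚ.⊔ ε)
  ⊔-nonZero {ε} 0<ε p = ℚ.>-nonZero (ℚ.<-≤-trans 0<ε (ℚ.p≤q⊔p p ε))

fromℚ : ℚ → ℝ
fromℚ q = mkℝ (λ _ → q) (cauchy-const q)

fromℕ : ℕ → ℝ
fromℕ n = fromℚ ((+ n) ℚ./ 1)

0ℝ 1ℝ : ℝ
0ℝ = fromℚ 0ℚ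
1ℝ = fromℚ 1ℚ

_+ℝ_ : ℝ → ℝ → ℝ
x +ℝ y = mkℝ (λ n → seq x n ℚ.+ seq y n) (cauchy-+ {seq x} {seq y} (cauchy x) (cauchy y))

_-ℝ_ : ℝ → ℝ → ℝ
x -ℝ y = mkℝ (λ n → seq x n ℚ.- seq y n)
  (cauchy-+ {seq x} {λ n → ℚ.- seq y n} (cauchy x) (cauchy-neg {seq y} (cauchy y)))

_*ℝ_ : ℝ → ℝ → ℝ
x *ℝ y = mkℝ (λ n → seq x n ℚ.* seq y n) (cauchy-* {seq x} {seq y} (cauchy x) (cauchy y))

-- A proof of 0 < x supplies ε > 0 with ε ≤ xₙ for all large n, so replacing
-- xₙ by max(xₙ, ε) makes every term invertible and changes only finitely many.
recipSeq : (x : ℝ) → 0ℝ <ℝ x → ℕ → ℚ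
recipSeq x (ε , 0<ε , _) n = (ℚ.1/ (seq x n ℚ.⊔ ε)) {{⊔-nonZero 0<ε (seq x n)}}

private
  recip-diff : ∀ r₁ r₂ t₁ t₂ → t₁ ℚ.* r₁ ≡ 1ℚ → t₂ ℚ.* r₂ ≡ 1ℚ →
    r₁ ℚ.- r₂ ≡ (r₁ ℚ.* r₂) ℚ.* (t₂ ℚ.- t₁)
  recip-diff r₁ r₂ t₁ t₂ e₁ e₂ = begin
    r₁ ℚ.- r₂
      ≡⟨ cong₂ ℚ._-_ (ℚ.*-identityʳ r₁) (ℚ.*-identityʳ r₂) ⟨
    r₁ ℚ.* 1ℚ ℚ.- r₂ ℚ.* 1ℚ
      ≡⟨ cong₂ (λ a b → r₁ ℚ.* a ℚ.- r₂ ℚ.* b) e₂ e₁ ⟨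
    r₁ ℚ.* (t₂ ℚ.* r₂) ℚ.- r₂ ℚ.* (t₁ ℚ.* r₁)
      ≡⟨ recip-split r₁ r₂ t₁ t₂ ⟩
    (r₁ ℚ.* r₂) ℚ.* (t₂ ℚ.- t₁) ∎
    where open ≡-Reasoning

  recip-antitone : ∀ r t i ε → t ℚ.* r ≡ 1ℚ → ε ℚ.* i ≡ 1ℚ →
    0ℚ ℚ.≤ r → 0ℚ ℚ.≤ i → ε ℚ.≤ t → r ℚ.≤ i
  recip-antitone r t i ε tr≡1 εi≡1 0≤r 0≤i ε≤t = begin
    r
      ≡⟨ trans (cong (r ℚ.*_) εi≡1) (ℚ.*-identityʳ r) ⟨
    r ℚ.* (ε ℚ.* i)
      ≤⟨ ℚ.*-monoˡ-≤-nonNeg r {{ℚ.nonNegative 0≤r}}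
           (ℚ.*-monoʳ-≤-nonNeg i {{ℚ.nonNegative 0≤i}} ε≤t) ⟩
    r ℚ.* (t ℚ.* i)
      ≡⟨ *-swap r t i ⟩
    (t ℚ.* r) ℚ.* i
      ≡⟨ trans (cong (ℚ._* i) tr≡1) (ℚ.*-identityˡ i) ⟩
    i ∎
    where open ℚ.≤-Reasoning

  recip-estimate : ∀ r₁ r₂ t₁ t₂ {i δ} → t₁ ℚ.* r₁ ≡ 1ℚ → t₂ ℚ.* r₂ ≡ 1ℚ →
    0ℚ ℚ.≤ r₁ → r₁ ℚ.≤ i → 0ℚ ℚ.≤ r₂ → r₂ ℚ.≤ i → ℚ.∣ t₂ ℚ.- t₁ ∣ ℚ.≤ δ →
    ℚ.∣ r₁ ℚ.- r₂ ∣ ℚ.≤ (i ℚ.* i) ℚ.* δ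
  recip-estimate r₁ r₂ t₁ t₂ {i} {δ} e₁ e₂ 0≤r₁ r₁≤i 0≤r₂ r₂≤i h = begin
    ℚ.∣ r₁ ℚ.- r₂ ∣
      ≡⟨ cong ℚ.∣_∣ (recip-diff r₁ r₂ t₁ t₂ e₁ e₂) ⟩
    ℚ.∣ (r₁ ℚ.* r₂) ℚ.* (t₂ ℚ.- t₁) ∣
      ≡⟨ ℚ.∣p*q∣≡∣p∣*∣q∣ (r₁ ℚ.* r₂) (t₂ ℚ.- t₁) ⟩
    ℚ.∣ r₁ ℚ.* r₂ ∣ ℚ.* ℚ.∣ t₂ ℚ.- t₁ ∣
      ≡⟨ cong (ℚ._* ℚ.∣ t₂ ℚ.- t₁ ∣) (trans (ℚ.∣p*q∣≡∣p∣*∣q∣ r₁ r₂)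
           (cong₂ ℚ._*_ (ℚ.0≤p⇒∣p∣≡p 0≤r₁) (ℚ.0≤p⇒∣p∣≡p 0≤r₂))) ⟩
    (r₁ ℚ.* r₂) ℚ.* ℚ.∣ t₂ ℚ.- t₁ ∣
      ≤⟨ ℚ.*-monoʳ-≤-nonNeg ℚ.∣ t₂ ℚ.- t₁ ∣ {{ℚ.∣-∣-nonNeg (t₂ ℚ.- t₁)}}
           (*-mono 0≤r₁ r₁≤i 0≤r₂ r₂≤i) ⟩
    (i ℚ.* i) ℚ.* ℚ.∣ t₂ ℚ.- t₁ ∣
      ≤⟨ ℚ.*-monoˡ-≤-nonNeg (i ℚ.* i) {{ℚ.nonNeg*nonNeg⇒nonNeg i {{i≥0}} i {{i≥0}}}} h ⟩
    (i ℚ.* i) ℚ.* δ ∎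
    where
    open ℚ.≤-Reasoning
    i≥0 : ℚ.NonNegative i
    i≥0 = ℚ.nonNegative (ℚ.≤-trans 0≤r₁ r₁≤i)

  cauchy-recip : ∀ x (0<x : 0ℝ <ℝ x) → Cauchy (recipSeq x 0<x)
  cauchy-recip x 0<x@(ε , 0<ε , M , ε≤x) η 0<η = step₁ (divide (i ℚ.* i) 0<ii η 0<η)
    where
    i : ℚ
    i = (ℚ.1/ ε) {{ℚ.>-nonZero 0<ε}}
    i-pos : ℚ.Positive i
    i-pos = ℚ.1/pos⇒pos ε {{ℚ.positive 0<ε}}
    0<ii : 0ℚ ℚ.< i ℚ.* i
    0<ii = ℚ.positive⁻¹ _ {{ℚ.pos*pos⇒pos i {{i-pos}} i {{i-pos}}}}
    t r : ℕ → ℚ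
    t n = seq x n ℚ.⊔ ε
    r = recipSeq x 0<x
    0<t : ∀ n → 0ℚ ℚ.< t n
    0<t n = ℚ.<-≤-trans 0<ε (ℚ.p≤q⊔p (seq x n) ε)
    0≤r : ∀ n → 0ℚ ℚ.≤ r n
    0≤r n = ℚ.<⇒≤ (ℚ.positive⁻¹ (r n) {{ℚ.1/pos⇒pos (t n) {{ℚ.positive (0<t n)}}}})
    tr≡1 : ∀ n → t n ℚ.* r n ≡ 1ℚ
    tr≡1 n = ℚ.*-inverseʳ (t n) {{⊔-nonZero 0<ε (seq x n)}}
    r≤i : ∀ n → r n ℚ.≤ i
    r≤i n = recip-antitone (r n) (t n) i ε (tr≡1 n) (ℚ.*-inverseʳ ε {{ℚ.>-nonZero 0<ε}})
      (0≤r n) (ℚ.<⇒≤ (ℚ.positive⁻¹ i {{i-pos}})) (ℚ.p≤q⊔p (seq x n) ε)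
    t≡x : ∀ n → M ℕ.≤ n → t n ≡ seq x n
    t≡x n p = ℚ.p≥q⇒p⊔q≡p (subst (ℚ._≤ seq x n) (ℚ.+-identityˡ ε) (ε≤x n p))
    Goal : Set
    Goal = ∃ λ K → ∀ m n → K ℕ.≤ m → K ℕ.≤ n → ℚ.∣ r m ℚ.- r n ∣ ℚ.≤ η
    step₁ : (Σ ℚ λ δ → 0ℚ ℚ.< δ × (i ℚ.* i) ℚ.* δ ≡ η) → Goal
    step₁ (δ , 0<δ , eq) = step₂ (cauchy x δ 0<δ)
      where
      step₂ : (∃ λ K → ∀ m n → K ℕ.≤ m → K ℕ.≤ n → ℚ.∣ seq x m ℚ.- seq x n ∣ ℚ.≤ δ) → Goal
      step₂ (K , k) = M ℕ.⊔ K , λ m n p q →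
        subst (ℚ.∣ r m ℚ.- r n ∣ ℚ.≤_) eq
          (recip-estimate (r m) (r n) (t m) (t n) (tr≡1 m) (tr≡1 n)
            (0≤r m) (r≤i m) (0≤r n) (r≤i n)
            (subst (ℚ._≤ δ)
              (sym (cong₂ (λ a b → ℚ.∣ a ℚ.- b ∣)
                (t≡x n (ℕ.m⊔n≤o⇒m≤o M K q)) (t≡x m (ℕ.m⊔n≤o⇒m≤o M K p))))
              (k n m (ℕ.m⊔n≤o⇒n≤o M K q) (ℕ.m⊔n≤o⇒n≤o M K p))))

recip : (x : ℝ) → 0ℝ <ℝ x → ℝ
recip x 0<x = mkℝ (recipSeq x 0<x) (cauchy-recip x 0<x)

_÷ℝ_⟨_⟩ : (x y : ℝ) → 0ℝ <ℝ y → ℝ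
x ÷ℝ y ⟨ 0<y ⟩ = x *ℝ recip y 0<y

∑ : ∀ {n} → (Fin n → ℝ) → ℝ
∑ = Vector.foldr _+ℝ_ 0ℝ

Matrix : ℕ → Set → Set
Matrix n A = Fin n → Fin n → A

IsEigenvalue : ∀ {n} → Matrix n ℚ → ℝ → Set
IsEigenvalue {n} M μ = Σ (Fin n → ℝ) λ f →
  (∃ λ v → f v #ℝ 0ℝ) ×
  (∀ v → ∑ (λ w → fromℚ (M v w) *ℝ f w) ≈ℝ μ *ℝ f v)

IsSmallestEigenvalue : ∀ {n} → Matrix n ℚ → ℝ → Set
IsSmallestEigenvalue M λ₁ = IsEigenvalue M λ₁ × (∀ μ → IsEigenvalue M μ → λ₁ ≤ℝ μ)

-- Unoriented hypergraphs on the vertex set Fin N.  The edge set is a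
-- repetition-free list of subsets; nothing below depends on its order.
-- All vertex–edge incidences carry orientation +1, so no orientation is
-- recorded and off-diagonal adjacency entries are the negated codegrees.

record Hypergraph (N : ℕ) : Set where
  field
    edges  : List (Subset N)
    unique : Unique edges

  degree : Fin N → ℕ
  degree v = length (filter (v ∈?_) edges)

  codegree : Fin N → Fin N → ℕ
  codegree v w = length (filter (λ e → (v ∈? e) ×-dec (w ∈? e)) edges)

  field
    noIsolated : ∀ v → 1 ℕ.≤ degree v

  adjacency : Matrix N ℤ
  adjacency v w = if does (v Fin.≟ w) then ℤ.0ℤ else ℤ.- (+ codegree v w)

  -- Entries of Id − D⁻¹A.
  laplacian : Matrix N ℚ
  laplacian v w =
    (if does (v Fin.≟ w) then 1ℚ else 0ℚ)
      ℚ.- (adjacency v w ℚ./ degree v) {{ℕ.>-nonZero (noIsolated v)}}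

open Hypergraph public

Uniform : ∀ {N} → ℕ → Hypergraph N → Set
Uniform c Γ = All (λ e → ∣ e ∣ ≡ c) (edges Γ)

NonEmpty : ∀ {N} → Hypergraph N → Set
NonEmpty Γ = edges Γ ≢ []

Coloring : ℕ → ℕ → Set
Coloring N k = Fin N → Fin k

colorClass : ∀ {N k} → Coloring N k → Fin k → Subset N
colorClass κ i = tabulate (λ v → does (κ v Fin.≟ i))

IsProper : ∀ {N k} → ℕ → Hypergraph N → Coloring N k → Set
IsProper d Γ κ = All (λ e → ∀ i → ∣ e ∩ colorClass κ i ∣ ℕ.≤ d) (edges Γ)

ProperlyColorable : ∀ {N} → ℕ → Hypergraph N → ℕ → Set
ProperlyColorable {N} d Γ k = Σ (Coloring N k) (IsProper d Γ)

-- IsColoringNumber d Γ k says χ_d(Γ) = k.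
IsColoringNumber : ∀ {N} → ℕ → Hypergraph N → ℕ → Set
IsColoringNumber d Γ k =
  ProperlyColorable d Γ k × (∀ j → ProperlyColorable d Γ j → k ℕ.≤ j)

hoffman : (c d : ℕ) (λ₁ : ℝ) → 0ℝ <ℝ fromℕ d -ℝ λ₁ → ℝ
hoffman c d λ₁ pos = (fromℕ c -ℝ λ₁) ÷ℝ (fromℕ d -ℝ λ₁) ⟨ pos ⟩

Sharp : ℕ → ℕ → Set
Sharp c d =
  ∃ λ N → Σ (Hypergraph N) λ Γ → Uniform c Γ × NonEmpty Γ ×
  Σ ℝ λ λ₁ → IsSmallestEigenvalue (laplacian Γ) λ₁ ×
  ∃ λ χ → IsColoringNumber d Γ χ ×
  Σ (0ℝ <ℝ fromℕ d -ℝ λ₁) λ pos → fromℕ χ ≈ℝ hoffman c d λ₁ pos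

{-# OPTIONS --safe #-}

-- The bound.  With D the diagonal matrix of degrees and S = D L, the form x ↦ xᵀSx equals
-- Σₑ (Σ_{v ∈ e} xᵥ)², and λ₁ is the minimum of xᵀSx / xᵀDx.  For a d-proper colouring with
-- classes V₁, …, V_χ use the test vectors fᵢ = χ·1_{Vᵢ} − 1 and add up over i: every edge
-- contributes c χ (χ − 1) to the denominators and χ² Σᵢ |e ∩ Vᵢ|² − χ c² ≤ χ c (χ d − c) to the
-- numerators, whence λ₁ (χ − 1) ≤ χ d − c.  Equality forces |e ∩ Vᵢ| ∈ {0, d} for all i, so d ∣ c.
-- The colouring with all vertices distinct and d = 1 gives λ₁ < 1.  A single edge with c = d m
-- vertices has λ₁ = 0 and χ_d = m.
--
-- The variational principle, constructively.  "λ₁ is the least eigenvalue" is turned into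
-- "S − qD is semidefinite for every rational q < λ₁".  Elimination over ℚ decides semidefiniteness
-- of S − tD, so if it failed at q, bisection would produce a Cauchy real m ≤ q, the threshold of
-- semidefiniteness.  Elimination over ℝ, where signs are known up to double negation, shows that
-- S − mD is singular or coercive.  Coercivity contradicts the choice of m, so m would be an
-- eigenvalue below λ₁.

module Submission where

open import Defs
open import Algebra.Bundles using (CommutativeRing)
import Algebra.Properties.Semiring.Sum as SemiringSum
import Algebra.Solver.Ring as RingSolver
open import Algebra.Solver.Ring.AlmostCommutativeRing using (AlmostCommutativeRing; _-Raw-AlmostCommutative⟶_; fromCommutativeRing; -raw-almostCommutative⟶)
open import Data.Bool.Base using (Bool; true; false; _∧_; if_then_else_)
open import Data.Empty using (⊥; ⊥-elim)
open import Data.Fin.Base using (Fin; zero; suc; _↑ˡ_; _↑ʳ_; combine; quotient)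
import Data.Fin.Properties as Fin
open import Data.Fin.Subset using (Subset; _∩_; ∣_∣; ⊤)
open import Data.Fin.Subset.Properties using (_∈?_; ∈⊤; ∣⊤∣≡n)
open import Data.Integer.Base as ℤ using (+_; -[1+_])
import Data.Integer.Properties as ℤ
open import Data.List.Base as List using (List; []; _∷_; length; filter)
open import Data.List.Membership.Propositional.Properties using (∈-lookup)
open import Data.List.Properties using (filter-accept)
open import Data.List.Relation.Unary.All as All using ([]; _∷_)
open import Data.List.Relation.Unary.AllPairs using ([]; _∷_)
open import Data.Maybe.Base as Maybe using (Maybe)
open import Data.Nat.Base as ℕ using (ℕ; zero; suc; _≤_; _∸_)
import Data.Nat.Coprimality as Coprimality
open import Data.Nat.Divisibility using (_∣_; divides; _∣?_; _∣0; ∣-refl; ∣m∣n⇒∣m+n)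
import Data.Nat.Properties as ℕ
open import Data.Product.Base using (Σ; ∃; _×_; _,_; proj₁; proj₂)
open import Data.Rational.Base as ℚ using (ℚ; 0ℚ; 1ℚ; ½; mkℚ)
import Data.Rational.Properties as ℚ
open import Data.Rational.Solver using (module +-*-Solver)
open import Data.Rational.Unnormalised.Base as ℚᵘ using (mkℚᵘ)
import Data.Rational.Unnormalised.Properties as ℚᵘ
open import Data.Sum.Base using (_⊎_; inj₁; inj₂; [_,_]′)
open import Data.Vec.Base as Vec using ([]; _∷_)
import Data.Vec.Functional as Vector
open import Data.Vec.Properties using (lookup-zipWith; lookup∘tabulate; lookup-replicate)
open import Function.Base using (_∘_; id)
open import Function.Bundles using (_⇔_; mk⇔)
open import Level using (0ℓ)
open import Relation.Binary.Consequences using (dec⇒weaklyDec)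
open import Relation.Binary.Definitions using (tri<; tri≈; tri>)
open import Relation.Binary.PropositionalEquality as ≡ using (_≡_; module ≡-Reasoning)
import Relation.Binary.Reasoning.Setoid as SetoidReasoning
open import Relation.Nullary.Decidable using (yes; no; does; _×-dec_; decidable-stable)
open import Relation.Nullary.Negation using (¬_; contradiction)
open import Relation.Unary using (Decidable)

-- Quadratic forms over ordered algebras

-- The hypothesis on λ₁ speaks about eigenvalues only, so a negative value of S - qD must first be
-- turned into an eigenvalue, while signs of reals cannot be decided. The double negations are
-- harmless because elimination over ℝ is used only to refute `IndefiniteAt q`; the wanted
-- inequality q xᵀDx ≤ xᵀSx lies in ℚ, where the sign tests are decisions. Both runs are one
-- algorithm, written once over an ordered algebra whose sign test lives in a monad. Pivots are
-- multiplied through instead of inverted, since a real inverse would need a witness of positivity;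
-- this is why powers of the corner and cleared denominators appear everywhere. Downstream of
-- `rayleigh` all estimates are rational, for rational q < λ₁. The real number λ₁ returns in
-- `bound-from-below`, as a bound on its approximations with an error ε. The equality case therefore
-- cannot argue from exact equality: integrality supplies a gap of fixed size, large enough to
-- absorb the errors.

-- Signs are decided inside a monad M: the identity for ℚ, double negation for ℝ.
record OrderedAlgebra : Set₁ where
  field
    commutativeRing : CommutativeRing 0ℓ 0ℓ
  open CommutativeRing commutativeRing public hiding (zero)
  almostCommutativeRing : AlmostCommutativeRing 0ℓ 0ℓ
  almostCommutativeRing = fromCommutativeRing commutativeRing
  field
    embedding : ℚ.+-*-rawRing -Raw-AlmostCommutative⟶ almostCommutativeRing
    Pos       : Carrier → Set
    Pos-resp  : ∀ {x y} → x ≈ y → Pos x → Pos y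
    Pos-asym  : ∀ {x} → Pos x → ¬ Pos (- x)
    Pos-+     : ∀ {x y} → Pos x → ¬ Pos (- y) → Pos (x + y)
    Pos-*     : ∀ {x y} → Pos x → Pos y → Pos (x * y)
    Pos-1     : Pos 1#
    M         : Set → Set
    pure      : ∀ {A} → A → M A
    _>>=_     : ∀ {A B} → M A → (A → M B) → M B
    run-⊥     : M ⊥ → ⊥
    sign      : ∀ x → M (Pos x ⊎ x ≈ 0# ⊎ Pos (- x))

module QuadraticForms (F : OrderedAlgebra) where
  open OrderedAlgebra F
  open SemiringSum semiring using (sum; sum-cong-≋; sum-replicate-zero; ∑-distrib-+; *-distribˡ-sum)
  open SetoidReasoning setoid

  private
    open _-Raw-AlmostCommutative⟶_ embedding using (⟦_⟧)
    coeff≟ : ∀ p q → Maybe (⟦ p ⟧ ≈ ⟦ q ⟧)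
    coeff≟ p q = Maybe.map (λ p≡q → reflexive (≡.cong ⟦_⟧ p≡q)) (dec⇒weaklyDec ℚ._≟_ p q)

  open RingSolver ℚ.+-*-rawRing almostCommutativeRing embedding coeff≟
    using (solve; _:=_; _:+_; _:*_; _:-_; :-_)

  -- A negated statement, hence stable: any proof of it may split on signs through `bySign`, which
  -- leaves the monad by `run-⊥`.
  Nonneg : Carrier → Set
  Nonneg x = ¬ Pos (- x)

  private
    variable
      n : ℕ
      s t : Carrier

  Nonneg-resp : s ≈ t → Nonneg s → Nonneg t
  Nonneg-resp x≈y 0≤x -y>0 = 0≤x (Pos-resp (-‿cong (sym x≈y)) -y>0)

  bySign : ∀ x → ¬ ¬ (Pos x ⊎ x ≈ 0# ⊎ Pos (- x))
  bySign x k = run-⊥ (sign x >>= (pure ∘ k))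

  -‿zero : s ≈ 0# → - s ≈ 0#
  -‿zero {x} x≈0 = begin
    - x       ≈⟨ +-identityˡ (- x) ⟨
    0# + - x  ≈⟨ +-congʳ x≈0 ⟨
    x + - x   ≈⟨ -‿inverseʳ x ⟩
    0#        ∎

  Pos⇒Nonneg : Pos s → Nonneg s
  Pos⇒Nonneg = Pos-asym

  zero⇒Nonneg : s ≈ 0# → Nonneg s
  zero⇒Nonneg x≈0 -x>0 = Pos-asym -x>0 (Pos-resp (trans (-‿zero x≈0) (sym (-‿zero (-‿zero x≈0)))) -x>0)

  Nonneg-+ : Nonneg s → Nonneg t → Nonneg (s + t)
  Nonneg-+ {x} {y} 0≤x 0≤y s = bySign x λ where
    (inj₁ x>0) → 0≤y (Pos-resp (solve 2 (λ x y → :- (x :+ y) :+ x := :- y) refl x y) (Pos-+ s (Pos⇒Nonneg x>0)))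
    (inj₂ (inj₁ x≈0)) → 0≤y (Pos-resp (-‿cong (trans (+-congʳ x≈0) (+-identityˡ y))) s)
    (inj₂ (inj₂ -x>0)) → 0≤x -x>0

  Nonneg-* : Nonneg s → Nonneg t → Nonneg (s * t)
  Nonneg-* {x} {y} 0≤x 0≤y s = bySign x λ where
    (inj₁ x>0) → bySign y λ where
      (inj₁ y>0) → Pos-asym (Pos-* x>0 y>0) s
      (inj₂ (inj₁ y≈0)) → zero⇒Nonneg (trans (*-congˡ y≈0) (zeroʳ x)) s
      (inj₂ (inj₂ -y>0)) → 0≤y -y>0
    (inj₂ (inj₁ x≈0)) → zero⇒Nonneg (trans (*-congʳ x≈0) (zeroˡ y)) s
    (inj₂ (inj₂ -x>0)) → 0≤x -x>0

  Pos-square : Pos s ⊎ Pos (- s) → Pos (s * s)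
  Pos-square (inj₁ x>0) = Pos-* x>0 x>0
  Pos-square {x} (inj₂ -x>0) = Pos-resp (solve 1 (λ x → (:- x) :* (:- x) := x :* x) refl x) (Pos-* -x>0 -x>0)

  Nonneg-square : ∀ x → Nonneg (x * x)
  Nonneg-square x s = bySign x λ where
    (inj₁ x>0) → Pos-asym (Pos-square (inj₁ x>0)) s
    (inj₂ (inj₁ x≈0)) → zero⇒Nonneg (trans (*-congʳ x≈0) (zeroˡ x)) s
    (inj₂ (inj₂ -x>0)) → Pos-asym (Pos-square (inj₂ -x>0)) s

  Nonneg-cancel : Pos s → Nonneg (s * t) → Nonneg t
  Nonneg-cancel {x} {y} x>0 0≤xy -y>0 =
    0≤xy (Pos-resp (solve 2 (λ x y → x :* (:- y) := :- (x :* y)) refl x y) (Pos-* x>0 -y>0))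

  Nonneg-sum : (f : Fin n → Carrier) → (∀ i → Nonneg (f i)) → Nonneg (sum f)
  Nonneg-sum {zero}  f 0≤f = zero⇒Nonneg refl
  Nonneg-sum {suc n} f 0≤f = Nonneg-+ (0≤f zero) (Nonneg-sum (f ∘ suc) (0≤f ∘ suc))

  term≤sum : (f : Fin n → Carrier) → (∀ i → Nonneg (f i)) → ∀ i → Nonneg (sum f - f i)
  term≤sum {suc n} f 0≤f zero = Nonneg-resp
    (solve 2 (λ s f₀ → s := f₀ :+ s :- f₀) refl (sum (f ∘ suc)) (f zero)) (Nonneg-sum (f ∘ suc) (0≤f ∘ suc))
  term≤sum {suc n} f 0≤f (suc i) = Nonneg-resp
    (solve 3 (λ s f₀ fᵢ → f₀ :+ (s :- fᵢ) := f₀ :+ s :- fᵢ) refl (sum (f ∘ suc)) (f zero) (f (suc i)))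
    (Nonneg-+ (0≤f zero) (term≤sum (f ∘ suc) (0≤f ∘ suc) i))

  sum-zero : (f : Fin n → Carrier) → (∀ i → f i ≈ 0#) → sum f ≈ 0#
  sum-zero {n} f f≈0 = trans (sum-cong-≋ f≈0) (sum-replicate-zero n)

  sum-lin : ∀ α β (f g : Fin n → Carrier) → sum (λ i → α * f i - β * g i) ≈ α * sum f - β * sum g
  sum-lin {zero}  α β f g = begin
    0#                 ≈⟨ -‿inverseʳ 0# ⟨
    0# - 0#            ≈⟨ +-cong (zeroʳ α) (-‿cong (zeroʳ β)) ⟨
    α * 0# - β * 0#    ∎
  sum-lin {suc n} α β f g = begin
    α * f zero - β * g zero + sum (λ i → α * f (suc i) - β * g (suc i))
      ≈⟨ +-congˡ (sum-lin α β (f ∘ suc) (g ∘ suc)) ⟩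
    α * f zero - β * g zero + (α * sum (f ∘ suc) - β * sum (g ∘ suc))
      ≈⟨ solve 6 (λ α β f₀ g₀ f g → α :* f₀ :- β :* g₀ :+ (α :* f :- β :* g) := α :* (f₀ :+ f) :- β :* (g₀ :+ g))
           refl α β (f zero) (g zero) (sum (f ∘ suc)) (sum (g ∘ suc)) ⟩
    α * sum f - β * sum g ∎

  Vec Mat : ℕ → Set
  Vec n = Fin n → Carrier
  Mat n = Fin n → Fin n → Carrier

  Symmetric : Mat n → Set
  Symmetric T = ∀ i j → T i j ≈ T j i

  infixl 7 _·_
  _·_ : Vec n → Vec n → Carrier
  x · y = sum (λ i → x i * y i)

  form : Mat n → Vec n → Carrier
  form T x = sum (λ i → x i * (T i · x))

  norm² : Vec n → Carrier
  norm² x = x · x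

  ·-scale : ∀ a (x y : Vec n) → x · (λ i → a * y i) ≈ a * (x · y)
  ·-scale a x y = begin
    sum (λ i → x i * (a * y i))  ≈⟨ sum-cong-≋ (λ i → solve 3 (λ x a y → x :* (a :* y) := a :* (x :* y)) refl (x i) a (y i)) ⟩
    sum (λ i → a * (x i * y i))  ≈⟨ *-distribˡ-sum a (λ i → x i * y i) ⟨
    a * (x · y)                  ∎

  form-scale : ∀ (T : Mat n) a y → form T (λ i → a * y i) ≈ a * (a * form T y)
  form-scale T a y = begin
    sum (λ i → (a * y i) * (T i · (λ j → a * y j)))
      ≈⟨ sum-cong-≋ (λ i → trans (*-congˡ (·-scale a (T i) y))
           (solve 3 (λ a y r → (a :* y) :* (a :* r) := (a :* a) :* (y :* r)) refl a (y i) (T i · y))) ⟩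
    sum (λ i → (a * a) * (y i * (T i · y)))
      ≈⟨ *-distribˡ-sum (a * a) (λ i → y i * (T i · y)) ⟨
    (a * a) * form T y
      ≈⟨ *-assoc a a (form T y) ⟩
    a * (a * form T y) ∎

  form-pencil : ∀ (A B : Mat n) t x → form (λ i j → A i j - t * B i j) x ≈ form A x - t * form B x
  form-pencil A B t x = begin
    sum (λ i → x i * sum (λ j → (A i j - t * B i j) * x j))
      ≈⟨ sum-cong-≋ (λ i → *-congˡ (sum-cong-≋ (λ j → trans
           (solve 4 (λ a t b x → (a :- t :* b) :* x := a :* x :- t :* (b :* x)) refl (A i j) t (B i j) (x j))
           (+-congʳ (sym (*-identityˡ _)))))) ⟩
    sum (λ i → x i * sum (λ j → 1# * (A i j * x j) - t * (B i j * x j)))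
      ≈⟨ sum-cong-≋ (λ i → *-congˡ (sum-lin 1# t (λ j → A i j * x j) (λ j → B i j * x j))) ⟩
    sum (λ i → x i * (1# * (A i · x) - t * (B i · x)))
      ≈⟨ sum-cong-≋ (λ i → solve 5 (λ x o a t b → x :* (o :* a :- t :* b) := o :* (x :* a) :- t :* (x :* b))
           refl (x i) 1# (A i · x) t (B i · x)) ⟩
    sum (λ i → 1# * (x i * (A i · x)) - t * (x i * (B i · x)))
      ≈⟨ sum-lin 1# t (λ i → x i * (A i · x)) (λ i → x i * (B i · x)) ⟩
    1# * form A x - t * form B x
      ≈⟨ +-congʳ (*-identityˡ _) ⟩
    form A x - t * form B x ∎

  -- Symmetric elimination by Schur complements

  corner : Mat (suc n) → Carrier
  corner T = T zero zero

  border : Mat (suc n) → Vec n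
  border T j = T zero (suc j)

  minor : Mat (suc n) → Mat n
  minor T i j = T (suc i) (suc j)

  -- The Schur complement of the corner, scaled by the corner to avoid division.
  schur : Mat (suc n) → Mat n
  schur T i j = corner T * minor T i j - border T i * border T j

  minor-symmetric : (T : Mat (suc n)) → Symmetric T → Symmetric (minor T)
  minor-symmetric T symT i j = symT (suc i) (suc j)

  schur-symmetric : (T : Mat (suc n)) → Symmetric T → Symmetric (schur T)
  schur-symmetric T symT i j =
    +-cong (*-congˡ (symT (suc i) (suc j))) (-‿cong (*-comm (border T i) (border T j)))

  form-split : (T : Mat (suc n)) → Symmetric T → ∀ x → let u = border T · (x ∘ suc) in
    form T x ≈ form (minor T) (x ∘ suc) + x zero * (corner T * x zero + u + u)
  form-split T symT x = begin
    x₀ * (a * x₀ + u) + sum (λ i → y i * (T (suc i) zero * x₀ + minor T i · y))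
      ≈⟨ +-congˡ (sum-cong-≋ (λ i → trans (*-congˡ (+-congʳ (*-congʳ (symT (suc i) zero))))
           (solve 4 (λ y b x r → y :* (b :* x :+ r) := x :* (b :* y) :+ y :* r) refl (y i) (border T i) x₀ (minor T i · y)))) ⟩
    x₀ * (a * x₀ + u) + sum (λ i → x₀ * (border T i * y i) + y i * (minor T i · y))
      ≈⟨ +-congˡ (∑-distrib-+ (λ i → x₀ * (border T i * y i)) (λ i → y i * (minor T i · y))) ⟩
    x₀ * (a * x₀ + u) + (sum (λ i → x₀ * (border T i * y i)) + form (minor T) y)
      ≈⟨ +-congˡ (+-congʳ (*-distribˡ-sum x₀ (λ i → border T i * y i))) ⟨
    x₀ * (a * x₀ + u) + (x₀ * u + form (minor T) y)
      ≈⟨ solve 4 (λ x a u q → x :* (a :* x :+ u) :+ (x :* u :+ q) := q :+ x :* (a :* x :+ u :+ u)) refl x₀ a u (form (minor T) y) ⟩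
    form (minor T) y + x₀ * (a * x₀ + u + u) ∎
    where
    x₀ = x zero
    a  = corner T
    y  = x ∘ suc
    u  = border T · y

  schur-row : (T : Mat (suc n)) → ∀ y i →
    schur T i · y ≈ corner T * (minor T i · y) - border T i * (border T · y)
  schur-row T y i = begin
    sum (λ j → (a * minor T i j - border T i * border T j) * y j)
      ≈⟨ sum-cong-≋ (λ j → solve 5 (λ a c b b′ y → (a :* c :- b :* b′) :* y := a :* (c :* y) :- b :* (b′ :* y))
           refl a (minor T i j) (border T i) (border T j) (y j)) ⟩
    sum (λ j → a * (minor T i j * y j) - border T i * (border T j * y j))
      ≈⟨ sum-lin a (border T i) (λ j → minor T i j * y j) (λ j → border T j * y j) ⟩
    a * (minor T i · y) - border T i * (border T · y) ∎
    where a = corner T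

  form-schur : (T : Mat (suc n)) → ∀ y → let u = border T · y in
    form (schur T) y ≈ corner T * form (minor T) y - u * u
  form-schur T y = begin
    sum (λ i → y i * (schur T i · y))
      ≈⟨ sum-cong-≋ (λ i → trans (*-congˡ (schur-row T y i))
           (solve 5 (λ y a r b u → y :* (a :* r :- b :* u) := a :* (y :* r) :- u :* (b :* y))
             refl (y i) a (minor T i · y) (border T i) u)) ⟩
    sum (λ i → a * (y i * (minor T i · y)) - u * (border T i * y i))
      ≈⟨ sum-lin a u (λ i → y i * (minor T i · y)) (λ i → border T i * y i) ⟩
    a * form (minor T) y - u * u ∎
    where
    a = corner T
    u = border T · y

  -- With corner a, u = b · y and q the form of the minor, a (a x₀² + 2 u x₀ + q) = (a x₀ + u)² + (a
  -- q - u²), and the last bracket is the Schur form.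
  complete-square : (T : Mat (suc n)) → Symmetric T → ∀ x →
    let w = corner T * x zero + border T · (x ∘ suc) in
    corner T * form T x ≈ w * w + form (schur T) (x ∘ suc)
  complete-square T symT x = begin
    a * form T x
      ≈⟨ *-congˡ (form-split T symT x) ⟩
    a * (q + x₀ * (a * x₀ + u + u))
      ≈⟨ solve 4 (λ a q x u → a :* (q :+ x :* (a :* x :+ u :+ u))
           := (a :* x :+ u) :* (a :* x :+ u) :+ (a :* q :- u :* u)) refl a q x₀ u ⟩
    (a * x₀ + u) * (a * x₀ + u) + (a * q - u * u)
      ≈⟨ +-congˡ (form-schur T (x ∘ suc)) ⟨
    (a * x₀ + u) * (a * x₀ + u) + form (schur T) (x ∘ suc) ∎
    where
    x₀ = x zero
    a  = corner T
    u  = border T · (x ∘ suc)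
    q  = form (minor T) (x ∘ suc)

  -- Only the existence of a constant matters, so the sharp Cauchy–Schwarz bound is not needed.
  ·-bounded : (b : Vec n) → ∃ λ B → Nonneg B × ∀ y → Nonneg (B * norm² y - (b · y) * (b · y))
  ·-bounded {zero}  b = 0# , zero⇒Nonneg refl , λ y → zero⇒Nonneg (-‿inverseʳ (0# * 0#))
  ·-bounded {suc n} b with ·-bounded (b ∘ suc)
  ... | B , 0≤B , bound = B′ , Nonneg-+ (Nonneg-+ 0≤b₀² 0≤b₀²) (Nonneg-+ 0≤B 0≤B) , λ y →
    let y₀ = y zero
        Y  = norm² (y ∘ suc)
        u  = (b ∘ suc) · (y ∘ suc)
        d  = b₀ * y₀ - u
        0≤r = bound (y ∘ suc)
    in Nonneg-resp
      (solve 5 (λ b y B Y u →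
          (b :* y :- u) :* (b :* y :- u) :+ ((B :* Y :- u :* u) :+ (B :* Y :- u :* u)
            :+ ((B :+ B) :* (y :* y) :+ (b :* b :+ b :* b) :* Y))
          := ((b :* b :+ b :* b) :+ (B :+ B)) :* (y :* y :+ Y) :- (b :* y :+ u) :* (b :* y :+ u))
        refl b₀ y₀ B Y u)
      (Nonneg-+ (Nonneg-square d) (Nonneg-+ (Nonneg-+ 0≤r 0≤r)
        (Nonneg-+ (Nonneg-* (Nonneg-+ 0≤B 0≤B) (Nonneg-square y₀))
          (Nonneg-* (Nonneg-+ 0≤b₀² 0≤b₀²) (Nonneg-sum (λ i → y (suc i) * y (suc i)) (λ i → Nonneg-square (y (suc i))))))))
    where
    b₀ = b zero
    0≤b₀² = Nonneg-square b₀
    -- The doubling comes from (b₀ y₀ + u)² ≤ 2 (b₀ y₀)² + 2 u², whose deficit is the square of d =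
    -- b₀ y₀ - u.
    B′ = (b₀ * b₀ + b₀ * b₀) + (B + B)

  norm²-nonneg : (x : Vec n) → Nonneg (norm² x)
  norm²-nonneg x = Nonneg-sum (λ i → x i * x i) (λ i → Nonneg-square (x i))

  -- `Coercive` is the bound form T x ≥ (L / K) ‖x‖² with the denominator cleared; being
  -- quantitative, it survives a small change of T, which `not-coercive` exploits. `Singular` asks
  -- for an entry of known sign, so that the kernel vector counts as an eigenvector.
  Indefinite Semidefinite Singular Coercive : Mat n → Set
  Indefinite T   = ∃ λ x → ¬ Nonneg (form T x)
  Semidefinite T = ∀ x → Nonneg (form T x)
  Singular T     = ∃ λ x → (∃ λ i → Pos (x i) ⊎ Pos (- x i)) × (∀ i → T i · x ≈ 0#)
  Coercive T     = ∃ λ L → ∃ λ K → Pos L × Pos K × (∀ x → Nonneg (K * form T x - L * norm² x))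

  Classification : Mat n → Set
  Classification T = Indefinite T ⊎ Semidefinite T × (Singular T ⊎ Coercive T)

  module PositiveCorner (T : Mat (suc n)) (symT : Symmetric T) (a>0 : Pos (corner T)) where
    private
      a = corner T
      b = border T

    -- Solves a x₀ + b · x′ = 0, so that the completed square vanishes and only the Schur form is
    -- left; taking x′ = a y makes x₀ = - b · y free of division.
    lift : Vec n → Vec (suc n)
    lift y = - (b · y) Vector.∷ (λ i → a * y i)

    lift-orthogonal : ∀ y → a * (- (b · y)) + b · (λ i → a * y i) ≈ 0#
    lift-orthogonal y = begin
      a * (- (b · y)) + b · (λ i → a * y i)  ≈⟨ +-congˡ (·-scale a b y) ⟩
      a * (- (b · y)) + a * (b · y)          ≈⟨ distribˡ a (- (b · y)) (b · y) ⟨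
      a * (- (b · y) + b · y)                ≈⟨ *-congˡ (-‿inverseˡ (b · y)) ⟩
      a * 0#                                 ≈⟨ zeroʳ a ⟩
      0#                                     ∎

    form-lift : ∀ y → a * form T (lift y) ≈ a * (a * form (schur T) y)
    form-lift y = begin
      a * form T (lift y)                          ≈⟨ complete-square T symT (lift y) ⟩
      w * w + form (schur T) (λ i → a * y i)       ≈⟨ +-congʳ (trans (*-congʳ (lift-orthogonal y)) (zeroˡ w)) ⟩
      0# + form (schur T) (λ i → a * y i)          ≈⟨ +-identityˡ _ ⟩
      form (schur T) (λ i → a * y i)               ≈⟨ form-scale (schur T) a y ⟩
      a * (a * form (schur T) y)                   ∎
      where w = a * (- (b · y)) + b · (λ i → a * y i)

    indefinite : Indefinite (schur T) → Indefinite T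
    indefinite (y , ¬0≤q) = lift y , λ 0≤q → ¬0≤q
      (Nonneg-cancel a>0 (Nonneg-cancel a>0 (Nonneg-resp (form-lift y) (Nonneg-* (Pos⇒Nonneg a>0) 0≤q))))

    semidefinite : Semidefinite (schur T) → Semidefinite T
    semidefinite psd x = Nonneg-cancel a>0 (Nonneg-resp (sym (complete-square T symT x))
      (Nonneg-+ (Nonneg-square _) (psd (x ∘ suc))))

    singular : Singular (schur T) → Singular T
    singular (y , (i , yᵢ#0) , ker) = lift y , (suc i , nonzero yᵢ#0) , rows
      where
      nonzero : Pos (y i) ⊎ Pos (- y i) → Pos (a * y i) ⊎ Pos (- (a * y i))
      nonzero (inj₁ p) = inj₁ (Pos-* a>0 p)
      nonzero (inj₂ p) = inj₂ (Pos-resp (solve 2 (λ a y → a :* (:- y) := :- (a :* y)) refl a (y i)) (Pos-* a>0 p))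
      rows : ∀ i → T i · lift y ≈ 0#
      rows zero    = lift-orthogonal y
      rows (suc j) = begin
        T (suc j) zero * (- (b · y)) + minor T j · (λ i → a * y i)
          ≈⟨ +-cong (*-congʳ (symT (suc j) zero)) (·-scale a (minor T j) y) ⟩
        b j * (- (b · y)) + a * (minor T j · y)
          ≈⟨ solve 4 (λ b u a r → b :* (:- u) :+ a :* r := a :* r :- b :* u) refl (b j) (b · y) a (minor T j · y) ⟩
        a * (minor T j · y) - b j * (b · y)
          ≈⟨ schur-row T y j ⟨
        schur T j · y
          ≈⟨ ker j ⟩
        0# ∎

    -- Since a x₀ = w - u, one has (a x₀)² ≤ 2 w² + 2 u², where u² ≤ B Y and L Y ≤ K s. Hence L a²
    -- (x₀² + Y) ≤ 2 L w² + (2 B + a²) L Y ≤ 2 L w² + G K s. The constant K′ = 2 L + G K dominates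
    -- both coefficients, and w² + s is a times the form of T; one factor a cancels.
    coercive : Semidefinite (schur T) → Coercive (schur T) → Coercive T
    coercive psd (L , K , L>0 , K>0 , bound) = coercive′ (·-bounded b)
      where
      coercive′ : (∃ λ B → Nonneg B × ∀ y → Nonneg (B * norm² y - (b · y) * (b · y))) → Coercive T
      coercive′ (B , 0≤B , cs) = a * L , K′ , Pos-* a>0 L>0 , K′>0 , λ x →
          let x₀ = x zero
              y  = x ∘ suc
              u  = b · y
              w  = a * x₀ + u
              s  = form (schur T) y
              Y  = norm² y
          in Nonneg-cancel a>0 (Nonneg-resp
            (begin
              (G * K) * (w * w) + (L + L) * s + L * ((w + u) * (w + u)) + G * (K * s - L * Y) + (L + L) * (B * Y - u * u)
                ≈⟨ solve 8 (λ a x u s Y L K B →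
                     let w = a :* x :+ u
                         G = (B :+ B) :+ a :* a
                     in (G :* K) :* (w :* w) :+ (L :+ L) :* s :+ L :* ((w :+ u) :* (w :+ u)) :+ G :* (K :* s :- L :* Y)
                          :+ (L :+ L) :* (B :* Y :- u :* u)
                        := ((L :+ L) :+ G :* K) :* (w :* w :+ s) :- a :* ((a :* L) :* (x :* x :+ Y)))
                     refl a x₀ u s Y L K B ⟩
              K′ * (w * w + s) - a * ((a * L) * (x₀ * x₀ + Y))
                ≈⟨ +-congʳ (*-congˡ (complete-square T symT x)) ⟨
              K′ * (a * form T x) - a * ((a * L) * (x₀ * x₀ + Y))
                ≈⟨ solve 4 (λ k a q m → k :* (a :* q) :- a :* m := a :* (k :* q :- m))
                     refl K′ a (form T x) ((a * L) * (x₀ * x₀ + Y)) ⟩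
              a * (K′ * form T x - (a * L) * (x₀ * x₀ + Y)) ∎)
            (Nonneg-+ (Nonneg-+ (Nonneg-+ (Nonneg-+
              (Nonneg-* 0≤GK (Nonneg-square w))
              (Nonneg-* 0≤2L (psd y)))
              (Nonneg-* (Pos⇒Nonneg L>0) (Nonneg-square (w + u))))
              (Nonneg-* 0≤G (bound y)))
              (Nonneg-* 0≤2L (cs y))))
        where
        G K′ : Carrier
        G  = (B + B) + a * a
        K′ = (L + L) + G * K
        0≤2L : Nonneg (L + L)
        0≤2L = Nonneg-+ (Pos⇒Nonneg L>0) (Pos⇒Nonneg L>0)
        0≤G : Nonneg G
        0≤G = Nonneg-+ (Nonneg-+ 0≤B 0≤B) (Nonneg-square a)
        0≤GK : Nonneg (G * K)
        0≤GK = Nonneg-* 0≤G (Pos⇒Nonneg K>0)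
        K′>0 : Pos K′
        K′>0 = Pos-+ (Pos-+ L>0 (Pos⇒Nonneg L>0)) 0≤GK

    classify : Classification (schur T) → Classification T
    classify (inj₁ indef) = inj₁ (indefinite indef)
    classify (inj₂ (psd , inj₁ sing)) = inj₂ (semidefinite psd , inj₁ (singular sing))
    classify (inj₂ (psd , inj₂ coer)) = inj₂ (semidefinite psd , inj₂ (coercive psd coer))

  negative-corner : (T : Mat (suc n)) → Symmetric T → Pos (- corner T) → Indefinite T
  negative-corner T symT a<0 = x , λ 0≤q → 0≤q (Pos-resp (-‿cong (sym value)) a<0)
    where
    x : Vec _
    x = 1# Vector.∷ (λ _ → 0#)
    dot0 : ∀ {n} (b : Vec n) → b · (λ _ → 0#) ≈ 0#
    dot0 b = sum-zero (λ i → b i * 0#) (λ i → zeroʳ (b i))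
    u = border T · (λ _ → 0#)
    value : form T x ≈ corner T
    value = begin
      form T x
        ≈⟨ form-split T symT x ⟩
      form (minor T) (λ _ → 0#) + 1# * (corner T * 1# + u + u)
        ≈⟨ +-cong (sum-zero (λ i → 0# * (minor T i · (λ _ → 0#))) (λ i → zeroˡ _)) (*-identityˡ _) ⟩
      0# + (corner T * 1# + u + u)
        ≈⟨ +-identityˡ _ ⟩
      corner T * 1# + u + u
        ≈⟨ +-cong (+-cong (*-identityʳ (corner T)) (dot0 (border T))) (dot0 (border T)) ⟩
      corner T + 0# + 0#
        ≈⟨ trans (+-identityʳ _) (+-identityʳ _) ⟩
      corner T ∎

  module ZeroCorner (T : Mat (suc n)) (symT : Symmetric T) (a≈0 : corner T ≈ 0#) where
    private
      a = corner T
      b = border T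
      β = b · b
      γ = form (minor T) b

    -- At (- (γ + 1), 2 β b) the form takes the value - 4 β².
    nonzero-border : Pos β → Indefinite T
    nonzero-border β>0 = x , λ 0≤q → 0≤q (Pos-resp (sym value) (Pos-+ 2β²>0 (Pos⇒Nonneg 2β²>0)))
      where
      x : Vec _
      x = - (γ + 1#) Vector.∷ (λ i → (β + β) * b i)
      2β²>0 : Pos (β * β + β * β)
      2β²>0 = Pos-+ (Pos-* β>0 β>0) (Pos⇒Nonneg (Pos-* β>0 β>0))
      u : Carrier
      u = b · (λ i → (β + β) * b i)
      value : - form T x ≈ (β * β + β * β) + (β * β + β * β)
      value = begin
        - form T x
          ≈⟨ -‿cong (form-split T symT x) ⟩
        - (form (minor T) (λ i → (β + β) * b i) + (- (γ + 1#)) * (a * (- (γ + 1#)) + u + u))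
          ≈⟨ -‿cong (+-cong (form-scale (minor T) (β + β) b) (*-congˡ
               (+-cong (+-cong (trans (*-congʳ a≈0) (zeroˡ _)) (·-scale (β + β) b b)) (·-scale (β + β) b b)))) ⟩
        - ((β + β) * ((β + β) * γ) + (- (γ + 1#)) * (0# + (β + β) * β + (β + β) * β))
          ≈⟨ -‿cong (+-congˡ (*-congˡ (+-congʳ (+-identityˡ _)))) ⟩
        - ((β + β) * ((β + β) * γ) + (- (γ + 1#)) * ((β + β) * β + (β + β) * β))
          ≈⟨ solve 3 (λ β γ e → :- ((β :+ β) :* ((β :+ β) :* γ) :+ (:- (γ :+ e)) :* ((β :+ β) :* β :+ (β :+ β) :* β))
               := e :* ((β :* β :+ β :* β) :+ (β :* β :+ β :* β))) refl β γ 1# ⟩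
        1# * ((β * β + β * β) + (β * β + β * β))
          ≈⟨ *-identityˡ _ ⟩
        (β * β + β * β) + (β * β + β * β) ∎

    -- Each square is at most the vanishing sum β, so neither strict sign is possible for an entry;
    -- the finitely many sign tests are sequenced inside `M`.
    border-zero : β ≈ 0# → M (∀ i → b i ≈ 0#)
    border-zero β≈0 = sequence (λ i → sign (b i) >>= (pure ∘ only-zero i))
      where
      sequence : ∀ {n} {P : Fin n → Set} → (∀ i → M (P i)) → M (∀ i → P i)
      sequence {zero}  f = pure (λ ())
      sequence {suc n} f = f zero >>= λ p → sequence (f ∘ suc) >>= λ ps → pure λ where
        zero    → p
        (suc i) → ps i
      square-not-positive : ∀ i → ¬ Pos (b i * b i)
      square-not-positive i b²>0 = term≤sum (λ i → b i * b i) (λ i → Nonneg-square (b i)) i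
        (Pos-resp (trans (solve 1 (λ s → s := :- (:- s)) refl (b i * b i))
          (-‿cong (trans (sym (+-identityˡ _)) (+-congʳ (sym β≈0))))) b²>0)
      only-zero : ∀ i → Pos (b i) ⊎ b i ≈ 0# ⊎ Pos (- b i) → b i ≈ 0#
      only-zero i (inj₁ p)        = ⊥-elim (square-not-positive i (Pos-square (inj₁ p)))
      only-zero i (inj₂ (inj₁ p)) = p
      only-zero i (inj₂ (inj₂ p)) = ⊥-elim (square-not-positive i (Pos-square (inj₂ p)))

    module _ (b≈0 : ∀ i → b i ≈ 0#) where
      private
        form-minor : ∀ x → form T x ≈ form (minor T) (x ∘ suc)
        form-minor x = begin
          form T x
            ≈⟨ form-split T symT x ⟩
          form (minor T) (x ∘ suc) + x zero * (a * x zero + u + u)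
            ≈⟨ +-congˡ (*-congˡ (+-cong (+-cong (trans (*-congʳ a≈0) (zeroˡ _)) u≈0) u≈0)) ⟩
          form (minor T) (x ∘ suc) + x zero * (0# + 0# + 0#)
            ≈⟨ +-congˡ (trans (*-congˡ (trans (+-identityʳ _) (+-identityʳ _))) (zeroʳ _)) ⟩
          form (minor T) (x ∘ suc) + 0#
            ≈⟨ +-identityʳ _ ⟩
          form (minor T) (x ∘ suc) ∎
          where
          u = b · (x ∘ suc)
          u≈0 : u ≈ 0#
          u≈0 = sum-zero (λ i → b i * x (suc i)) (λ i → trans (*-congʳ (b≈0 i)) (zeroˡ _))

        column≈0 : ∀ i → T i zero ≈ 0#
        column≈0 zero    = a≈0
        column≈0 (suc i) = trans (symT (suc i) zero) (b≈0 i)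

        kernel : ∀ i → T i · (1# Vector.∷ (λ _ → 0#)) ≈ 0#
        kernel i = begin
          T i zero * 1# + sum (λ j → T i (suc j) * 0#)
            ≈⟨ +-cong (trans (*-congʳ (column≈0 i)) (zeroˡ 1#)) (sum-zero (λ j → T i (suc j) * 0#) (λ j → zeroʳ _)) ⟩
          0# + 0#
            ≈⟨ +-identityˡ 0# ⟩
          0# ∎

      -- The first basis vector lies in the kernel, so a semidefinite T is singular whichever
      -- alternative holds for the minor.
      classify : Classification (minor T) → Classification T
      classify (inj₁ (y , ¬0≤q)) = inj₁ (0# Vector.∷ y , λ 0≤q → ¬0≤q (Nonneg-resp (form-minor (0# Vector.∷ y)) 0≤q))
      classify (inj₂ (psd , _))  = inj₂
        ( (λ x → Nonneg-resp (sym (form-minor x)) (psd (x ∘ suc)))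
        , inj₁ ((1# Vector.∷ (λ _ → 0#)) , (zero , inj₁ Pos-1) , kernel) )

  -- No search for a pivot is required: a zero corner with a nonzero border already makes the form
  -- negative somewhere, and with a zero border the first variable drops out. The empty form is
  -- coercive, both sides of the bound being zero.
  classify : (T : Mat n) → Symmetric T → M (Classification T)
  classify {zero} T symT = pure (inj₂ ((λ x → zero⇒Nonneg refl) ,
    inj₂ (1# , 1# , Pos-1 , Pos-1 , λ x → zero⇒Nonneg (-‿inverseʳ (1# * 0#)))))
  classify {suc n} T symT = sign (corner T) >>= λ where
    (inj₁ a>0) → classify (schur T) (schur-symmetric T symT) >>= λ c →
      pure (PositiveCorner.classify T symT a>0 c)
    (inj₂ (inj₂ a<0)) → pure (inj₁ (negative-corner T symT a<0))
    (inj₂ (inj₁ a≈0)) → let open ZeroCorner T symT a≈0 renaming (classify to classify₀) in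
      sign (border T · border T) >>= λ where
        (inj₁ β>0) → pure (inj₁ (nonzero-border β>0))
        (inj₂ (inj₁ β≈0)) → border-zero β≈0 >>= λ b≈0 →
          classify (minor T) (minor-symmetric T symT) >>= λ c → pure (classify₀ b≈0 c)
        (inj₂ (inj₂ β<0)) → ⊥-elim (norm²-nonneg (border T) β<0)

open ≡ using (refl; sym; trans; cong; cong₂; subst)
open +-*-Solver using (solve; _:=_; _:+_; _:*_; _:-_; :-_; con)

-- Rational arithmetic and the ordered field of real numbers

-- Rational inequalities are proved by exhibiting the difference of the two sides.

≤-by : ∀ {p q s} → 0ℚ ℚ.≤ s → s ≡ q ℚ.- p → p ℚ.≤ q
≤-by {p} {q} {s} 0≤s eq =
  ≡.subst₂ ℚ._≤_ (ℚ.+-identityˡ p) (solve 2 (λ p q → (q :- p) :+ p := q) refl p q)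
    (ℚ.+-monoˡ-≤ p (subst (0ℚ ℚ.≤_) eq 0≤s))

<-by : ∀ {p q s} → 0ℚ ℚ.< s → s ≡ q ℚ.- p → p ℚ.< q
<-by {p} {q} {s} 0<s eq =
  ≡.subst₂ ℚ._<_ (ℚ.+-identityˡ p) (solve 2 (λ p q → (q :- p) :+ p := q) refl p q)
    (ℚ.+-monoˡ-< p (subst (0ℚ ℚ.<_) eq 0<s))

diff-≥0 : ∀ {p q} → p ℚ.≤ q → 0ℚ ℚ.≤ q ℚ.- p
diff-≥0 {p} {q} p≤q = subst (ℚ._≤ q ℚ.- p) (ℚ.+-inverseʳ p) (ℚ.+-monoˡ-≤ (ℚ.- p) p≤q)

diff->0 : ∀ {p q} → p ℚ.< q → 0ℚ ℚ.< q ℚ.- p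
diff->0 {p} {q} p<q = subst (ℚ._< q ℚ.- p) (ℚ.+-inverseʳ p) (ℚ.+-monoˡ-< (ℚ.- p) p<q)

+-≥0 : ∀ {p q} → 0ℚ ℚ.≤ p → 0ℚ ℚ.≤ q → 0ℚ ℚ.≤ p ℚ.+ q
+-≥0 = ℚ.+-mono-≤

*-≥0 : ∀ {p q} → 0ℚ ℚ.≤ p → 0ℚ ℚ.≤ q → 0ℚ ℚ.≤ p ℚ.* q
*-≥0 {p} {q} 0≤p 0≤q =
  ℚ.nonNegative⁻¹ _ {{ℚ.nonNeg*nonNeg⇒nonNeg p {{ℚ.nonNegative 0≤p}} q {{ℚ.nonNegative 0≤q}}}}

*->0 : ∀ {p q} → 0ℚ ℚ.< p → 0ℚ ℚ.< q → 0ℚ ℚ.< p ℚ.* q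
*->0 {p} {q} 0<p 0<q =
  ℚ.positive⁻¹ _ {{ℚ.pos*pos⇒pos p {{ℚ.positive 0<p}} q {{ℚ.positive 0<q}}}}

square-≥0 : ∀ p → 0ℚ ℚ.≤ p ℚ.* p
square-≥0 p with ℚ.≤-total 0ℚ p
... | inj₁ 0≤p = *-≥0 0≤p 0≤p
... | inj₂ p≤0 = subst (0ℚ ℚ.≤_) (solve 1 (λ p → (:- p) :* (:- p) := p :* p) refl p) (*-≥0 0≤-p 0≤-p)
  where
  0≤-p : 0ℚ ℚ.≤ ℚ.- p
  0≤-p = ℚ.neg-antimono-≤ p≤0

½->0 : ∀ {ε} → 0ℚ ℚ.< ε → 0ℚ ℚ.< ½ ℚ.* ε
½->0 = *->0 (ℚ.positive⁻¹ ½)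

½+½ : ∀ ε → ½ ℚ.* ε ℚ.+ ½ ℚ.* ε ≡ ε
½+½ = solve 1 (λ ε → con ½ :* ε :+ con ½ :* ε := ε) refl

quotient->0 : ∀ {ε B} → 0ℚ ℚ.< B → 0ℚ ℚ.< ε → ∃ λ δ → 0ℚ ℚ.< δ × B ℚ.* δ ≡ ε
quotient->0 {ε} {B} 0<B 0<ε = δ , *->0 0<1/B 0<ε ,
  trans (sym (ℚ.*-assoc B (ℚ.1/ B) ε)) (trans (cong (ℚ._* ε) (ℚ.*-inverseʳ B)) (ℚ.*-identityˡ ε))
  where
  instance
    B-pos : ℚ.Positive B
    B-pos = ℚ.positive 0<B
    B-nonZero : ℚ.NonZero B
    B-nonZero = ℚ.pos⇒nonZero B
  0<1/B : 0ℚ ℚ.< ℚ.1/ B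
  0<1/B = ℚ.positive⁻¹ _ {{ℚ.1/pos⇒pos B}}
  δ : ℚ
  δ = ℚ.1/ B ℚ.* ε

p≤∣p∣ : ∀ p → p ℚ.≤ ℚ.∣ p ∣
p≤∣p∣ p with ℚ.≤-total 0ℚ p
... | inj₁ 0≤p = ℚ.≤-reflexive (sym (ℚ.0≤p⇒∣p∣≡p 0≤p))
... | inj₂ p≤0 = ℚ.≤-trans p≤0 (ℚ.0≤∣p∣ p)

∣∣≤⇒≤ : ∀ {p ε} → ℚ.∣ p ∣ ℚ.≤ ε → p ℚ.≤ ε
∣∣≤⇒≤ {p} h = ℚ.≤-trans (p≤∣p∣ p) h

∣∣≤-intro : ∀ {p ε} → p ℚ.≤ ε → ℚ.- p ℚ.≤ ε → ℚ.∣ p ∣ ℚ.≤ ε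
∣∣≤-intro {p} p≤ε -p≤ε with ℚ.∣p∣≡p∨∣p∣≡-p p
... | inj₁ eq = subst (ℚ._≤ _) (sym eq) p≤ε
... | inj₂ eq = subst (ℚ._≤ _) (sym eq) -p≤ε

*-mono-≥0 : ∀ {a b c d} → 0ℚ ℚ.≤ a → a ℚ.≤ b → 0ℚ ℚ.≤ c → c ℚ.≤ d → a ℚ.* c ℚ.≤ b ℚ.* d
*-mono-≥0 {a} {b} {c} {d} 0≤a a≤b 0≤c c≤d = ≤-by
  (+-≥0 (*-≥0 (diff-≥0 a≤b) 0≤c) (*-≥0 (ℚ.≤-trans 0≤a a≤b) (diff-≥0 c≤d)))
  (solve 4 (λ a b c d → (b :- a) :* c :+ b :* (d :- c) := b :* d :- a :* c) refl a b c d)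

≤⇒≯ : ∀ {p q} → p ℚ.≤ q → ¬ (q ℚ.< p)
≤⇒≯ p≤q q<p = ℚ.<-irrefl refl (ℚ.<-≤-trans q<p p≤q)

ℚ-orderedAlgebra : OrderedAlgebra
ℚ-orderedAlgebra = record
  { commutativeRing = ℚ.+-*-commutativeRing
  ; embedding       = -raw-almostCommutative⟶ (fromCommutativeRing ℚ.+-*-commutativeRing)
  ; Pos             = 0ℚ ℚ.<_
  ; Pos-resp        = λ {refl 0<x → 0<x}
  ; Pos-asym        = λ {x} 0<x 0<-x → ℚ.<-irrefl (sym (ℚ.+-inverseʳ x)) (ℚ.+-mono-< 0<x 0<-x)
  ; Pos-+           = λ 0<x ¬y<0 → ℚ.+-mono-<-≤ 0<x (≮-neg⇒≥0 ¬y<0)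
  ; Pos-*           = *->0
  ; Pos-1           = ℚ.positive⁻¹ 1ℚ
  ; M               = id
  ; pure            = id
  ; _>>=_           = λ x f → f x
  ; run-⊥           = id
  ; sign            = sign
  }
  where
  ≮-neg⇒≥0 : ∀ {y} → ¬ (0ℚ ℚ.< ℚ.- y) → 0ℚ ℚ.≤ y
  ≮-neg⇒≥0 ¬y<0 = ℚ.≮⇒≥ λ y<0 → ¬y<0 (ℚ.neg-antimono-< y<0)
  sign : ∀ x → 0ℚ ℚ.< x ⊎ x ≡ 0ℚ ⊎ 0ℚ ℚ.< ℚ.- x
  sign x with ℚ.<-cmp 0ℚ x
  ... | tri< 0<x _ _ = inj₁ 0<x
  ... | tri≈ _ 0≡x _ = inj₂ (inj₁ (sym 0≡x))
  ... | tri> _ _ x<0 = inj₂ (inj₂ (ℚ.neg-antimono-< x<0))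

-- Eventual properties and the ring of Cauchy reals

Eventually : (ℕ → Set) → Set
Eventually P = ∃ λ M → ∀ n → M ℕ.≤ n → P n

eventually-map : ∀ {P Q : ℕ → Set} → (∀ n → P n → Q n) → Eventually P → Eventually Q
eventually-map f (M , h) = M , λ n M≤n → f n (h n M≤n)

eventually-both : ∀ {P Q : ℕ → Set} → Eventually P → Eventually Q → Eventually (λ n → P n × Q n)
eventually-both (M , h) (K , k) = M ℕ.⊔ K , λ n p → h n (ℕ.m⊔n≤o⇒m≤o M K p) , k n (ℕ.m⊔n≤o⇒n≤o M K p)

eventually-witness : ∀ {P : ℕ → Set} → Eventually P → ∃ P
eventually-witness (M , h) = M , h M ℕ.≤-refl

infix 8 -ℝ_
-ℝ_ : ℝ → ℝ
-ℝ x = 0ℝ -ℝ x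

≈-pointwise : ∀ x y → (∀ n → seq x n ≡ seq y n) → x ≈ℝ y
≈-pointwise x y eq ε 0<ε = 0 , λ n _ → ℚ.≤-trans
  (ℚ.≤-reflexive (cong ℚ.∣_∣ (trans (cong (ℚ._- seq y n) (eq n)) (ℚ.+-inverseʳ (seq y n))))) (ℚ.<⇒≤ 0<ε)

≈ℝ-refl : ∀ {x} → x ≈ℝ x
≈ℝ-refl {x} = ≈-pointwise x x (λ _ → refl)

≈ℝ-sym : ∀ {x y} → x ≈ℝ y → y ≈ℝ x
≈ℝ-sym {x} {y} x≈y ε 0<ε = eventually-map (λ n → subst (ℚ._≤ ε)
  (trans (sym (ℚ.∣-p∣≡∣p∣ (seq x n ℚ.- seq y n)))
    (cong ℚ.∣_∣ (solve 2 (λ x y → :- (x :- y) := y :- x) refl (seq x n) (seq y n))))) (x≈y ε 0<ε)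

+-split-≤ : ∀ {p q r ε} → ℚ.∣ p ∣ ℚ.≤ ½ ℚ.* ε → ℚ.∣ q ∣ ℚ.≤ ½ ℚ.* ε → p ℚ.+ q ≡ r → ℚ.∣ r ∣ ℚ.≤ ε
+-split-≤ {p} {q} {r} {ε} hp hq refl = ℚ.≤-trans (ℚ.∣p+q∣≤∣p∣+∣q∣ p q)
  (subst (ℚ.∣ p ∣ ℚ.+ ℚ.∣ q ∣ ℚ.≤_) (½+½ ε) (ℚ.+-mono-≤ hp hq))

≈ℝ-trans : ∀ {x y z} → x ≈ℝ y → y ≈ℝ z → x ≈ℝ z
≈ℝ-trans {x} {y} {z} x≈y y≈z ε 0<ε = eventually-map
  (λ n (h , k) → +-split-≤ h k
    (solve 3 (λ x y z → (x :- y) :+ (y :- z) := x :- z) refl (seq x n) (seq y n) (seq z n)))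
  (eventually-both (x≈y _ (½->0 0<ε)) (y≈z _ (½->0 0<ε)))

+ℝ-cong : ∀ {x x′ y y′} → x ≈ℝ x′ → y ≈ℝ y′ → x +ℝ y ≈ℝ x′ +ℝ y′
+ℝ-cong {x} {x′} {y} {y′} x≈x′ y≈y′ ε 0<ε = eventually-map
  (λ n (h , k) → +-split-≤ h k
    (solve 4 (λ x x′ y y′ → (x :- x′) :+ (y :- y′) := (x :+ y) :- (x′ :+ y′)) refl
      (seq x n) (seq x′ n) (seq y n) (seq y′ n)))
  (eventually-both (x≈x′ _ (½->0 0<ε)) (y≈y′ _ (½->0 0<ε)))

-ℝ-cong : ∀ {x y} → x ≈ℝ y → -ℝ x ≈ℝ -ℝ y
-ℝ-cong {x} {y} x≈y ε 0<ε = eventually-map (λ n → subst (ℚ._≤ ε)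
  (trans (sym (ℚ.∣-p∣≡∣p∣ (seq x n ℚ.- seq y n)))
    (cong ℚ.∣_∣ (solve 2 (λ x y → :- (x :- y) := (con 0ℚ :- x) :- (con 0ℚ :- y)) refl (seq x n) (seq y n))))) (x≈y ε 0<ε)

bounded : ∀ x → ∃ λ B → 0ℚ ℚ.< B × Eventually (λ n → ℚ.∣ seq x n ∣ ℚ.≤ B)
bounded x with cauchy x 1ℚ (ℚ.positive⁻¹ 1ℚ)
... | M , h = 1ℚ ℚ.+ ℚ.∣ seq x M ∣ , ℚ.+-mono-<-≤ (ℚ.positive⁻¹ 1ℚ) (ℚ.0≤∣p∣ (seq x M)) , M , λ n M≤n →
  ℚ.≤-trans (ℚ.≤-reflexive (cong ℚ.∣_∣ (solve 2 (λ x y → x := (x :- y) :+ y) refl (seq x n) (seq x M))))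
    (ℚ.≤-trans (ℚ.∣p+q∣≤∣p∣+∣q∣ (seq x n ℚ.- seq x M) (seq x M)) (ℚ.+-monoˡ-≤ ℚ.∣ seq x M ∣ (h n M M≤n ℕ.≤-refl)))

*ℝ-cong : ∀ {x x′ y y′} → x ≈ℝ x′ → y ≈ℝ y′ → x *ℝ y ≈ℝ x′ *ℝ y′
*ℝ-cong {x} {x′} {y} {y′} x≈x′ y≈y′ ε 0<ε = estimate (bounded x) (bounded y′)
  where
  product-≤ : ∀ p q {B δ η} → ℚ.∣ p ∣ ℚ.≤ B → ℚ.∣ q ∣ ℚ.≤ δ → B ℚ.* δ ≡ η → ℚ.∣ p ℚ.* q ∣ ℚ.≤ η
  product-≤ p q {B} {δ} hp hq Bδ≡η = ℚ.≤-trans (ℚ.≤-reflexive (ℚ.∣p*q∣≡∣p∣*∣q∣ p q))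
    (ℚ.≤-trans (*-mono-≥0 {ℚ.∣ p ∣} {B} {ℚ.∣ q ∣} {δ} (ℚ.0≤∣p∣ p) hp (ℚ.0≤∣p∣ q) hq) (ℚ.≤-reflexive Bδ≡η))
  estimate : (∃ λ B → 0ℚ ℚ.< B × Eventually (λ n → ℚ.∣ seq x n ∣ ℚ.≤ B)) →
             (∃ λ C → 0ℚ ℚ.< C × Eventually (λ n → ℚ.∣ seq y′ n ∣ ℚ.≤ C)) →
             Eventually (λ n → ℚ.∣ seq x n ℚ.* seq y n ℚ.- seq x′ n ℚ.* seq y′ n ∣ ℚ.≤ ε)
  estimate (B , 0<B , hB) (C , 0<C , hC) = eventually-map
    (λ n ((∣x∣≤B , ∣y′∣≤C) , (h , k)) → +-split-≤
      (product-≤ (seq x n) (seq y n ℚ.- seq y′ n) ∣x∣≤B k (proj₂ (proj₂ δB)))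
      (product-≤ (seq y′ n) (seq x n ℚ.- seq x′ n) ∣y′∣≤C h (proj₂ (proj₂ δC)))
      (solve 4 (λ x x′ y y′ → x :* (y :- y′) :+ y′ :* (x :- x′) := x :* y :- x′ :* y′) refl
        (seq x n) (seq x′ n) (seq y n) (seq y′ n)))
    (eventually-both (eventually-both hB hC)
      (eventually-both (x≈x′ (proj₁ δC) (proj₁ (proj₂ δC))) (y≈y′ (proj₁ δB) (proj₁ (proj₂ δB)))))
    where
    δB = quotient->0 0<B (½->0 0<ε)
    δC = quotient->0 0<C (½->0 0<ε)

ℝ-commutativeRing : CommutativeRing _ _
ℝ-commutativeRing = record
  { Carrier = ℝ ; _≈_ = _≈ℝ_ ; _+_ = _+ℝ_ ; _*_ = _*ℝ_ ; -_ = -ℝ_ ; 0# = 0ℝ ; 1# = 1ℝ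
  ; isCommutativeRing = record
    { isRing = record
      { +-isAbelianGroup = record
        { isGroup = record
          { isMonoid = record
            { isSemigroup = record
              { isMagma = record
                { isEquivalence = record { refl = λ {x} → ≈ℝ-refl {x} ; sym = λ {x} {y} → ≈ℝ-sym {x} {y} ; trans = λ {x} {y} {z} → ≈ℝ-trans {x} {y} {z} }
                ; ∙-cong = λ {x} {x′} {y} {y′} → +ℝ-cong {x} {x′} {y} {y′} }
              ; assoc = λ x y z → ≈-pointwise (x +ℝ y +ℝ z) (x +ℝ (y +ℝ z)) (λ n → ℚ.+-assoc (seq x n) (seq y n) (seq z n)) }
            ; identity = (λ x → ≈-pointwise (0ℝ +ℝ x) x (λ n → ℚ.+-identityˡ (seq x n)))
                       , (λ x → ≈-pointwise (x +ℝ 0ℝ) x (λ n → ℚ.+-identityʳ (seq x n))) }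
          ; inverse = (λ x → ≈-pointwise (-ℝ x +ℝ x) 0ℝ (λ n → solve 1 (λ x → (con 0ℚ :- x) :+ x := con 0ℚ) refl (seq x n)))
                    , (λ x → ≈-pointwise (x +ℝ -ℝ x) 0ℝ (λ n → solve 1 (λ x → x :+ (con 0ℚ :- x) := con 0ℚ) refl (seq x n)))
          ; ⁻¹-cong = λ {x} {y} → -ℝ-cong {x} {y} }
        ; comm = λ x y → ≈-pointwise (x +ℝ y) (y +ℝ x) (λ n → ℚ.+-comm (seq x n) (seq y n)) }
      ; *-cong = λ {x} {x′} {y} {y′} → *ℝ-cong {x} {x′} {y} {y′}
      ; *-assoc = λ x y z → ≈-pointwise (x *ℝ y *ℝ z) (x *ℝ (y *ℝ z)) (λ n → ℚ.*-assoc (seq x n) (seq y n) (seq z n))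
      ; *-identity = (λ x → ≈-pointwise (1ℝ *ℝ x) x (λ n → ℚ.*-identityˡ (seq x n)))
                   , (λ x → ≈-pointwise (x *ℝ 1ℝ) x (λ n → ℚ.*-identityʳ (seq x n)))
      ; distrib = (λ x y z → ≈-pointwise (x *ℝ (y +ℝ z)) (x *ℝ y +ℝ x *ℝ z) (λ n → ℚ.*-distribˡ-+ (seq x n) (seq y n) (seq z n)))
                , (λ x y z → ≈-pointwise ((y +ℝ z) *ℝ x) (y *ℝ x +ℝ z *ℝ x) (λ n → ℚ.*-distribʳ-+ (seq x n) (seq y n) (seq z n))) }
    ; *-comm = λ x y → ≈-pointwise (x *ℝ y) (y *ℝ x) (λ n → ℚ.*-comm (seq x n) (seq y n)) } }

-- The constructive substitute for deciding x > 0. From M on the sequence moves by at most ε/2, so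
-- comparing the single rational `seq x M` with ε/2 settles the matter.
positive-or-small : ∀ x {ε} → 0ℚ ℚ.< ε → 0ℝ <ℝ x ⊎ Eventually (λ n → seq x n ℚ.≤ ε)
positive-or-small x {ε} 0<ε with cauchy x _ (½->0 0<ε)
... | M , h with seq x M ℚ.≤? ½ ℚ.* ε
... | yes xM≤ε/2 = inj₂ (M , λ n M≤n → ≤-by
        (+-≥0 (diff-≥0 xM≤ε/2) (diff-≥0 (∣∣≤⇒≤ (h n M M≤n ℕ.≤-refl))))
        (solve 3 (λ e x y → (con ½ :* e :- y) :+ (con ½ :* e :- (x :- y)) := e :- x) refl ε (seq x n) (seq x M)))
... | no xM≰ε/2 = inj₁ (seq x M ℚ.- ½ ℚ.* ε , diff->0 (ℚ.≰⇒> xM≰ε/2) , M , λ n M≤n → ≤-by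
        (diff-≥0 (∣∣≤⇒≤ (h M n ℕ.≤-refl M≤n)))
        (solve 3 (λ e x y → e :- (y :- x) := x :- (con 0ℚ :+ (y :- e))) refl (½ ℚ.* ε) (seq x n) (seq x M)))

-- Converts negative information, such as `Nonneg` over ℝ, back into estimates on the approximating
-- sequences.
≯0⇒small : ∀ x → ¬ (0ℝ <ℝ x) → ∀ {ε} → 0ℚ ℚ.< ε → Eventually (λ n → seq x n ℚ.≤ ε)
≯0⇒small x x≯0 0<ε with positive-or-small x 0<ε
... | inj₁ x>0 = contradiction x>0 x≯0
... | inj₂ small = small

ℝ-orderedAlgebra : OrderedAlgebra
ℝ-orderedAlgebra = record
  { commutativeRing = ℝ-commutativeRing
  ; embedding       = record
    { ⟦_⟧    = fromℚ
    ; +-homo = λ p q → ≈-pointwise (fromℚ (p ℚ.+ q)) (fromℚ p +ℝ fromℚ q) (λ _ → refl)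
    ; *-homo = λ p q → ≈-pointwise (fromℚ (p ℚ.* q)) (fromℚ p *ℝ fromℚ q) (λ _ → refl)
    ; -‿homo = λ p → ≈-pointwise (fromℚ (ℚ.- p)) ( -ℝ fromℚ p) (λ _ → sym (ℚ.+-identityˡ (ℚ.- p)))
    ; 0-homo = ≈ℝ-refl {0ℝ}
    ; 1-homo = ≈ℝ-refl {1ℝ}
    }
  ; Pos             = 0ℝ <ℝ_
  ; Pos-resp        = λ {x} {y} → resp x y
  ; Pos-asym        = λ {x} → asym x
  ; Pos-+           = λ {x} {y} → plus x y
  ; Pos-*           = λ {x} {y} → times x y
  ; Pos-1           = 1ℚ , ℚ.positive⁻¹ 1ℚ , 0 , λ n _ → ℚ.≤-refl
  ; M               = λ A → ¬ ¬ A
  ; pure            = λ a k → k a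
  ; _>>=_           = λ m f k → m (λ a → f a k)
  ; run-⊥           = λ m → m id
  ; sign            = sign
  }
  where
  resp : ∀ x y → x ≈ℝ y → 0ℝ <ℝ x → 0ℝ <ℝ y
  resp x y x≈y (ε , 0<ε , h) = ½ ℚ.* ε , ½->0 0<ε , eventually-map
    (λ n (ε≤x , ∣x-y∣≤) → ≤-by (+-≥0 (diff-≥0 ε≤x) (diff-≥0 (∣∣≤⇒≤ ∣x-y∣≤)))
      (solve 3 (λ e x y → (x :- (con 0ℚ :+ e)) :+ (con ½ :* e :- (x :- y)) := y :- (con 0ℚ :+ con ½ :* e)) refl ε (seq x n) (seq y n)))
    (eventually-both h (x≈y _ (½->0 0<ε)))

  asym : ∀ x → 0ℝ <ℝ x → ¬ (0ℝ <ℝ -ℝ x)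
  asym x (ε , 0<ε , h) (η , 0<η , k) with eventually-witness (eventually-both h k)
  ... | n , ε≤x , η≤-x = ≤⇒≯ (≤-by (+-≥0 (diff-≥0 ε≤x) (diff-≥0 η≤-x))
    (solve 3 (λ e f x → (x :- (con 0ℚ :+ e)) :+ ((con 0ℚ :- x) :- (con 0ℚ :+ f)) := (con 0ℚ :+ con 0ℚ) :- (e :+ f)) refl ε η (seq x n))) (ℚ.+-mono-< 0<ε 0<η)

  plus : ∀ x y → 0ℝ <ℝ x → ¬ (0ℝ <ℝ -ℝ y) → 0ℝ <ℝ x +ℝ y
  plus x y (ε , 0<ε , h) y≮0 = ½ ℚ.* ε , ½->0 0<ε , eventually-map
    (λ n (ε≤x , -y≤) → ≤-by (+-≥0 (diff-≥0 ε≤x) (diff-≥0 -y≤))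
      (solve 3 (λ e x y → (x :- (con 0ℚ :+ e)) :+ (con ½ :* e :- (con 0ℚ :- y)) := (x :+ y) :- (con 0ℚ :+ con ½ :* e)) refl ε (seq x n) (seq y n)))
    (eventually-both h (≯0⇒small (-ℝ y) y≮0 (½->0 0<ε)))

  times : ∀ x y → 0ℝ <ℝ x → 0ℝ <ℝ y → 0ℝ <ℝ x *ℝ y
  times x y (ε , 0<ε , h) (η , 0<η , k) = ε ℚ.* η , *->0 0<ε 0<η , eventually-map
    (λ n (ε≤x , η≤y) → subst (ℚ._≤ seq x n ℚ.* seq y n) (sym (ℚ.+-identityˡ _))
      (*-mono-≥0 (ℚ.<⇒≤ 0<ε) (subst (ℚ._≤ seq x n) (ℚ.+-identityˡ ε) ε≤x)
                 (ℚ.<⇒≤ 0<η) (subst (ℚ._≤ seq y n) (ℚ.+-identityˡ η) η≤y)))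
    (eventually-both h k)

  -- A refutation of all three alternatives refutes both strict ones, which makes x and its negative
  -- eventually small, that is x ≈ 0; this is the alternative handed back to the refutation.
  sign : ∀ x → ¬ ¬ (0ℝ <ℝ x ⊎ x ≈ℝ 0ℝ ⊎ 0ℝ <ℝ -ℝ x)
  sign x k = k (inj₂ (inj₁ λ ε 0<ε → eventually-map
    (λ n (x≤ε , -x≤ε) → ∣∣≤-intro
      (subst (ℚ._≤ ε) (solve 1 (λ x → x := x :- con 0ℚ) refl (seq x n)) x≤ε)
      (subst (ℚ._≤ ε) (solve 1 (λ x → con 0ℚ :- x := :- (x :- con 0ℚ)) refl (seq x n)) -x≤ε))
    (eventually-both (≯0⇒small x (k ∘ inj₁) 0<ε) (≯0⇒small (-ℝ x) (k ∘ inj₂ ∘ inj₂) 0<ε))))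

-- Natural numbers inside ℚ

ι : ℕ → ℚ
ι n = (+ n) ℚ./ 1

-- `ι n` is a normalisation by a gcd and does not reduce for variable n; in constructor form
-- rational sums and products unfold.
ι-mkℚ : ∀ n → ι n ≡ mkℚ (+ n) 0 (Coprimality.sym (Coprimality.1-coprimeTo n))
ι-mkℚ n = ℚ.normalize-coprime (Coprimality.sym (Coprimality.1-coprimeTo n))

ι-+ : ∀ m n → ι (m ℕ.+ n) ≡ ι m ℚ.+ ι n
ι-+ m n = sym (trans (cong₂ ℚ._+_ (ι-mkℚ m) (ι-mkℚ n))
  (cong (ℚ._/ 1) (cong₂ ℤ._+_ (ℤ.*-identityʳ (+ m)) (ℤ.*-identityʳ (+ n)))))

ι-* : ∀ m n → ι (m ℕ.* n) ≡ ι m ℚ.* ι n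
ι-* m n = sym (trans (cong₂ ℚ._*_ (ι-mkℚ m) (ι-mkℚ n)) (cong (ℚ._/ 1) (sym (ℤ.pos-* m n))))

ι-≥0 : ∀ n → 0ℚ ℚ.≤ ι n
ι-≥0 n = ℚ.nonNegative⁻¹ (ι n) {{ℚ.normalize-nonNeg n 1}}

ι-mono : ∀ {m n} → m ℕ.≤ n → ι m ℚ.≤ ι n
ι-mono {m} {n} m≤n = ≤-by (ι-≥0 (n ℕ.∸ m)) (begin
  ι (n ℕ.∸ m)                         ≡⟨ solve 2 (λ x y → x := (x :+ y) :- y) refl (ι (n ℕ.∸ m)) (ι m) ⟩
  (ι (n ℕ.∸ m) ℚ.+ ι m) ℚ.- ι m       ≡⟨ cong (ℚ._- ι m) (ι-+ (n ℕ.∸ m) m) ⟨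
  ι (n ℕ.∸ m ℕ.+ m) ℚ.- ι m           ≡⟨ cong (λ k → ι k ℚ.- ι m) (ℕ.m∸n+n≡m m≤n) ⟩
  ι n ℚ.- ι m                         ∎)
  where open ≡-Reasoning

ι-suc : ∀ n → ι (suc n) ≡ 1ℚ ℚ.+ ι n
ι-suc = ι-+ 1

ι-suc->0 : ∀ n → 0ℚ ℚ.< ι (suc n)
ι-suc->0 n = subst (0ℚ ℚ.<_) (sym (ι-suc n)) (ℚ.+-mono-<-≤ (ℚ.positive⁻¹ 1ℚ) (ι-≥0 n))

-- The Archimedean property; a nonnegative numerator is itself a bound.
≤-ι : ∀ p → ∃ λ k → p ℚ.≤ ι k
≤-ι p@(mkℚ (+ a) d _) = a , subst (p ℚ.≤_) (sym (ι-mkℚ a)) (ℚ.*≤* (ℤ.*-monoˡ-≤-nonNeg (+ a) (ℤ.+≤+ (ℕ.s≤s ℕ.z≤n))))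
≤-ι p@(mkℚ -[1+ a ] d _) = 0 , ℚ.≤-trans (ℚ.nonPositive⁻¹ p) (ι-≥0 0)

*-cancel-≤ : ∀ {p q r} → 0ℚ ℚ.< r → r ℚ.* p ℚ.≤ r ℚ.* q → p ℚ.≤ q
*-cancel-≤ {r = r} 0<r = ℚ.*-cancelˡ-≤-pos r {{ℚ.positive 0<r}}

-- Bisection between two predicates that cover ℚ

module Bisection
  {A B : ℚ → Set} (decide : ∀ t → A t ⊎ B t)
  (bottom top : ℚ) (bottom≤top : bottom ℚ.≤ top) (A-bottom : A bottom) (B-top : B top) where

  record Interval : Set where
    constructor interval
    field
      lower upper : ℚ
      ordered     : lower ℚ.≤ upper
      A-lower     : A lower
      B-upper     : B upper
  open Interval

  midpoint : Interval → ℚ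
  midpoint I = ½ ℚ.* (lower I ℚ.+ upper I)

  half-width : ∀ I → midpoint I ℚ.- lower I ≡ ½ ℚ.* (upper I ℚ.- lower I)
  half-width I = solve 2 (λ l u → con ½ :* (l :+ u) :- l := con ½ :* (u :- l)) refl (lower I) (upper I)

  half-width′ : ∀ I → upper I ℚ.- midpoint I ≡ ½ ℚ.* (upper I ℚ.- lower I)
  half-width′ I = solve 2 (λ l u → u :- con ½ :* (l :+ u) := con ½ :* (u :- l)) refl (lower I) (upper I)

  half-width-≥0 : ∀ I → 0ℚ ℚ.≤ ½ ℚ.* (upper I ℚ.- lower I)
  half-width-≥0 I = *-≥0 (ℚ.nonNegative⁻¹ ½) (diff-≥0 (ordered I))

  record Halving (I J : Interval) : Set where
    field
      lower-≤  : lower I ℚ.≤ lower J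
      upper-≤  : upper J ℚ.≤ upper I
      halves   : upper J ℚ.- lower J ≡ ½ ℚ.* (upper I ℚ.- lower I)
  open Halving

  halve : ∀ I → ∃ (Halving I)
  halve I with decide (midpoint I)
  ... | inj₁ a = interval (midpoint I) (upper I) mid≤upper a (B-upper I) , record
    { lower-≤ = ≤-by (half-width-≥0 I) (sym (half-width I)) ; upper-≤ = ℚ.≤-refl ; halves = half-width′ I }
    where
    mid≤upper : midpoint I ℚ.≤ upper I
    mid≤upper = ≤-by (half-width-≥0 I) (sym (half-width′ I))
  ... | inj₂ b = interval (lower I) (midpoint I) lower≤mid (A-lower I) b , record
    { lower-≤ = ℚ.≤-refl ; upper-≤ = ≤-by (half-width-≥0 I) (sym (half-width′ I)) ; halves = half-width I }
    where
    lower≤mid : lower I ℚ.≤ midpoint I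
    lower≤mid = ≤-by (half-width-≥0 I) (sym (half-width I))

  I : ℕ → Interval
  I zero    = interval bottom top bottom≤top A-bottom B-top
  I (suc n) = proj₁ (halve (I n))

  lo hi : ℕ → ℚ
  lo n = lower (I n)
  hi n = upper (I n)

  lo-mono : ∀ m k → lo m ℚ.≤ lo (k ℕ.+ m)
  lo-mono m zero    = ℚ.≤-refl
  lo-mono m (suc k) = ℚ.≤-trans (lo-mono m k) (lower-≤ (proj₂ (halve (I (k ℕ.+ m)))))

  hi-mono : ∀ m k → hi (k ℕ.+ m) ℚ.≤ hi m
  hi-mono m zero    = ℚ.≤-refl
  hi-mono m (suc k) = ℚ.≤-trans (upper-≤ (proj₂ (halve (I (k ℕ.+ m))))) (hi-mono m k)

  lo-mono-≤ : ∀ {m n} → m ℕ.≤ n → lo m ℚ.≤ lo n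
  lo-mono-≤ {m} {n} m≤n = subst (λ k → lo m ℚ.≤ lo k) (ℕ.m∸n+n≡m m≤n) (lo-mono m (n ℕ.∸ m))

  lo≤hi : ∀ {m n} → m ℕ.≤ n → lo n ℚ.≤ hi m
  lo≤hi {m} {n} m≤n = ℚ.≤-trans (ordered (I n))
    (subst (λ k → hi k ℚ.≤ hi m) (ℕ.m∸n+n≡m m≤n) (hi-mono m (n ℕ.∸ m)))

  width : ℕ → ℚ
  width n = hi n ℚ.- lo n

  width-≥0 : ∀ n → 0ℚ ℚ.≤ width n
  width-≥0 n = diff-≥0 (ordered (I n))

  -- Much weaker than the true 2⁻ⁿ, but it meets the Archimedean property without powers. The
  -- induction step is (n + 2) / 2 ≤ n + 1, with difference n / 2.
  width-decay : ∀ n → ι (suc n) ℚ.* width n ℚ.≤ width 0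
  width-decay zero    = ℚ.≤-reflexive (ℚ.*-identityˡ (width 0))
  width-decay (suc n) = ℚ.≤-trans (≤-by (*-≥0 (*-≥0 (ℚ.nonNegative⁻¹ ½) (ι-≥0 n)) (width-≥0 n)) (begin
      (½ ℚ.* ι n) ℚ.* width n
        ≡⟨ solve 2 (λ k w → (con ½ :* k) :* w := (con 1ℚ :+ k) :* w :- (con 1ℚ :+ (con 1ℚ :+ k)) :* (con ½ :* w)) refl (ι n) (width n) ⟩
      (1ℚ ℚ.+ ι n) ℚ.* width n ℚ.- (1ℚ ℚ.+ (1ℚ ℚ.+ ι n)) ℚ.* (½ ℚ.* width n)
        ≡⟨ cong₂ (λ p q → p ℚ.* width n ℚ.- q ℚ.* (½ ℚ.* width n)) (ι-suc n) (trans (ι-suc (suc n)) (cong (1ℚ ℚ.+_) (ι-suc n))) ⟨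
      ι (suc n) ℚ.* width n ℚ.- ι (suc (suc n)) ℚ.* (½ ℚ.* width n)
        ≡⟨ cong (λ w → ι (suc n) ℚ.* width n ℚ.- ι (suc (suc n)) ℚ.* w) (halves (proj₂ (halve (I n)))) ⟨
      ι (suc n) ℚ.* width n ℚ.- ι (suc (suc n)) ℚ.* width (suc n) ∎))
    (width-decay n)
    where open ≡-Reasoning

  width-small : ∀ {δ} → 0ℚ ℚ.< δ → ∃ λ n → width n ℚ.≤ δ
  width-small {δ} 0<δ = k , *-cancel-≤ (ι-suc->0 k) (ℚ.≤-trans (width-decay k) width₀≤)
    where
    1/δ = quotient->0 0<δ (ℚ.positive⁻¹ 1ℚ)
    r = proj₁ 1/δ
    bound = ≤-ι (width 0 ℚ.* r)
    k = proj₁ bound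
    width₀≤ : width 0 ℚ.≤ ι (suc k) ℚ.* δ
    width₀≤ = ≤-by (*-≥0 (+-≥0 (ℚ.nonNegative⁻¹ 1ℚ) (diff-≥0 (proj₂ bound))) (ℚ.<⇒≤ 0<δ)) (begin
      (1ℚ ℚ.+ (ι k ℚ.- width 0 ℚ.* r)) ℚ.* δ
        ≡⟨ solve 4 (λ k w r d → (con 1ℚ :+ (k :- w :* r)) :* d := (con 1ℚ :+ k) :* d :- w :* (d :* r)) refl (ι k) (width 0) r δ ⟩
      (1ℚ ℚ.+ ι k) ℚ.* δ ℚ.- width 0 ℚ.* (δ ℚ.* r)
        ≡⟨ cong₂ (λ p q → p ℚ.* δ ℚ.- width 0 ℚ.* q) (ι-suc k) (sym (proj₂ (proj₂ 1/δ))) ⟨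
      ι (suc k) ℚ.* δ ℚ.- width 0 ℚ.* 1ℚ
        ≡⟨ cong (λ w → ι (suc k) ℚ.* δ ℚ.- w) (ℚ.*-identityʳ (width 0)) ⟩
      ι (suc k) ℚ.* δ ℚ.- width 0 ∎)
      where open ≡-Reasoning

  -- The lower ends serve as the approximating sequence because then every single term satisfies A
  -- and stays below `top`, so facts about the limit can be checked term by term.
  limit : ℝ
  limit = mkℝ lo λ ε 0<ε → let (K , wK≤ε) = width-small 0<ε in K , λ m n K≤m K≤n → ∣∣≤-intro
      (close wK≤ε K≤m K≤n)
      (subst (ℚ._≤ ε) (solve 2 (λ x y → x :- y := :- (y :- x)) refl (lo n) (lo m)) (close wK≤ε K≤n K≤m))
    where
    close : ∀ {ε K m n} → width K ℚ.≤ ε → K ℕ.≤ m → K ℕ.≤ n → lo m ℚ.- lo n ℚ.≤ ε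
    close {ε} {K} {m} {n} wK≤ε K≤m K≤n = ≤-by
      (+-≥0 (+-≥0 (diff-≥0 wK≤ε) (diff-≥0 (lo≤hi K≤m))) (diff-≥0 (lo-mono-≤ K≤n)))
      (solve 5 (λ e h l x y → (e :- (h :- l)) :+ (h :- x) :+ (y :- l) := e :- (x :- y)) refl ε (hi K) (lo K) (lo m) (lo n))

  A-limit : ∀ n → A (seq limit n)
  A-limit n = A-lower (I n)

  limit-≤-top : ∀ n → seq limit n ℚ.≤ top
  limit-≤-top n = lo≤hi {0} {n} ℕ.z≤n

  B-near-limit : ∀ {δ} → 0ℚ ℚ.< δ → ∃ λ h → B h × Eventually (λ n → h ℚ.- seq limit n ℚ.≤ δ)
  B-near-limit {δ} 0<δ = let (K , wK≤δ) = width-small 0<δ in hi K , B-upper (I K) , K , λ n K≤n →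
    ≤-by (+-≥0 (diff-≥0 wK≤δ) (diff-≥0 (lo-mono-≤ K≤n)))
      (solve 4 (λ d h l x → (d :- (h :- l)) :+ (x :- l) := d :- (h :- x)) refl δ (hi K) (lo K) (lo n))

-- Rayleigh quotients

open SemiringSum (CommutativeRing.semiring ℚ.+-*-commutativeRing) using (sum; sum-cong-≗; *-distribˡ-sum; *-distribʳ-sum; ∑-comm)
module Q = QuadraticForms ℚ-orderedAlgebra
module R = QuadraticForms ℝ-orderedAlgebra
module ℝ-Sum = SemiringSum (CommutativeRing.semiring ℝ-commutativeRing)

Nonneg⇒≥0 : ∀ {p} → Q.Nonneg p → 0ℚ ℚ.≤ p
Nonneg⇒≥0 p≮0 = ℚ.≮⇒≥ λ p<0 → p≮0 (ℚ.neg-antimono-< p<0)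

≥0⇒Nonneg : ∀ {p} → 0ℚ ℚ.≤ p → Q.Nonneg p
≥0⇒Nonneg {p} 0≤p 0<-p = ≤⇒≯ 0≤p (<-by 0<-p (sym (ℚ.+-identityˡ (ℚ.- p))))

¬Nonneg⇒>0 : ∀ {p} → ¬ Q.Nonneg p → 0ℚ ℚ.< ℚ.- p
¬Nonneg⇒>0 {p} ¬0≤p = ℚ.neg-antimono-< (ℚ.≰⇒> λ 0≤p → ¬0≤p (≥0⇒Nonneg 0≤p))

δ : ∀ {n} → Fin n → Fin n → ℚ
δ i j = if does (i Fin.≟ j) then 1ℚ else 0ℚ

sum-δ : ∀ {n} (x : Fin n → ℚ) i → sum (λ j → δ i j ℚ.* x j) ≡ x i
sum-δ x zero = begin
  1ℚ ℚ.* x zero ℚ.+ sum (λ j → 0ℚ ℚ.* x (suc j))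
    ≡⟨ cong₂ ℚ._+_ (ℚ.*-identityˡ (x zero)) (Q.sum-zero (λ j → 0ℚ ℚ.* x (suc j)) (λ j → ℚ.*-zeroˡ (x (suc j)))) ⟩
  x zero ℚ.+ 0ℚ
    ≡⟨ ℚ.+-identityʳ (x zero) ⟩
  x zero ∎
  where open ≡-Reasoning
sum-δ x (suc i) = begin
  0ℚ ℚ.* x zero ℚ.+ sum (λ j → δ i j ℚ.* x (suc j))
    ≡⟨ cong₂ ℚ._+_ (ℚ.*-zeroˡ (x zero)) (sum-δ (x ∘ suc) i) ⟩
  0ℚ ℚ.+ x (suc i)
    ≡⟨ ℚ.+-identityˡ (x (suc i)) ⟩
  x (suc i) ∎
  where open ≡-Reasoning

δ-sym : ∀ {n} (w : Fin n → ℚ) i j → w i ℚ.* δ i j ≡ w j ℚ.* δ j i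
δ-sym w i j with i Fin.≟ j | j Fin.≟ i
... | yes refl | yes _ = refl
... | yes refl | no ne = contradiction refl ne
... | no ne | yes refl = contradiction refl ne
... | no _ | no _ = trans (ℚ.*-zeroʳ (w i)) (sym (ℚ.*-zeroʳ (w j)))

seq-∑ : ∀ {n} (f : Fin n → ℝ) k → seq (∑ f) k ≡ sum (λ i → seq (f i) k)
seq-∑ {zero}  f k = refl
seq-∑ {suc n} f k = cong (seq (f zero) k ℚ.+_) (seq-∑ (f ∘ suc) k)

-- Real operations act termwise, so positivity of a real form follows from positivity of the
-- rational forms of its k-th approximations.
seq-form : ∀ {n} (T : R.Mat n) x k →
  seq (R.form T x) k ≡ Q.form (λ i j → seq (T i j) k) (λ i → seq (x i) k)
seq-form T x k = trans (seq-∑ (λ i → x i *ℝ (T i R.· x)) k)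
  (sum-cong-≗ (λ i → cong (seq (x i) k ℚ.*_) (seq-∑ (λ j → T i j *ℝ x j) k)))

≥0⇒Nonnegℝ : ∀ x → (∀ k → 0ℚ ℚ.≤ seq x k) → R.Nonneg x
≥0⇒Nonnegℝ x 0≤x (ε , 0<ε , M , h) = ≤⇒≯ (0≤x M) (<-by 0<ε+ (solve 2 (λ e x → e :+ ((con 0ℚ :- x) :- (con 0ℚ :+ e)) := con 0ℚ :- x) refl ε (seq x M)))
  where
  0<ε+ : 0ℚ ℚ.< ε ℚ.+ ((0ℚ ℚ.- seq x M) ℚ.- (0ℚ ℚ.+ ε))
  0<ε+ = ℚ.+-mono-<-≤ 0<ε (diff-≥0 (h M ℕ.≤-refl))

module Rayleigh {n} (L : Matrix n ℚ) (w : Fin n → ℚ) (0<w : ∀ i → 0ℚ ℚ.< w i)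
  (self-adjoint : ∀ i j → w i ℚ.* L i j ≡ w j ℚ.* L j i)
  (nonnegative : ∀ x → 0ℚ ℚ.≤ Q.form (λ i j → w i ℚ.* L i j) x) where

  S D : Matrix n ℚ
  S i j = w i ℚ.* L i j
  D i j = w i ℚ.* δ i j

  pencil : ℚ → Matrix n ℚ
  pencil t i j = S i j ℚ.- t ℚ.* D i j

  pencilℝ : ℝ → Matrix n ℝ
  pencilℝ t i j = fromℚ (S i j) -ℝ t *ℝ fromℚ (D i j)

  pencil-symmetric : ∀ t → Q.Symmetric (pencil t)
  pencil-symmetric t i j = cong₂ (λ s d → s ℚ.- t ℚ.* d) (self-adjoint i j) (δ-sym w i j)

  pencilℝ-symmetric : ∀ t → R.Symmetric (pencilℝ t)
  pencilℝ-symmetric t i j = ≈-pointwise (pencilℝ t i j) (pencilℝ t j i) (λ k → pencil-symmetric (seq t k) i j)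

  row-D : ∀ x i → D i Q.· x ≡ w i ℚ.* x i
  row-D x i = begin
    sum (λ j → (w i ℚ.* δ i j) ℚ.* x j)  ≡⟨ sum-cong-≗ (λ j → ℚ.*-assoc (w i) (δ i j) (x j)) ⟩
    sum (λ j → w i ℚ.* (δ i j ℚ.* x j))  ≡⟨ *-distribˡ-sum (w i) (λ j → δ i j ℚ.* x j) ⟨
    w i ℚ.* sum (λ j → δ i j ℚ.* x j)    ≡⟨ cong (w i ℚ.*_) (sum-δ x i) ⟩
    w i ℚ.* x i                          ∎
    where open ≡-Reasoning

  form-D : ∀ x → Q.form D x ≡ sum (λ i → w i ℚ.* (x i ℚ.* x i))
  form-D x = sum-cong-≗ (λ i → trans (cong (x i ℚ.*_) (row-D x i))
    (solve 2 (λ x w → x :* (w :* x) := w :* (x :* x)) refl (x i) (w i)))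

  sum-≥0 : ∀ {m} (f : Fin m → ℚ) → (∀ i → 0ℚ ℚ.≤ f i) → 0ℚ ℚ.≤ sum f
  sum-≥0 f 0≤f = Nonneg⇒≥0 (Q.Nonneg-sum f (λ i → ≥0⇒Nonneg (0≤f i)))

  form-D-≥0 : ∀ x → 0ℚ ℚ.≤ Q.form D x
  form-D-≥0 x = subst (0ℚ ℚ.≤_) (sym (form-D x))
    (sum-≥0 (λ i → w i ℚ.* (x i ℚ.* x i)) (λ i → *-≥0 (ℚ.<⇒≤ (0<w i)) (square-≥0 (x i))))

  -- A crude bound on every weight, giving D ≤ `total` · Id; the summand 1 keeps it positive also
  -- for n = 0.
  total : ℚ
  total = 1ℚ ℚ.+ sum w

  0<total : 0ℚ ℚ.< total
  0<total = ℚ.+-mono-<-≤ (ℚ.positive⁻¹ 1ℚ) (sum-≥0 w (λ i → ℚ.<⇒≤ (0<w i)))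

  w≤total : ∀ i → w i ℚ.≤ total
  w≤total i = ≤-by (+-≥0 (ℚ.nonNegative⁻¹ 1ℚ) (Nonneg⇒≥0 (Q.term≤sum w (λ i → ≥0⇒Nonneg (ℚ.<⇒≤ (0<w i))) i)))
    (sym (ℚ.+-assoc 1ℚ (sum w) (ℚ.- w i)))

  form-D-≤ : ∀ x → Q.form D x ℚ.≤ total ℚ.* Q.norm² x
  form-D-≤ x = ≤-by
    (sum-≥0 (λ i → total ℚ.* (x i ℚ.* x i) ℚ.- 1ℚ ℚ.* (w i ℚ.* (x i ℚ.* x i))) term)
    (begin
      sum (λ i → total ℚ.* (x i ℚ.* x i) ℚ.- 1ℚ ℚ.* (w i ℚ.* (x i ℚ.* x i)))
        ≡⟨ Q.sum-lin total 1ℚ (λ i → x i ℚ.* x i) (λ i → w i ℚ.* (x i ℚ.* x i)) ⟩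
      total ℚ.* Q.norm² x ℚ.- 1ℚ ℚ.* sum (λ i → w i ℚ.* (x i ℚ.* x i))
        ≡⟨ cong (λ z → total ℚ.* Q.norm² x ℚ.- z) (trans (ℚ.*-identityˡ _) (sym (form-D x))) ⟩
      total ℚ.* Q.norm² x ℚ.- Q.form D x ∎)
    where
    open ≡-Reasoning
    term : ∀ i → 0ℚ ℚ.≤ total ℚ.* (x i ℚ.* x i) ℚ.- 1ℚ ℚ.* (w i ℚ.* (x i ℚ.* x i))
    term i = subst (0ℚ ℚ.≤_)
      (solve 3 (λ t w x → (t :- w) :* x := t :* x :- con 1ℚ :* (w :* x)) refl total (w i) (x i ℚ.* x i))
      (*-≥0 (diff-≥0 (w≤total i)) (square-≥0 (x i)))

  -- Row v of S - mD is w v times row v of L - m, so multiplying by the rational 1/w v turns the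
  -- kernel equation into the eigenvalue equation.
  eigenvalue : ∀ m → R.Singular (pencilℝ m) → IsEigenvalue L m
  eigenvalue m (x , (i , xᵢ#0) , ker) = x , (i , apart xᵢ#0) , λ v →
      ≈-from-difference v (*ℝ-cong {fromℚ (1/w v)} {fromℚ (1/w v)} {pencilℝ m v R.· x} {0ℝ} (≈ℝ-refl {fromℚ (1/w v)}) (ker v))
    where
    apart : 0ℝ <ℝ x i ⊎ 0ℝ <ℝ -ℝ x i → x i #ℝ 0ℝ
    apart (inj₁ xᵢ>0) = inj₂ xᵢ>0
    apart (inj₂ (ε , 0<ε , h)) = inj₁ (ε , 0<ε , eventually-map (λ k ε≤-x → ≤-by (diff-≥0 ε≤-x)
      (solve 2 (λ e x → (con 0ℚ :- x) :- (con 0ℚ :+ e) := con 0ℚ :- (x :+ e)) refl ε (seq (x i) k))) h)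
    inverse : ∀ v → ∃ λ r → 0ℚ ℚ.< r × w v ℚ.* r ≡ 1ℚ
    inverse v = quotient->0 (0<w v) (ℚ.positive⁻¹ 1ℚ)
    1/w : Fin n → ℚ
    1/w v = proj₁ (inverse v)
    Lx : Fin n → ℝ
    Lx v = ∑ (λ j → fromℚ (L v j) *ℝ x j)
    row : ∀ v k → 1/w v ℚ.* seq (pencilℝ m v R.· x) k ≡ seq (Lx v) k ℚ.- seq m k ℚ.* seq (x v) k
    row v k = begin
      r ℚ.* seq (pencilℝ m v R.· x) k
        ≡⟨ cong (r ℚ.*_) (seq-∑ (λ j → pencilℝ m v j *ℝ x j) k) ⟩
      r ℚ.* sum (λ j → (w v ℚ.* L v j ℚ.- t ℚ.* (w v ℚ.* δ v j)) ℚ.* y j)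
        ≡⟨ cong (r ℚ.*_) (sum-cong-≗ (λ j → solve 5 (λ w l t d y → (w :* l :- t :* (w :* d)) :* y := w :* (l :* y) :- (t :* w) :* (d :* y))
             refl (w v) (L v j) t (δ v j) (y j))) ⟩
      r ℚ.* sum (λ j → w v ℚ.* (L v j ℚ.* y j) ℚ.- (t ℚ.* w v) ℚ.* (δ v j ℚ.* y j))
        ≡⟨ cong (r ℚ.*_) (Q.sum-lin (w v) (t ℚ.* w v) (λ j → L v j ℚ.* y j) (λ j → δ v j ℚ.* y j)) ⟩
      r ℚ.* (w v ℚ.* sum (λ j → L v j ℚ.* y j) ℚ.- (t ℚ.* w v) ℚ.* sum (λ j → δ v j ℚ.* y j))
        ≡⟨ cong₂ (λ a b → r ℚ.* (w v ℚ.* a ℚ.- (t ℚ.* w v) ℚ.* b)) (sym (seq-∑ (λ j → fromℚ (L v j) *ℝ x j) k)) (sum-δ y v) ⟩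
      r ℚ.* (w v ℚ.* seq (Lx v) k ℚ.- (t ℚ.* w v) ℚ.* y v)
        ≡⟨ solve 5 (λ r w a t b → r :* (w :* a :- (t :* w) :* b) := (w :* r) :* (a :- t :* b)) refl r (w v) (seq (Lx v) k) t (y v) ⟩
      (w v ℚ.* r) ℚ.* (seq (Lx v) k ℚ.- t ℚ.* y v)
        ≡⟨ cong (ℚ._* (seq (Lx v) k ℚ.- t ℚ.* y v)) (proj₂ (proj₂ (inverse v))) ⟩
      1ℚ ℚ.* (seq (Lx v) k ℚ.- t ℚ.* y v)
        ≡⟨ ℚ.*-identityˡ _ ⟩
      seq (Lx v) k ℚ.- t ℚ.* y v ∎
      where
      open ≡-Reasoning
      r = 1/w v
      t = seq m k
      y : Fin n → ℚ
      y j = seq (x j) k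
    ≈-from-difference : ∀ v → fromℚ (1/w v) *ℝ (pencilℝ m v R.· x) ≈ℝ fromℚ (1/w v) *ℝ 0ℝ → Lx v ≈ℝ m *ℝ x v
    ≈-from-difference v h ε 0<ε = eventually-map (λ k → subst (λ z → ℚ.∣ z ∣ ℚ.≤ ε)
      (trans (cong₂ ℚ._-_ (row v k) (ℚ.*-zeroʳ (1/w v))) (ℚ.+-identityʳ _))) (h ε 0<ε)

  -- Pairing the eigenvalue equation with w f gives μ P = fᵀSf ≥ 0 for P = Σ wᵢ fᵢ², and P is at
  -- least its positive term at v. In the extremal example this certifies that 0 is the least
  -- eigenvalue.
  eigenvalue-≥0 : ∀ μ → IsEigenvalue L μ → 0ℝ ≤ℝ μ
  eigenvalue-≥0 μ (f , (v , fᵥ#0) , Lf≈μf) ε 0<ε = eventually-map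
      (λ k -μ≤ε → ≤-by (diff-≥0 -μ≤ε) (solve 2 (λ e m → e :- (con 0ℚ :- m) := (m :+ e) :- con 0ℚ) refl ε (seq μ k)))
      (≯0⇒small (-ℝ μ) not-negative 0<ε)
    where
    W : Fin n → ℝ
    W i = fromℚ (w i)
    term : Fin n → ℝ
    term i = W i *ℝ (f i *ℝ f i)
    P : ℝ
    P = ∑ term
    Sℝ : R.Mat n
    Sℝ i j = fromℚ (S i j)
    Lf : Fin n → ℝ
    Lf i = ∑ (λ j → fromℚ (L i j) *ℝ f j)
    weighted-row : ∀ i → f i *ℝ (Sℝ i R.· f) ≈ℝ (f i *ℝ W i) *ℝ Lf i
    weighted-row i = ≈-pointwise (f i *ℝ (Sℝ i R.· f)) ((f i *ℝ W i) *ℝ Lf i) λ k → let y = λ j → seq (f j) k in begin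
      y i ℚ.* seq (Sℝ i R.· f) k                                ≡⟨ cong (y i ℚ.*_) (seq-∑ (λ j → Sℝ i j *ℝ f j) k) ⟩
      y i ℚ.* sum (λ j → (w i ℚ.* L i j) ℚ.* y j)               ≡⟨ cong (y i ℚ.*_) (sum-cong-≗ (λ j → ℚ.*-assoc (w i) (L i j) (y j))) ⟩
      y i ℚ.* sum (λ j → w i ℚ.* (L i j ℚ.* y j))               ≡⟨ cong (y i ℚ.*_) (*-distribˡ-sum (w i) (λ j → L i j ℚ.* y j)) ⟨
      y i ℚ.* (w i ℚ.* sum (λ j → L i j ℚ.* y j))               ≡⟨ ℚ.*-assoc (y i) (w i) _ ⟨
      (y i ℚ.* w i) ℚ.* sum (λ j → L i j ℚ.* y j)               ≡⟨ cong ((y i ℚ.* w i) ℚ.*_) (seq-∑ (λ j → fromℚ (L i j) *ℝ f j) k) ⟨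
      (y i ℚ.* w i) ℚ.* seq (Lf i) k                            ∎
      where open ≡-Reasoning
    eigen-row : ∀ i → f i *ℝ (Sℝ i R.· f) ≈ℝ μ *ℝ term i
    eigen-row i = ≈ℝ-trans {f i *ℝ (Sℝ i R.· f)} {(f i *ℝ W i) *ℝ Lf i} {μ *ℝ term i} (weighted-row i)
      (≈ℝ-trans {(f i *ℝ W i) *ℝ Lf i} {(f i *ℝ W i) *ℝ (μ *ℝ f i)} {μ *ℝ term i}
        (*ℝ-cong {f i *ℝ W i} {f i *ℝ W i} {Lf i} {μ *ℝ f i} (≈ℝ-refl {f i *ℝ W i}) (Lf≈μf i))
        (≈-pointwise ((f i *ℝ W i) *ℝ (μ *ℝ f i)) (μ *ℝ term i) (λ k →
          solve 3 (λ f w m → (f :* w) :* (m :* f) := m :* (w :* (f :* f))) refl (seq (f i) k) (w i) (seq μ k))))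
    form≈μP : R.form Sℝ f ≈ℝ μ *ℝ P
    form≈μP = ≈ℝ-trans {R.form Sℝ f} {∑ (λ i → μ *ℝ term i)} {μ *ℝ P}
      (ℝ-Sum.sum-cong-≋ {n} {λ i → f i *ℝ (Sℝ i R.· f)} {λ i → μ *ℝ term i} eigen-row)
      (≈ℝ-sym {μ *ℝ P} {∑ (λ i → μ *ℝ term i)} (ℝ-Sum.*-distribˡ-sum μ term))
    0≤μP : R.Nonneg (μ *ℝ P)
    0≤μP = R.Nonneg-resp {R.form Sℝ f} {μ *ℝ P} form≈μP (≥0⇒Nonnegℝ (R.form Sℝ f) λ k →
      subst (0ℚ ℚ.≤_) (sym (seq-form Sℝ f k)) (nonnegative (λ i → seq (f i) k)))
    0<W : ∀ i → 0ℝ <ℝ W i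
    0<W i = w i , 0<w i , 0 , λ _ _ → ℚ.≤-reflexive (ℚ.+-identityˡ (w i))
    sign-of : f v #ℝ 0ℝ → 0ℝ <ℝ f v ⊎ 0ℝ <ℝ -ℝ f v
    sign-of (inj₂ f>0) = inj₁ f>0
    sign-of (inj₁ (ε , 0<ε , h)) = inj₂ (ε , 0<ε , eventually-map (λ k f+ε≤0 → ≤-by (diff-≥0 f+ε≤0)
      (solve 2 (λ e x → con 0ℚ :- (x :+ e) := (con 0ℚ :- x) :- (con 0ℚ :+ e)) refl ε (seq (f v) k))) h)
    0<term : 0ℝ <ℝ term v
    0<term = OrderedAlgebra.Pos-* ℝ-orderedAlgebra {W v} {f v *ℝ f v} (0<W v) (R.Pos-square {f v} (sign-of fᵥ#0))
    not-negative : ¬ (0ℝ <ℝ -ℝ μ)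
    not-negative μ<0 = R.Nonneg-+ { -ℝ P} {P -ℝ term v} 0≤-P 0≤P-term
        (OrderedAlgebra.Pos-resp ℝ-orderedAlgebra {term v} { -ℝ (-ℝ P +ℝ (P -ℝ term v))}
          (≈-pointwise (term v) (-ℝ (-ℝ P +ℝ (P -ℝ term v))) (λ k →
            solve 2 (λ t p → t := con 0ℚ :- ((con 0ℚ :- p) :+ (p :- t))) refl (seq (term v) k) (seq P k))) 0<term)
      where
      0≤-P : R.Nonneg (-ℝ P)
      0≤-P = R.Nonneg-cancel { -ℝ μ} { -ℝ P} μ<0 (R.Nonneg-resp {μ *ℝ P} { -ℝ μ *ℝ -ℝ P}
        (≈-pointwise (μ *ℝ P) (-ℝ μ *ℝ -ℝ P) (λ k →
          solve 2 (λ m p → m :* p := (con 0ℚ :- m) :* (con 0ℚ :- p)) refl (seq μ k) (seq P k))) 0≤μP)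
      0≤P-term : R.Nonneg (P -ℝ term v)
      0≤P-term = R.Nonneg-resp {P +ℝ -ℝ term v} {P -ℝ term v}
        (≈-pointwise (P +ℝ -ℝ term v) (P -ℝ term v) (λ k →
          solve 2 (λ p t → p :+ (con 0ℚ :- t) := p :- t) refl (seq P k) (seq (term v) k)))
        (R.term≤sum term (λ i → R.Nonneg-* {W i} {f i *ℝ f i} (R.Pos⇒Nonneg {W i} (0<W i)) (R.Nonneg-square (f i))) v)

  -- Moving from m to h ≤ m + η lowers the form by at most η xᵀDx ≤ η `total` ‖x‖². For small η
  -- coercivity at m outweighs this loss, and no vector can be negative at h.
  not-coercive : ∀ m → (∀ {η} → 0ℚ ℚ.< η → ∃ λ h → Q.Indefinite (pencil h) × Eventually (λ k → h ℚ.- seq m k ℚ.≤ η)) →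
    ¬ R.Coercive (pencilℝ m)
  not-coercive m near (l , K , (l₀ , 0<l₀ , l₀≤l) , (κ , 0<κ , κ≤K) , coercive) = contra (bounded K)
    where
    contra : ¬ (∃ λ B → 0ℚ ℚ.< B × Eventually (λ k → ℚ.∣ seq K k ∣ ℚ.≤ B))
    -- With K ≤ B eventually, the loss K η `total` ‖x‖² is at most l₀ ‖x‖², which coercivity pays
    -- for since l₀ ≤ l eventually.
    contra (B , 0<B , K≤B) = contra′ (quotient->0 (*->0 0<B 0<total) 0<l₀)
      where
      contra′ : ¬ (∃ λ η → 0ℚ ℚ.< η × (B ℚ.* total) ℚ.* η ≡ l₀)
      contra′ (η , 0<η , Bη≡l₀) = contra″ (near 0<η)
        where
        contra″ : ¬ (∃ λ h → Q.Indefinite (pencil h) × Eventually (λ k → h ℚ.- seq m k ℚ.≤ η))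
        -- Once the perturbation is absorbed, K times the value - γ of the form at h is left, and K
        -- ≥ κ makes the coercivity expression at X at most - κ γ.
        contra″ (h , (X , ¬0≤q) , h≤m+η) = coercive X′ (κ ℚ.* γ , *->0 0<κ 0<γ , eventually-map estimate
            (eventually-both (eventually-both l₀≤l κ≤K) (eventually-both K≤B h≤m+η)))
          where
          X′ : Fin n → ℝ
          X′ i = fromℚ (X i)
          γ d N : ℚ
          γ = ℚ.- Q.form (pencil h) X
          d = Q.form D X
          N = Q.norm² X
          0<γ : 0ℚ ℚ.< γ
          0<γ = ¬Nonneg⇒>0 ¬0≤q
          0≤d : 0ℚ ℚ.≤ d
          0≤d = form-D-≥0 X
          0≤N : 0ℚ ℚ.≤ N
          0≤N = sum-≥0 (λ i → X i ℚ.* X i) (λ i → square-≥0 (X i))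
          value : ∀ k → seq (R.form (pencilℝ m) X′) k ≡ (h ℚ.- seq m k) ℚ.* d ℚ.- γ
          value k = begin
            seq (R.form (pencilℝ m) X′) k
              ≡⟨ seq-form (pencilℝ m) X′ k ⟩
            Q.form (pencil (seq m k)) X
              ≡⟨ Q.form-pencil S D (seq m k) X ⟩
            s ℚ.- seq m k ℚ.* d
              ≡⟨ solve 4 (λ s m d h → s :- m :* d := (h :- m) :* d :- (:- (s :- h :* d))) refl s (seq m k) d h ⟩
            (h ℚ.- seq m k) ℚ.* d ℚ.- (ℚ.- (s ℚ.- h ℚ.* d))
              ≡⟨ cong (λ z → (h ℚ.- seq m k) ℚ.* d ℚ.- (ℚ.- z)) (Q.form-pencil S D h X) ⟨
            (h ℚ.- seq m k) ℚ.* d ℚ.- γ ∎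
            where
            open ≡-Reasoning
            s = Q.form S X
          estimate : ∀ k → ((0ℚ ℚ.+ l₀ ℚ.≤ seq l k) × (0ℚ ℚ.+ κ ℚ.≤ seq K k)) × ((ℚ.∣ seq K k ∣ ℚ.≤ B) × (h ℚ.- seq m k ℚ.≤ η)) →
            0ℚ ℚ.+ κ ℚ.* γ ℚ.≤ 0ℚ ℚ.- (seq K k ℚ.* seq (R.form (pencilℝ m) X′) k ℚ.+ (0ℚ ℚ.- seq l k ℚ.* seq (R.norm² X′) k))
          estimate k ((l₀≤l , κ≤K) , (∣K∣≤B , h-m≤η)) = ≤-by
            (+-≥0 (+-≥0 (+-≥0 (*-≥0 (diff-≥0 l₀≤l) 0≤N) (*-≥0 (diff-≥0 (∣∣≤⇒≤ ∣K∣≤B)) 0≤WηN))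
                       (*-≥0 0≤K (+-≥0 (*-≥0 0≤η (diff-≥0 (form-D-≤ X))) (*-≥0 (diff-≥0 h-m≤η) 0≤d))))
                  (*-≥0 (diff-≥0 κ≤K) (ℚ.<⇒≤ 0<γ)))
            (begin
              (lₖ ℚ.- (0ℚ ℚ.+ l₀)) ℚ.* N ℚ.+ (B ℚ.- Kₖ) ℚ.* ((total ℚ.* η) ℚ.* N)
                ℚ.+ Kₖ ℚ.* (η ℚ.* (total ℚ.* N ℚ.- d) ℚ.+ (η ℚ.- (h ℚ.- seq m k)) ℚ.* d) ℚ.+ (Kₖ ℚ.- (0ℚ ℚ.+ κ)) ℚ.* γ
                ≡⟨ cong (λ z → (lₖ ℚ.- (0ℚ ℚ.+ z)) ℚ.* N ℚ.+ (B ℚ.- Kₖ) ℚ.* ((total ℚ.* η) ℚ.* N)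
                     ℚ.+ Kₖ ℚ.* (η ℚ.* (total ℚ.* N ℚ.- d) ℚ.+ (η ℚ.- (h ℚ.- seq m k)) ℚ.* d) ℚ.+ (Kₖ ℚ.- (0ℚ ℚ.+ κ)) ℚ.* γ) Bη≡l₀ ⟨
              (lₖ ℚ.- (0ℚ ℚ.+ (B ℚ.* total) ℚ.* η)) ℚ.* N ℚ.+ (B ℚ.- Kₖ) ℚ.* ((total ℚ.* η) ℚ.* N)
                ℚ.+ Kₖ ℚ.* (η ℚ.* (total ℚ.* N ℚ.- d) ℚ.+ (η ℚ.- (h ℚ.- seq m k)) ℚ.* d) ℚ.+ (Kₖ ℚ.- (0ℚ ℚ.+ κ)) ℚ.* γ
                ≡⟨ identity lₖ B total η N Kₖ d (h ℚ.- seq m k) κ γ ⟩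
              (0ℚ ℚ.- (Kₖ ℚ.* ((h ℚ.- seq m k) ℚ.* d ℚ.- γ) ℚ.+ (0ℚ ℚ.- lₖ ℚ.* N))) ℚ.- (0ℚ ℚ.+ κ ℚ.* γ)
                ≡⟨ cong₂ (λ q N → (0ℚ ℚ.- (Kₖ ℚ.* q ℚ.+ (0ℚ ℚ.- lₖ ℚ.* N))) ℚ.- (0ℚ ℚ.+ κ ℚ.* γ))
                     (value k) (seq-∑ (λ i → X′ i *ℝ X′ i) k) ⟨
              (0ℚ ℚ.- (Kₖ ℚ.* seq (R.form (pencilℝ m) X′) k ℚ.+ (0ℚ ℚ.- lₖ ℚ.* seq (R.norm² X′) k))) ℚ.- (0ℚ ℚ.+ κ ℚ.* γ) ∎)
            where
            open ≡-Reasoning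
            lₖ Kₖ : ℚ
            lₖ = seq l k
            Kₖ = seq K k
            0≤η : 0ℚ ℚ.≤ η
            0≤η = ℚ.<⇒≤ 0<η
            0≤WηN : 0ℚ ℚ.≤ (total ℚ.* η) ℚ.* N
            0≤WηN = *-≥0 (*-≥0 (ℚ.<⇒≤ 0<total) 0≤η) 0≤N
            0≤K : 0ℚ ℚ.≤ Kₖ
            0≤K = ℚ.≤-trans (+-≥0 ℚ.≤-refl (ℚ.<⇒≤ 0<κ)) κ≤K
            identity : ∀ l B W η N K d g κ γ →
              (l ℚ.- (0ℚ ℚ.+ (B ℚ.* W) ℚ.* η)) ℚ.* N ℚ.+ (B ℚ.- K) ℚ.* ((W ℚ.* η) ℚ.* N)
                ℚ.+ K ℚ.* (η ℚ.* (W ℚ.* N ℚ.- d) ℚ.+ (η ℚ.- g) ℚ.* d) ℚ.+ (K ℚ.- (0ℚ ℚ.+ κ)) ℚ.* γ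
              ≡ (0ℚ ℚ.- (K ℚ.* (g ℚ.* d ℚ.- γ) ℚ.+ (0ℚ ℚ.- l ℚ.* N))) ℚ.- (0ℚ ℚ.+ κ ℚ.* γ)
            identity = solve 10 (λ l B W η N K d g κ γ →
              (l :- (con 0ℚ :+ (B :* W) :* η)) :* N :+ (B :- K) :* ((W :* η) :* N)
                :+ K :* (η :* (W :* N :- d) :+ (η :- g) :* d) :+ (K :- (con 0ℚ :+ κ)) :* γ
              := (con 0ℚ :- (K :* (g :* d :- γ) :+ (con 0ℚ :- l :* N))) :- (con 0ℚ :+ κ :* γ)) refl

  SemidefiniteAt IndefiniteAt : ℚ → Set
  SemidefiniteAt t = Q.Semidefinite (pencil t)
  IndefiniteAt t = Q.Indefinite (pencil t)

  definiteness : ∀ t → SemidefiniteAt t ⊎ IndefiniteAt t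
  definiteness t = [ inj₂ , inj₁ ∘ proj₁ ]′ (Q.classify (pencil t) (pencil-symmetric t))

  semidefinite-≤0 : ∀ {t} → t ℚ.≤ 0ℚ → SemidefiniteAt t
  semidefinite-≤0 {t} t≤0 x = ≥0⇒Nonneg (subst (0ℚ ℚ.≤_)
    (trans (solve 3 (λ s t d → s :+ (:- t) :* d := s :- t :* d) refl (Q.form S x) t (Q.form D x))
      (sym (Q.form-pencil S D t x)))
    (+-≥0 (nonnegative x) (*-≥0 (ℚ.neg-antimono-≤ t≤0) (form-D-≥0 x))))

  module _ {λ₁ : ℝ} (smallest : ∀ μ → IsEigenvalue L μ → λ₁ ≤ℝ μ) {q : ℚ} (q<λ₁ : fromℚ q <ℝ λ₁) where

    ≤q-not-eigenvalue : ∀ m → (∀ k → seq m k ℚ.≤ q) → ¬ IsEigenvalue L m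
    ≤q-not-eigenvalue m m≤q eig = absurd q<λ₁
      where
      absurd : ¬ (fromℚ q <ℝ λ₁)
      absurd (ε , 0<ε , q+ε≤λ₁) =
        let (k , q+ε≤ , ≤m+ε/2) = eventually-witness (eventually-both q+ε≤λ₁ (smallest m eig _ (½->0 0<ε)))
        in ≤⇒≯
          (≤-by (+-≥0 (+-≥0 (diff-≥0 q+ε≤) (diff-≥0 ≤m+ε/2)) (diff-≥0 (m≤q k)))
            (solve 4 (λ q e l m → (l :- (q :+ e)) :+ ((m :+ con ½ :* e) :- l) :+ (q :- m) := con 0ℚ :- con ½ :* e)
              refl q ε (seq λ₁ k) (seq m k)))
          (½->0 0<ε)

    -- The goal is ⊥, so the real classification may be inspected although it is known only up to
    -- double negation. A negative value at m is excluded termwise: the k-th approximation of the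
    -- form belongs to the semidefinite `pencil (seq m k)`.
    no-threshold : ∀ m → (∀ k → SemidefiniteAt (seq m k)) → (∀ k → seq m k ℚ.≤ q) →
      ¬ (∀ {η} → 0ℚ ℚ.< η → ∃ λ h → IndefiniteAt h × Eventually (λ k → h ℚ.- seq m k ℚ.≤ η))
    no-threshold m semidefinite m≤q near = R.classify (pencilℝ m) (pencilℝ-symmetric m) impossible
      where
      impossible : ¬ R.Classification (pencilℝ m)
      impossible (inj₁ (y , ¬0≤qy)) = ¬0≤qy (≥0⇒Nonnegℝ (R.form (pencilℝ m) y) λ k →
        subst (0ℚ ℚ.≤_) (sym (seq-form (pencilℝ m) y k)) (Nonneg⇒≥0 (semidefinite k (λ i → seq (y i) k))))
      impossible (inj₂ (_ , inj₁ singular)) = ≤q-not-eigenvalue m m≤q (eigenvalue m singular)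
      impossible (inj₂ (_ , inj₂ coercive)) = not-coercive m near coercive

    not-indefinite : ¬ IndefiniteAt q
    not-indefinite indef@(X , ¬0≤q) = no-threshold limit A-limit limit-≤-top B-near-limit
      where
      -- Bisection starts at 0, where the form is S and hence semidefinite. A negative q would only
      -- add - q D to S, so an indefinite q lies to the right of the starting point.
      0≤q : 0ℚ ℚ.≤ q
      0≤q = ℚ.≮⇒≥ λ q<0 → ¬0≤q (semidefinite-≤0 (ℚ.<⇒≤ q<0) X)
      open Bisection {SemidefiniteAt} {IndefiniteAt} definiteness 0ℚ q 0≤q (semidefinite-≤0 ℚ.≤-refl) indef using (limit; A-limit; limit-≤-top; B-near-limit)

    rayleigh : ∀ x → q ℚ.* Q.form D x ℚ.≤ Q.form S x
    rayleigh x = ≤-by (Nonneg⇒≥0 (semidefinite x)) (Q.form-pencil S D q x)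
      where
      semidefinite : SemidefiniteAt q
      semidefinite = [ id , ⊥-elim ∘ not-indefinite ]′ (definiteness q)

-- Incidence sums and colourings

ind : Bool → ℚ
ind b = if b then 1ℚ else 0ℚ

ind-∧ : ∀ a b → ind (a ∧ b) ≡ ind a ℚ.* ind b
ind-∧ true  b = sym (ℚ.*-identityˡ (ind b))
ind-∧ false b = sym (ℚ.*-zeroˡ (ind b))

ind-idem : ∀ b → ind b ℚ.* ind b ≡ ind b
ind-idem true  = refl
ind-idem false = refl

does-∈? : ∀ {n} v (e : Subset n) → does (v ∈? e) ≡ Vec.lookup e v
does-∈? zero    (true  ∷ e) = refl
does-∈? zero    (false ∷ e) = refl
does-∈? (suc v) (_ ∷ e)     = does-∈? v e

ι-∣∣ : ∀ {n} (e : Subset n) → ι ∣ e ∣ ≡ sum (λ v → ind (Vec.lookup e v))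
ι-∣∣ []          = refl
ι-∣∣ (true  ∷ e) = trans (ι-suc ∣ e ∣) (cong (1ℚ ℚ.+_) (ι-∣∣ e))
ι-∣∣ (false ∷ e) = trans (ι-∣∣ e) (sym (ℚ.+-identityˡ _))

ι-length-filter : ∀ {a p} {A : Set a} {P : A → Set p} (P? : Decidable P) xs →
  ι (length (filter P? xs)) ≡ sum (λ k → ind (does (P? (List.lookup xs k))))
ι-length-filter P? []       = refl
ι-length-filter P? (x ∷ xs) with does (P? x)
... | true  = trans (ι-suc (length (filter P? xs))) (cong (1ℚ ℚ.+_) (ι-length-filter P? xs))
... | false = trans (ι-length-filter P? xs) (sym (ℚ.+-identityˡ _))

sum-const : ∀ n q → sum {n} (λ _ → q) ≡ ι n ℚ.* q
sum-const zero    q = sym (ℚ.*-zeroˡ q)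
sum-const (suc n) q = begin
  q ℚ.+ sum {n} (λ _ → q)   ≡⟨ cong (q ℚ.+_) (sum-const n q) ⟩
  q ℚ.+ ι n ℚ.* q           ≡⟨ solve 2 (λ n q → q :+ n :* q := (con 1ℚ :+ n) :* q) refl (ι n) q ⟩
  (1ℚ ℚ.+ ι n) ℚ.* q        ≡⟨ cong (ℚ._* q) (ι-suc n) ⟨
  ι (suc n) ℚ.* q           ∎
  where open ≡-Reasoning

sum-mono : ∀ {n} (f g : Fin n → ℚ) → (∀ i → f i ℚ.≤ g i) → sum f ℚ.≤ sum g
sum-mono {zero}  f g f≤g = ℚ.≤-refl
sum-mono {suc n} f g f≤g = ℚ.+-mono-≤ (f≤g zero) (sum-mono (f ∘ suc) (g ∘ suc) (f≤g ∘ suc))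

∑-nested : ∀ {m n} (f : Fin m → ℚ) (g : Fin m → Fin n → ℚ) →
  sum (λ i → f i ℚ.* sum (g i)) ≡ sum (λ j → sum (λ i → f i ℚ.* g i j))
∑-nested f g = trans (sum-cong-≗ (λ i → *-distribˡ-sum (f i) (g i))) (∑-comm (λ i j → f i ℚ.* g i j))

form-gram : ∀ {m n} (a : Fin m → Fin n → ℚ) x →
  Q.form (λ v w → sum (λ k → a k v ℚ.* a k w)) x ≡ sum (λ k → (a k Q.· x) ℚ.* (a k Q.· x))
form-gram a x = begin
  sum (λ v → x v ℚ.* sum (λ w → sum (λ k → a k v ℚ.* a k w) ℚ.* x w))
    ≡⟨ sum-cong-≗ (λ v → cong (x v ℚ.*_) (row v)) ⟩
  sum (λ v → x v ℚ.* sum (λ k → a k v ℚ.* (a k Q.· x)))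
    ≡⟨ ∑-nested x (λ v k → a k v ℚ.* (a k Q.· x)) ⟩
  sum (λ k → sum (λ v → x v ℚ.* (a k v ℚ.* (a k Q.· x))))
    ≡⟨ sum-cong-≗ (λ k → trans
         (sum-cong-≗ (λ v → solve 3 (λ x a s → x :* (a :* s) := (a :* x) :* s) refl (x v) (a k v) (a k Q.· x)))
         (sym (*-distribʳ-sum (a k Q.· x) (λ v → a k v ℚ.* x v)))) ⟩
  sum (λ k → (a k Q.· x) ℚ.* (a k Q.· x)) ∎
  where
  open ≡-Reasoning
  row : ∀ v → sum (λ w → sum (λ k → a k v ℚ.* a k w) ℚ.* x w) ≡ sum (λ k → a k v ℚ.* (a k Q.· x))
  row v = begin
    sum (λ w → sum (λ k → a k v ℚ.* a k w) ℚ.* x w)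
      ≡⟨ sum-cong-≗ (λ w → trans (*-distribʳ-sum (x w) (λ k → a k v ℚ.* a k w))
           (sum-cong-≗ (λ k → ℚ.*-assoc (a k v) (a k w) (x w)))) ⟩
    sum (λ w → sum (λ k → a k v ℚ.* (a k w ℚ.* x w)))
      ≡⟨ ∑-comm (λ w k → a k v ℚ.* (a k w ℚ.* x w)) ⟩
    sum (λ k → sum (λ w → a k v ℚ.* (a k w ℚ.* x w)))
      ≡⟨ sum-cong-≗ (λ k → *-distribˡ-sum (a k v) (λ w → a k w ℚ.* x w)) ⟨
    sum (λ k → a k v ℚ.* (a k Q.· x)) ∎

form-cong : ∀ {n} (A B : Matrix n ℚ) → (∀ i j → A i j ≡ B i j) → ∀ x → Q.form A x ≡ Q.form B x
form-cong A B A≡B x = sum-cong-≗ (λ i → cong (x i ℚ.*_) (sum-cong-≗ (λ j → cong (ℚ._* x j) (A≡B i j))))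

ι-*-/ : ∀ d .{{_ : ℕ.NonZero d}} i → ι d ℚ.* (i ℚ./ d) ≡ i ℚ./ 1
ι-*-/ d@(suc d-1) i = ℚ.toℚᵘ-injective (begin
  ℚ.toℚᵘ (ι d ℚ.* (i ℚ./ d))                  ≈⟨ ℚ.toℚᵘ-homo-* (ι d) (i ℚ./ d) ⟩
  ℚ.toℚᵘ (ι d) ℚᵘ.* ℚ.toℚᵘ (i ℚ./ d)          ≈⟨ ℚᵘ.*-cong (ℚ.toℚᵘ-fromℚᵘ (mkℚᵘ (+ d) 0)) (ℚ.toℚᵘ-fromℚᵘ (mkℚᵘ i d-1)) ⟩
  mkℚᵘ (+ d) 0 ℚᵘ.* mkℚᵘ i d-1                ≈⟨ ℚᵘ.*≡* cross ⟩
  mkℚᵘ i 0                                    ≈⟨ ℚ.toℚᵘ-fromℚᵘ (mkℚᵘ i 0) ⟨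
  ℚ.toℚᵘ (i ℚ./ 1)                            ∎)
  where
  open ℚᵘ.≃-Reasoning
  cross : (+ d ℤ.* i) ℤ.* + 1 ≡ i ℤ.* (+ 1 ℤ.* + d)
  cross = trans (ℤ.*-identityʳ (+ d ℤ.* i)) (trans (ℤ.*-comm (+ d) i) (cong (i ℤ.*_) (sym (ℤ.*-identityˡ (+ d)))))

neg-/1 : ∀ n → (ℤ.- (+ n)) ℚ./ 1 ≡ ℚ.- ι n
neg-/1 zero    = refl
neg-/1 (suc n) = refl

module Incidence {N} (Γ : Hypergraph N) where

  size : ℕ
  size = length (edges Γ)

  edge : Fin size → Subset N
  edge = List.lookup (edges Γ)

  inc : Fin size → Fin N → ℚ
  inc k v = ind (Vec.lookup (edge k) v)

  ι-degree : ∀ v → ι (degree Γ v) ≡ sum (λ k → inc k v)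
  ι-degree v = trans (ι-length-filter (v ∈?_) (edges Γ)) (sum-cong-≗ (λ k → cong ind (does-∈? v (edge k))))

  ι-codegree : ∀ v w → ι (codegree Γ v w) ≡ sum (λ k → inc k v ℚ.* inc k w)
  ι-codegree v w = trans (ι-length-filter (λ e → (v ∈? e) ×-dec (w ∈? e)) (edges Γ)) (sum-cong-≗ (λ k →
    trans (ind-∧ (does (v ∈? edge k)) (does (w ∈? edge k)))
      (cong₂ (λ a b → ind a ℚ.* ind b) (does-∈? v (edge k)) (does-∈? w (edge k)))))

  weight : Fin N → ℚ
  weight v = ι (degree Γ v)

  0<weight : ∀ v → 0ℚ ℚ.< weight v
  0<weight v = ℚ.<-≤-trans (ℚ.positive⁻¹ 1ℚ) (ι-mono (noIsolated Γ v))

  -- D L is the Gram matrix of the incidence vectors. Off the diagonal the sign of Id - D⁻¹A cancels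
  -- the sign of the adjacency entries; on it, the degree is a sum of idempotents.
  weighted-laplacian : ∀ v w → weight v ℚ.* laplacian Γ v w ≡ sum (λ k → inc k v ℚ.* inc k w)
  weighted-laplacian v w with v Fin.≟ w
  ... | yes refl = begin
    weight v ℚ.* (1ℚ ℚ.- (ℤ.0ℤ ℚ./ degree Γ v))
      ≡⟨ cong (λ z → weight v ℚ.* (1ℚ ℚ.- z)) (ℚ.0/n≡0 (degree Γ v)) ⟩
    weight v ℚ.* (1ℚ ℚ.- 0ℚ)
      ≡⟨ ℚ.*-identityʳ (weight v) ⟩
    weight v
      ≡⟨ ι-degree v ⟩
    sum (λ k → inc k v)
      ≡⟨ sum-cong-≗ (λ k → ind-idem (Vec.lookup (edge k) v)) ⟨
    sum (λ k → inc k v ℚ.* inc k v) ∎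
    where
    open ≡-Reasoning
    instance
      deg-nonZero : ℕ.NonZero (degree Γ v)
      deg-nonZero = ℕ.>-nonZero (noIsolated Γ v)
  ... | no _ = begin
    weight v ℚ.* (0ℚ ℚ.- ((ℤ.- (+ codegree Γ v w)) ℚ./ degree Γ v))
      ≡⟨ solve 2 (λ d z → d :* (con 0ℚ :- z) := :- (d :* z)) refl (weight v) ((ℤ.- (+ codegree Γ v w)) ℚ./ degree Γ v) ⟩
    ℚ.- (weight v ℚ.* ((ℤ.- (+ codegree Γ v w)) ℚ./ degree Γ v))
      ≡⟨ cong ℚ.-_ (trans (ι-*-/ (degree Γ v) (ℤ.- (+ codegree Γ v w))) (neg-/1 (codegree Γ v w))) ⟩
    ℚ.- (ℚ.- ι (codegree Γ v w))
      ≡⟨ solve 1 (λ x → :- (:- x) := x) refl (ι (codegree Γ v w)) ⟩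
    ι (codegree Γ v w)
      ≡⟨ ι-codegree v w ⟩
    sum (λ k → inc k v ℚ.* inc k w) ∎
    where
    open ≡-Reasoning
    instance
      deg-nonZero : ℕ.NonZero (degree Γ v)
      deg-nonZero = ℕ.>-nonZero (noIsolated Γ v)

  form-laplacian : ∀ x → Q.form (λ v w → weight v ℚ.* laplacian Γ v w) x ≡ sum (λ k → (inc k Q.· x) ℚ.* (inc k Q.· x))
  form-laplacian x = trans
    (form-cong (λ v w → weight v ℚ.* laplacian Γ v w) (λ v w → sum (λ k → inc k v ℚ.* inc k w)) weighted-laplacian x)
    (form-gram inc x)

  self-adjoint : ∀ v w → weight v ℚ.* laplacian Γ v w ≡ weight w ℚ.* laplacian Γ w v
  self-adjoint v w = trans (weighted-laplacian v w) (trans (sum-cong-≗ (λ k → ℚ.*-comm (inc k v) (inc k w))) (sym (weighted-laplacian w v)))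

  form-laplacian-≥0 : ∀ x → 0ℚ ℚ.≤ Q.form (λ v w → weight v ℚ.* laplacian Γ v w) x
  form-laplacian-≥0 x = subst (0ℚ ℚ.≤_) (sym (form-laplacian x))
    (Nonneg⇒≥0 (Q.Nonneg-sum (λ k → (inc k Q.· x) ℚ.* (inc k Q.· x)) (λ k → Q.Nonneg-square (inc k Q.· x))))

  open Rayleigh (laplacian Γ) weight 0<weight self-adjoint form-laplacian-≥0 using (D; form-D; rayleigh; eigenvalue-≥0) public

  form-degree : ∀ x → Q.form D x ≡ sum (λ k → sum (λ v → inc k v ℚ.* (x v ℚ.* x v)))
  form-degree x = begin
    Q.form D x
      ≡⟨ form-D x ⟩
    sum (λ v → weight v ℚ.* (x v ℚ.* x v))
      ≡⟨ sum-cong-≗ (λ v → trans (cong (ℚ._* (x v ℚ.* x v)) (ι-degree v)) (*-distribʳ-sum (x v ℚ.* x v) (λ k → inc k v))) ⟩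
    sum (λ v → sum (λ k → inc k v ℚ.* (x v ℚ.* x v)))
      ≡⟨ ∑-comm (λ v k → inc k v ℚ.* (x v ℚ.* x v)) ⟩
    sum (λ k → sum (λ v → inc k v ℚ.* (x v ℚ.* x v))) ∎
    where open ≡-Reasoning

  edge-rayleigh : ∀ {λ₁} → (∀ μ → IsEigenvalue (laplacian Γ) μ → λ₁ ≤ℝ μ) → ∀ {q} → fromℚ q <ℝ λ₁ → ∀ x →
    q ℚ.* sum (λ k → sum (λ v → inc k v ℚ.* (x v ℚ.* x v))) ℚ.≤ sum (λ k → (inc k Q.· x) ℚ.* (inc k Q.· x))
  edge-rayleigh {λ₁} smallest {q} q<λ₁ x =
    ≡.subst₂ (λ a b → q ℚ.* a ℚ.≤ b) (form-degree x) (form-laplacian x) (rayleigh {λ₁} smallest {q} q<λ₁ x)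

-- Colour classes within an edge

module ℕ-Sum = SemiringSum ℕ.+-*-semiring

δ-total : ∀ {n} (i : Fin n) → sum (δ i) ≡ 1ℚ
δ-total i = trans (sum-cong-≗ (λ j → sym (ℚ.*-identityʳ (δ i j)))) (sum-δ (λ _ → 1ℚ) i)

squares-≤ : ∀ {n} d (g : Fin n → ℕ) → (∀ i → g i ℕ.≤ d) →
  sum (λ i → ι (g i) ℚ.* ι (g i)) ℚ.≤ ι d ℚ.* sum (ι ∘ g)
squares-≤ d g g≤d = subst (sum (λ i → ι (g i) ℚ.* ι (g i)) ℚ.≤_) (sym (*-distribˡ-sum (ι d) (ι ∘ g)))
  (sum-mono (λ i → ι (g i) ℚ.* ι (g i)) (λ i → ι d ℚ.* ι (g i)) (λ i →
    ℚ.*-monoʳ-≤-nonNeg (ι (g i)) {{ℚ.nonNegative (ι-≥0 (g i))}} (ι-mono (g≤d i))))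

-- g (d - g) is a natural number that vanishes only at g = 0 and g = d, so otherwise it is at least
-- 1. This uniform gap is what survives the approximation of λ₁.
part-dichotomy : ∀ d g → g ℕ.≤ d → d ∣ g ⊎ ι g ℚ.* ι g ℚ.+ 1ℚ ℚ.≤ ι d ℚ.* ι g
part-dichotomy d zero    _   = inj₁ (d ∣0)
part-dichotomy d (suc g) g<d with suc g ℕ.≟ d
... | yes refl = inj₁ ∣-refl
... | no  g≢d  = inj₂ (≡.subst₂ ℚ._≤_ (trans (ι-+ (suc g ℕ.* suc g) 1) (cong (ℚ._+ 1ℚ) (ι-* (suc g) (suc g)))) (ι-* d (suc g))
  (ι-mono (begin
    suc g ℕ.* suc g ℕ.+ 1      ≡⟨ ℕ.+-comm (suc g ℕ.* suc g) 1 ⟩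
    1 ℕ.+ suc g ℕ.* suc g      ≤⟨ ℕ.+-monoˡ-≤ (suc g ℕ.* suc g) (ℕ.s≤s ℕ.z≤n) ⟩
    suc (suc g) ℕ.* suc g      ≤⟨ ℕ.*-monoˡ-≤ (suc g) (ℕ.≤∧≢⇒< g<d g≢d) ⟩
    d ℕ.* suc g                ∎)))
  where open ℕ.≤-Reasoning

-- One part strictly between 0 and d already costs 1, and the other parts cannot compensate, by
-- `squares-≤`.
squares-dichotomy : ∀ {n} d (g : Fin n → ℕ) → (∀ i → g i ℕ.≤ d) →
  d ∣ ℕ-Sum.sum g ⊎ sum (λ i → ι (g i) ℚ.* ι (g i)) ℚ.+ 1ℚ ℚ.≤ ι d ℚ.* sum (ι ∘ g)
squares-dichotomy {zero}  d g g≤d = inj₁ (d ∣0)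
squares-dichotomy {suc n} d g g≤d with part-dichotomy d (g zero) (g≤d zero) | squares-dichotomy d (g ∘ suc) (g≤d ∘ suc)
... | inj₁ d∣g₀ | inj₁ d∣rest = inj₁ (∣m∣n⇒∣m+n d∣g₀ d∣rest)
... | inj₂ g₀<  | _ = inj₂ (≤-by (+-≥0 (diff-≥0 g₀<) (diff-≥0 (squares-≤ d (g ∘ suc) (g≤d ∘ suc))))
  (solve 4 (λ a s d b → (d :* a :- (a :* a :+ con 1ℚ)) :+ (d :* b :- s) := d :* (a :+ b) :- (a :* a :+ s :+ con 1ℚ)) refl
    (ι (g zero)) (sum (λ i → ι (g (suc i)) ℚ.* ι (g (suc i)))) (ι d) (sum (ι ∘ g ∘ suc))))
... | inj₁ _ | inj₂ rest< = inj₂ (≤-by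
  (+-≥0 (*-≥0 (diff-≥0 (ι-mono (g≤d zero))) (ι-≥0 (g zero))) (diff-≥0 rest<))
  (solve 4 (λ a s d b → (d :- a) :* a :+ (d :* b :- (s :+ con 1ℚ)) := d :* (a :+ b) :- (a :* a :+ s :+ con 1ℚ)) refl
    (ι (g zero)) (sum (λ i → ι (g (suc i)) ℚ.* ι (g (suc i)))) (ι d) (sum (ι ∘ g ∘ suc))))

ι-sum : ∀ {n} (g : Fin n → ℕ) → ι (ℕ-Sum.sum g) ≡ sum (ι ∘ g)
ι-sum {zero}  g = refl
ι-sum {suc n} g = trans (ι-+ (g zero) (ℕ-Sum.sum (g ∘ suc))) (cong (ι (g zero) ℚ.+_) (ι-sum (g ∘ suc)))

ι-injective : ∀ {m n} → ι m ≡ ι n → m ≡ n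
ι-injective {m} {n} eq = ℤ.+-injective (cong ℚ.↥_ (trans (sym (ι-mkℚ m)) (trans eq (ι-mkℚ n))))

part : ∀ {N χ} → Subset N → Coloring N χ → Fin χ → ℕ
part e κ i = ∣ e ∩ colorClass κ i ∣

ι-part : ∀ {N χ} (e : Subset N) (κ : Coloring N χ) i →
  ι (part e κ i) ≡ sum (λ v → ind (Vec.lookup e v) ℚ.* δ (κ v) i)
ι-part e κ i = trans (ι-∣∣ (e ∩ colorClass κ i)) (sum-cong-≗ (λ v → trans
  (cong ind (trans (lookup-zipWith _∧_ v e (colorClass κ i))
    (cong (Vec.lookup e v ∧_) (lookup∘tabulate (λ v → does (κ v Fin.≟ i)) v))))
  (ind-∧ (Vec.lookup e v) (does (κ v Fin.≟ i)))))

sum-parts : ∀ {N χ} (e : Subset N) (κ : Coloring N χ) → sum (λ i → ι (part e κ i)) ≡ ι ∣ e ∣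
sum-parts e κ = begin
  sum (λ i → ι (part e κ i))
    ≡⟨ sum-cong-≗ (ι-part e κ) ⟩
  sum (λ i → sum (λ v → a v ℚ.* δ (κ v) i))
    ≡⟨ ∑-nested a (λ v → δ (κ v)) ⟨
  sum (λ v → a v ℚ.* sum (δ (κ v)))
    ≡⟨ sum-cong-≗ (λ v → trans (cong (a v ℚ.*_) (δ-total (κ v))) (ℚ.*-identityʳ (a v))) ⟩
  sum a
    ≡⟨ ι-∣∣ e ⟨
  ι ∣ e ∣ ∎
  where
  open ≡-Reasoning
  a : Fin _ → ℚ
  a v = ind (Vec.lookup e v)

∣e∣≡sum-parts : ∀ {N χ} (e : Subset N) (κ : Coloring N χ) → ∣ e ∣ ≡ ℕ-Sum.sum (part e κ)
∣e∣≡sum-parts e κ = ι-injective (sym (trans (ι-sum (part e κ)) (sum-parts e κ)))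

δ-idem : ∀ {n} (i j : Fin n) → δ i j ℚ.* δ i j ≡ δ i j
δ-idem i j = ind-idem (does (i Fin.≟ j))

-- Averaging over the colour classes

module Hoffman {N} (Γ : Hypergraph N) {c} (uniform : Uniform c Γ) (nonEmpty : NonEmpty Γ) where
  open Incidence Γ

  edge-size : ∀ k → ∣ edge k ∣ ≡ c
  edge-size k = All.lookup uniform (∈-lookup k)

  C : ℚ
  C = ι c

  sum-inc : ∀ k → sum (inc k) ≡ C
  sum-inc k = trans (sym (ι-∣∣ (edge k))) (cong ι (edge-size k))

  0<size : 0ℚ ℚ.< ι size
  0<size = 0<length (edges Γ) nonEmpty
    where
    0<length : ∀ (es : List (Subset N)) → ¬ es ≡ [] → 0ℚ ℚ.< ι (length es)
    0<length []       ne = contradiction refl ne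
    0<length (_ ∷ es) ne = ι-suc->0 (length es)

  module Colored {χ} (κ : Coloring N χ) where

    X : ℚ
    X = ι χ

    p : Fin size → Fin χ → ℚ
    p k i = ι (part (edge k) κ i)

    sum-p : ∀ k → sum (p k) ≡ C
    sum-p k = trans (sum-parts (edge k) κ) (cong ι (edge-size k))

    -- The indicator of a class minus its average 1/χ over the colours, times χ to clear the
    -- denominator. At every vertex the squares add up over i to the same χ² - χ, so the sizes of
    -- the classes disappear from the summed denominators.
    test : Fin χ → Fin N → ℚ
    test i v = X ℚ.* δ (κ v) i ℚ.- 1ℚ

    inc·test : ∀ k i → inc k Q.· test i ≡ X ℚ.* p k i ℚ.- C
    inc·test k i = begin
      sum (λ v → inc k v ℚ.* (X ℚ.* δ (κ v) i ℚ.- 1ℚ))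
        ≡⟨ sum-cong-≗ (λ v → solve 3 (λ a x d → a :* (x :* d :- con 1ℚ) := x :* (a :* d) :- con 1ℚ :* a) refl (inc k v) X (δ (κ v) i)) ⟩
      sum (λ v → X ℚ.* (inc k v ℚ.* δ (κ v) i) ℚ.- 1ℚ ℚ.* inc k v)
        ≡⟨ Q.sum-lin X 1ℚ (λ v → inc k v ℚ.* δ (κ v) i) (inc k) ⟩
      X ℚ.* sum (λ v → inc k v ℚ.* δ (κ v) i) ℚ.- 1ℚ ℚ.* sum (inc k)
        ≡⟨ cong₂ (λ a b → X ℚ.* a ℚ.- b) (sym (ι-part (edge k) κ i)) (trans (ℚ.*-identityˡ _) (sum-inc k)) ⟩
      X ℚ.* p k i ℚ.- C ∎
      where open ≡-Reasoning

    squares : Fin size → ℚ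
    squares k = sum (λ i → p k i ℚ.* p k i)

    sum-numerators : ∀ k → sum (λ i → (inc k Q.· test i) ℚ.* (inc k Q.· test i)) ≡ (X ℚ.* X) ℚ.* squares k ℚ.- X ℚ.* (C ℚ.* C)
    sum-numerators k = begin
      sum (λ i → (inc k Q.· test i) ℚ.* (inc k Q.· test i))
        ≡⟨ sum-cong-≗ (λ i → trans (cong (λ z → z ℚ.* z) (inc·test k i))
             (solve 3 (λ x p c → (x :* p :- c) :* (x :* p :- c) := (x :* x) :* (p :* p) :- c :* ((x :+ x) :* p :- con 1ℚ :* c)) refl X (p k i) C)) ⟩
      sum (λ i → (X ℚ.* X) ℚ.* (p k i ℚ.* p k i) ℚ.- C ℚ.* ((X ℚ.+ X) ℚ.* p k i ℚ.- 1ℚ ℚ.* C))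
        ≡⟨ Q.sum-lin (X ℚ.* X) C (λ i → p k i ℚ.* p k i) (λ i → (X ℚ.+ X) ℚ.* p k i ℚ.- 1ℚ ℚ.* C) ⟩
      (X ℚ.* X) ℚ.* squares k ℚ.- C ℚ.* sum (λ i → (X ℚ.+ X) ℚ.* p k i ℚ.- 1ℚ ℚ.* C)
        ≡⟨ cong (λ z → (X ℚ.* X) ℚ.* squares k ℚ.- C ℚ.* z) (trans (Q.sum-lin (X ℚ.+ X) 1ℚ (p k) (λ _ → C))
             (cong₂ (λ a b → (X ℚ.+ X) ℚ.* a ℚ.- 1ℚ ℚ.* b) (sum-p k) (sum-const χ C))) ⟩
      (X ℚ.* X) ℚ.* squares k ℚ.- C ℚ.* ((X ℚ.+ X) ℚ.* C ℚ.- 1ℚ ℚ.* (X ℚ.* C))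
        ≡⟨ solve 3 (λ x s c → (x :* x) :* s :- c :* ((x :+ x) :* c :- con 1ℚ :* (x :* c)) := (x :* x) :* s :- x :* (c :* c)) refl X (squares k) C ⟩
      (X ℚ.* X) ℚ.* squares k ℚ.- X ℚ.* (C ℚ.* C) ∎
      where open ≡-Reasoning

    sum-test² : ∀ v → sum (λ i → test i v ℚ.* test i v) ≡ X ℚ.* X ℚ.- X
    sum-test² v = begin
      sum (λ i → test i v ℚ.* test i v)
        ≡⟨ sum-cong-≗ (λ i → trans
             (solve 2 (λ x d → (x :* d :- con 1ℚ) :* (x :* d :- con 1ℚ) := (x :* x) :* (d :* d) :- con 1ℚ :* ((x :+ x) :* d :- con 1ℚ)) refl X (δ (κ v) i))
             (cong (λ z → (X ℚ.* X) ℚ.* z ℚ.- 1ℚ ℚ.* ((X ℚ.+ X) ℚ.* δ (κ v) i ℚ.- 1ℚ)) (δ-idem (κ v) i))) ⟩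
      sum (λ i → (X ℚ.* X) ℚ.* δ (κ v) i ℚ.- 1ℚ ℚ.* ((X ℚ.+ X) ℚ.* δ (κ v) i ℚ.- 1ℚ ℚ.* 1ℚ))
        ≡⟨ Q.sum-lin (X ℚ.* X) 1ℚ (δ (κ v)) (λ i → (X ℚ.+ X) ℚ.* δ (κ v) i ℚ.- 1ℚ ℚ.* 1ℚ) ⟩
      (X ℚ.* X) ℚ.* sum (δ (κ v)) ℚ.- 1ℚ ℚ.* sum (λ i → (X ℚ.+ X) ℚ.* δ (κ v) i ℚ.- 1ℚ ℚ.* 1ℚ)
        ≡⟨ cong₂ (λ a b → (X ℚ.* X) ℚ.* a ℚ.- 1ℚ ℚ.* b) (δ-total (κ v)) (trans (Q.sum-lin (X ℚ.+ X) 1ℚ (δ (κ v)) (λ _ → 1ℚ))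
             (cong₂ (λ a b → (X ℚ.+ X) ℚ.* a ℚ.- 1ℚ ℚ.* b) (δ-total (κ v)) (sum-const χ 1ℚ))) ⟩
      (X ℚ.* X) ℚ.* 1ℚ ℚ.- 1ℚ ℚ.* ((X ℚ.+ X) ℚ.* 1ℚ ℚ.- 1ℚ ℚ.* (X ℚ.* 1ℚ))
        ≡⟨ solve 1 (λ x → (x :* x) :* con 1ℚ :- con 1ℚ :* ((x :+ x) :* con 1ℚ :- con 1ℚ :* (x :* con 1ℚ)) := x :* x :- x) refl X ⟩
      X ℚ.* X ℚ.- X ∎
      where open ≡-Reasoning

    sum-denominators : ∀ k → sum (λ i → sum (λ v → inc k v ℚ.* (test i v ℚ.* test i v))) ≡ C ℚ.* (X ℚ.* X ℚ.- X)
    sum-denominators k = begin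
      sum (λ i → sum (λ v → inc k v ℚ.* (test i v ℚ.* test i v)))
        ≡⟨ ∑-nested (inc k) (λ v i → test i v ℚ.* test i v) ⟨
      sum (λ v → inc k v ℚ.* sum (λ i → test i v ℚ.* test i v))
        ≡⟨ sum-cong-≗ (λ v → cong (inc k v ℚ.*_) (sum-test² v)) ⟩
      sum (λ v → inc k v ℚ.* (X ℚ.* X ℚ.- X))
        ≡⟨ *-distribʳ-sum (X ℚ.* X ℚ.- X) (inc k) ⟨
      sum (inc k) ℚ.* (X ℚ.* X ℚ.- X)
        ≡⟨ cong (ℚ._* (X ℚ.* X ℚ.- X)) (sum-inc k) ⟩
      C ℚ.* (X ℚ.* X ℚ.- X) ∎
      where open ≡-Reasoning

    averaged : ∀ {λ₁} → (∀ μ → IsEigenvalue (laplacian Γ) μ → λ₁ ≤ℝ μ) → ∀ {q} → fromℚ q <ℝ λ₁ →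
      q ℚ.* (ι size ℚ.* (C ℚ.* (X ℚ.* X ℚ.- X))) ℚ.≤ sum (λ k → (X ℚ.* X) ℚ.* squares k ℚ.- X ℚ.* (C ℚ.* C))
    averaged {λ₁} smallest {q} q<λ₁ = ≡.subst₂ ℚ._≤_ lhs rhs
      (sum-mono (λ i → q ℚ.* den i) num (λ i → edge-rayleigh {λ₁} smallest {q} q<λ₁ (test i)))
      where
      open ≡-Reasoning
      den num : Fin χ → ℚ
      den i = sum (λ k → sum (λ v → inc k v ℚ.* (test i v ℚ.* test i v)))
      num i = sum (λ k → (inc k Q.· test i) ℚ.* (inc k Q.· test i))
      lhs : sum (λ i → q ℚ.* den i) ≡ q ℚ.* (ι size ℚ.* (C ℚ.* (X ℚ.* X ℚ.- X)))
      lhs = begin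
        sum (λ i → q ℚ.* den i)
          ≡⟨ *-distribˡ-sum q den ⟨
        q ℚ.* sum den
          ≡⟨ cong (q ℚ.*_) (∑-comm (λ i k → sum (λ v → inc k v ℚ.* (test i v ℚ.* test i v)))) ⟩
        q ℚ.* sum (λ k → sum (λ i → sum (λ v → inc k v ℚ.* (test i v ℚ.* test i v))))
          ≡⟨ cong (q ℚ.*_) (trans (sum-cong-≗ sum-denominators) (sum-const size (C ℚ.* (X ℚ.* X ℚ.- X)))) ⟩
        q ℚ.* (ι size ℚ.* (C ℚ.* (X ℚ.* X ℚ.- X))) ∎
      rhs : sum num ≡ sum (λ k → (X ℚ.* X) ℚ.* squares k ℚ.- X ℚ.* (C ℚ.* C))
      rhs = trans (∑-comm (λ i k → (inc k Q.· test i) ℚ.* (inc k Q.· test i))) (sum-cong-≗ sum-numerators)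

  -- σ measures how far each edge is from meeting every colour 0 or d times.
  hoffman-ℚ : ∀ {χ} (κ : Coloring N (suc χ)) (D σ : ℚ) →
    (∀ k → Colored.squares κ k ℚ.+ σ ℚ.≤ D ℚ.* C) →
    ∀ {λ₁} → (∀ μ → IsEigenvalue (laplacian Γ) μ → λ₁ ≤ℝ μ) → ∀ {q} → fromℚ q <ℝ λ₁ →
    q ℚ.* (C ℚ.* ι χ) ℚ.≤ ι (suc χ) ℚ.* (D ℚ.* C ℚ.- σ) ℚ.- C ℚ.* C
  hoffman-ℚ {χ} κ D σ small {λ₁} smallest {q} q<λ₁ =
    -- The number of colours is X = `ι (suc χ)`, so X² - X = X · ι χ; once the common factors
    -- `ι size` and X are cancelled, `ι χ` is the number of colours minus one.
    *-cancel-≤ (ι-suc->0 χ) (*-cancel-≤ 0<size (ℚ.≤-trans (ℚ.≤-reflexive lhs) (ℚ.≤-trans (averaged {λ₁} smallest {q} q<λ₁)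
      (ℚ.≤-trans (sum-mono (λ k → (X ℚ.* X) ℚ.* squares k ℚ.- X ℚ.* (C ℚ.* C)) (λ _ → bound) per-edge)
        (ℚ.≤-reflexive (trans (sum-const size bound) (cong (ι size ℚ.*_) factor)))))))
    where
    open Colored κ
    bound : ℚ
    bound = (X ℚ.* X) ℚ.* (D ℚ.* C ℚ.- σ) ℚ.- X ℚ.* (C ℚ.* C)
    per-edge : ∀ k → (X ℚ.* X) ℚ.* squares k ℚ.- X ℚ.* (C ℚ.* C) ℚ.≤ bound
    per-edge k = ≤-by (*-≥0 (square-≥0 X) (diff-≥0 (small k)))
      (solve 6 (λ x s c d e m → (x :* x) :* (d :* c :- (s :+ e)) := ((x :* x) :* (d :* c :- e) :- m) :- ((x :* x) :* s :- m)) refl X (squares k) C D σ (X ℚ.* (C ℚ.* C)))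
    factor : bound ≡ X ℚ.* (X ℚ.* (D ℚ.* C ℚ.- σ) ℚ.- C ℚ.* C)
    factor = solve 3 (λ x y c → (x :* x) :* y :- x :* (c :* c) := x :* (x :* y :- c :* c)) refl X (D ℚ.* C ℚ.- σ) C
    lhs : ι size ℚ.* (X ℚ.* (q ℚ.* (C ℚ.* ι χ))) ≡ q ℚ.* (ι size ℚ.* (C ℚ.* (X ℚ.* X ℚ.- X)))
    lhs = trans
      (solve 5 (λ n x q c y → n :* (x :* (q :* (c :* y))) := q :* (n :* (c :* (x :* (con 1ℚ :+ y) :- x)))) refl (ι size) X q C (ι χ))
      (cong (λ z → q ℚ.* (ι size ℚ.* (C ℚ.* (X ℚ.* z ℚ.- X)))) (sym (ι-suc χ)))

-- The bound and its sharpness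

-- For large n the rational `seq λ₁ n` - η lies below λ₁ with margin η/2, so it may be inserted for
-- q; the error η A is at most ε because (1 + A) η = ε, where the 1 guards against A = 0.
bound-from-below : ∀ λ₁ {A B} → 0ℚ ℚ.≤ A → (∀ q → fromℚ q <ℝ λ₁ → q ℚ.* A ℚ.≤ B) →
  ∀ {ε} → 0ℚ ℚ.< ε → Eventually (λ n → seq λ₁ n ℚ.* A ℚ.≤ B ℚ.+ ε)
bound-from-below λ₁ {A} {B} 0≤A below {ε} 0<ε = M , λ n M≤n → ≤-by
    (+-≥0 (diff-≥0 (below (seq λ₁ n ℚ.- η) (q<λ₁ n M≤n))) (ℚ.<⇒≤ 0<η))
    (begin
      (B ℚ.- (seq λ₁ n ℚ.- η) ℚ.* A) ℚ.+ η
        ≡⟨ solve 4 (λ b l e a → (b :- (l :- e) :* a) :+ e := (b :+ (con 1ℚ :+ a) :* e) :- l :* a) refl B (seq λ₁ n) η A ⟩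
      (B ℚ.+ (1ℚ ℚ.+ A) ℚ.* η) ℚ.- seq λ₁ n ℚ.* A
        ≡⟨ cong (λ z → (B ℚ.+ z) ℚ.- seq λ₁ n ℚ.* A) (proj₂ (proj₂ scale)) ⟩
      (B ℚ.+ ε) ℚ.- seq λ₁ n ℚ.* A ∎)
  where
  open ≡-Reasoning
  scale : ∃ λ η → 0ℚ ℚ.< η × (1ℚ ℚ.+ A) ℚ.* η ≡ ε
  scale = quotient->0 (ℚ.+-mono-<-≤ (ℚ.positive⁻¹ 1ℚ) 0≤A) 0<ε
  η : ℚ
  η = proj₁ scale
  0<η : 0ℚ ℚ.< η
  0<η = proj₁ (proj₂ scale)
  modulus : ∃ λ M → ∀ m n → M ℕ.≤ m → M ℕ.≤ n → ℚ.∣ seq λ₁ m ℚ.- seq λ₁ n ∣ ℚ.≤ ½ ℚ.* η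
  modulus = cauchy λ₁ (½ ℚ.* η) (½->0 0<η)
  M : ℕ
  M = proj₁ modulus
  q<λ₁ : ∀ n → M ℕ.≤ n → fromℚ (seq λ₁ n ℚ.- η) <ℝ λ₁
  q<λ₁ n M≤n = ½ ℚ.* η , ½->0 0<η , M , λ k M≤k → ≤-by
    (diff-≥0 (∣∣≤⇒≤ (proj₂ modulus n k M≤n M≤k)))
    (solve 3 (λ e x y → con ½ :* e :- (x :- y) := y :- ((x :- e) :+ con ½ :* e)) refl η (seq λ₁ n) (seq λ₁ k))

-- From M on the clamping at ε in `recipSeq` has no effect, so the terms are true reciprocals; B =
-- 1/ε controls errors multiplied by them.
recip-spec : ∀ y (0<y : 0ℝ <ℝ y) → ∃ λ B → 0ℚ ℚ.< B ×
  Eventually (λ n → 0ℚ ℚ.< seq y n × seq y n ℚ.* recipSeq y 0<y n ≡ 1ℚ × 0ℚ ℚ.≤ recipSeq y 0<y n × recipSeq y 0<y n ℚ.≤ B)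
recip-spec y 0<y@(ε , 0<ε , M , ε≤y) = B , proj₁ (proj₂ 1/ε) , M , λ n M≤n →
    0<yₙ n M≤n , yr≡1 n M≤n , 0≤r n , r≤B n M≤n
  where
  open ≡-Reasoning
  1/ε : ∃ λ B → 0ℚ ℚ.< B × ε ℚ.* B ≡ 1ℚ
  1/ε = quotient->0 0<ε (ℚ.positive⁻¹ 1ℚ)
  B : ℚ
  B = proj₁ 1/ε
  r t : ℕ → ℚ
  r = recipSeq y 0<y
  t n = seq y n ℚ.⊔ ε
  0<t : ∀ n → 0ℚ ℚ.< t n
  0<t n = ℚ.<-≤-trans 0<ε (ℚ.p≤q⊔p (seq y n) ε)
  ε≤yₙ : ∀ n → M ℕ.≤ n → ε ℚ.≤ seq y n
  ε≤yₙ n M≤n = subst (ℚ._≤ seq y n) (ℚ.+-identityˡ ε) (ε≤y n M≤n)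
  0<yₙ : ∀ n → M ℕ.≤ n → 0ℚ ℚ.< seq y n
  0<yₙ n M≤n = ℚ.<-≤-trans 0<ε (ε≤yₙ n M≤n)
  yr≡1 : ∀ n → M ℕ.≤ n → seq y n ℚ.* r n ≡ 1ℚ
  yr≡1 n M≤n = trans (cong (ℚ._* r n) (sym (ℚ.p≥q⇒p⊔q≡p (ε≤yₙ n M≤n)))) (ℚ.*-inverseʳ (t n) {{ℚ.>-nonZero (0<t n)}})
  0≤r : ∀ n → 0ℚ ℚ.≤ r n
  0≤r n = ℚ.<⇒≤ (ℚ.positive⁻¹ (r n) {{ℚ.1/pos⇒pos (t n) {{ℚ.positive (0<t n)}}}})
  r≤B : ∀ n → M ℕ.≤ n → r n ℚ.≤ B
  r≤B n M≤n = ≤-by (*-≥0 (*-≥0 (0≤r n) (ℚ.<⇒≤ (proj₁ (proj₂ 1/ε)))) (diff-≥0 (ε≤yₙ n M≤n))) (begin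
    (r n ℚ.* B) ℚ.* (seq y n ℚ.- ε)
      ≡⟨ solve 4 (λ r b y e → (r :* b) :* (y :- e) := (y :* r) :* b :- r :* (e :* b)) refl (r n) B (seq y n) ε ⟩
    (seq y n ℚ.* r n) ℚ.* B ℚ.- r n ℚ.* (ε ℚ.* B)
      ≡⟨ cong₂ (λ a b → a ℚ.* B ℚ.- r n ℚ.* b) (yr≡1 n M≤n) (proj₂ (proj₂ 1/ε)) ⟩
    1ℚ ℚ.* B ℚ.- r n ℚ.* 1ℚ
      ≡⟨ cong₂ ℚ._-_ (ℚ.*-identityˡ B) (ℚ.*-identityʳ (r n)) ⟩
    B ℚ.- r n ∎)

module Bound {N} (Γ : Hypergraph N) {c} (2≤c : 2 ℕ.≤ c) (uniform : Uniform c Γ) (nonEmpty : NonEmpty Γ)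
  (λ₁ : ℝ) (smallest : ∀ μ → IsEigenvalue (laplacian Γ) μ → λ₁ ≤ℝ μ) where
  open Incidence Γ
  open Hoffman Γ uniform nonEmpty

  1+1≤C : 1ℚ ℚ.+ 1ℚ ℚ.≤ C
  1+1≤C = ι-mono 2≤c

  0<C : 0ℚ ℚ.< C
  0<C = ℚ.<-≤-trans (ℚ.positive⁻¹ (1ℚ ℚ.+ 1ℚ)) 1+1≤C

  some-edge : Fin size
  some-edge = index (edges Γ) nonEmpty
    where
    index : ∀ (es : List (Subset N)) → ¬ es ≡ [] → Fin (length es)
    index []       ne = contradiction refl ne
    index (_ ∷ es) ne = zero

  no-0-coloring : ¬ Coloring N 0
  no-0-coloring κ = ℚ.<-irrefl (Colored.sum-p κ some-edge) 0<C

  -- D is left free for its two uses: D = 1 for the colouring with all vertices distinct, D = d for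
  -- proper colourings.
  eventual-bound : ∀ {χ} (κ : Coloring N (suc χ)) D → (∀ k → Colored.squares κ k ℚ.≤ D ℚ.* C) →
    ∀ {ε} → 0ℚ ℚ.< ε → Eventually (λ n → seq λ₁ n ℚ.* ι χ ℚ.≤ (ι (suc χ) ℚ.* D ℚ.- C) ℚ.+ ε)
  eventual-bound {χ} κ D small = bound-from-below λ₁ (ι-≥0 χ) λ q q<λ₁ → *-cancel-≤ 0<C (≡.subst₂ ℚ._≤_
    (solve 3 (λ q c x → q :* (c :* x) := c :* (q :* x)) refl q C (ι χ))
    (solve 3 (λ x d c → x :* (d :* c :- con 0ℚ) :- c :* c := c :* (x :* d :- c)) refl (ι (suc χ)) D C)
    (hoffman-ℚ κ D 0ℚ (λ k → subst (ℚ._≤ D ℚ.* C) (sym (ℚ.+-identityʳ _)) (small k)) {λ₁} smallest {q} q<λ₁))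

  discrete-squares : ∀ k → Colored.squares {N} id k ≡ C
  discrete-squares k = trans (sum-cong-≗ (λ i → trans (cong (λ z → z ℚ.* z) (p≡inc i)) (ind-idem (Vec.lookup (edge k) i)))) (sum-inc k)
    where
    open ≡-Reasoning
    p≡inc : ∀ i → Colored.p id k i ≡ inc k i
    p≡inc i = begin
      ι (part (edge k) id i)                ≡⟨ ι-part (edge k) id i ⟩
      sum (λ v → inc k v ℚ.* δ v i)         ≡⟨ sum-cong-≗ (λ v → δ-sym (inc k) v i) ⟩
      sum (λ v → inc k i ℚ.* δ i v)         ≡⟨ *-distribˡ-sum (inc k i) (δ i) ⟨
      inc k i ℚ.* sum (δ i)                 ≡⟨ cong (inc k i ℚ.*_) (δ-total i) ⟩
      inc k i ℚ.* 1ℚ                        ≡⟨ ℚ.*-identityʳ (inc k i) ⟩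
      inc k i                               ∎

  -- With one colour per vertex the bound reads (N - 1) λ₁ ≤ N - c ≤ (N - 1) - 1, the last step by c
  -- ≥ 2.
  λ₁<1 : λ₁ <ℝ 1ℝ
  λ₁<1 = by-order N id (λ k → ℚ.≤-reflexive (trans (discrete-squares k) (sym (ℚ.*-identityˡ C))))
    where
    -- The number of colours is separated from N, so that it can be split into cases while the
    -- vertex set stays fixed.
    by-order : ∀ χ (κ : Coloring N χ) → (∀ k → Colored.squares κ k ℚ.≤ 1ℚ ℚ.* C) → λ₁ <ℝ 1ℝ
    by-order zero          κ small = ⊥-elim (no-0-coloring κ)
    -- A single colour would give 0 ≤ 1 - c + ½, against c ≥ 2.
    by-order (suc zero)    κ small = ⊥-elim
      (let (n , h) = eventually-witness (eventual-bound κ 1ℚ small (ℚ.positive⁻¹ ½)) in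
       ≤⇒≯ (≤-by (+-≥0 (diff-≥0 h) (diff-≥0 1+1≤C))
         (solve 2 (λ l c → (((con 1ℚ :* con 1ℚ :- c) :+ con ½) :- l :* con 0ℚ) :+ (c :- (con 1ℚ :+ con 1ℚ)) := con 0ℚ :- con ½) refl (seq λ₁ n) C))
       (ℚ.positive⁻¹ ½))
    by-order (suc (suc m)) κ small =
      -- Half of the slack 1 pays for the error ½ of `eventual-bound`; the other half, divided by Y
      -- = N - 1, is the distance of λ₁ from 1.
      let (γ , 0<γ , Yγ≡½) = quotient->0 (ι-suc->0 m) (ℚ.positive⁻¹ ½)
          Y = ι (suc m)
      in γ , 0<γ , eventually-map (λ n h → *-cancel-≤ (ι-suc->0 m) (≤-by (+-≥0 (diff-≥0 h) (diff-≥0 1+1≤C))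
        (trans (cong₂ (λ x e → (((x ℚ.* 1ℚ ℚ.- C) ℚ.+ e) ℚ.- seq λ₁ n ℚ.* Y) ℚ.+ (C ℚ.- (1ℚ ℚ.+ 1ℚ))) (ι-suc (suc m)) (sym Yγ≡½))
          (trans (solve 4 (λ y c g l → ((((con 1ℚ :+ y) :* con 1ℚ :- c) :+ y :* g) :- l :* y) :+ (c :- (con 1ℚ :+ con 1ℚ))
                             := (y :* con 1ℚ :- y :* (l :+ g)) :+ (y :* g :+ y :* g :- con 1ℚ)) refl Y C γ (seq λ₁ n))
            (trans (cong (λ e → (Y ℚ.* 1ℚ ℚ.- Y ℚ.* (seq λ₁ n ℚ.+ γ)) ℚ.+ (e ℚ.+ e ℚ.- 1ℚ)) Yγ≡½) (ℚ.+-identityʳ _))))))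
        (eventual-bound κ 1ℚ small (ℚ.positive⁻¹ ½))

  d-λ₁>0 : ∀ {d} → 1 ℕ.≤ d → 0ℝ <ℝ fromℕ d -ℝ λ₁
  d-λ₁>0 {d} 1≤d = shift λ₁<1
    where
    shift : λ₁ <ℝ 1ℝ → 0ℝ <ℝ fromℕ d -ℝ λ₁
    shift (ε , 0<ε , h) = ε , 0<ε , eventually-map (λ n λ₁+ε≤1 → ≤-by (+-≥0 (diff-≥0 (ι-mono 1≤d)) (diff-≥0 λ₁+ε≤1))
      (solve 3 (λ d l e → (d :- con 1ℚ) :+ (con 1ℚ :- (l :+ e)) := (d :- l) :- (con 0ℚ :+ e)) refl (ι d) (seq λ₁ n) ε)) h

  parts-≤ : ∀ {d χ} {κ : Coloring N χ} → IsProper d Γ κ → ∀ k i → part (edge k) κ i ℕ.≤ d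
  parts-≤ proper k = All.lookup proper (∈-lookup k)

  proper-squares : ∀ {d χ} (κ : Coloring N χ) → IsProper d Γ κ → ∀ k → Colored.squares κ k ℚ.≤ ι d ℚ.* C
  proper-squares {d} κ proper k = subst (λ z → Colored.squares κ k ℚ.≤ ι d ℚ.* z) (Colored.sum-p κ k)
    (squares-≤ d (part (edge k) κ) (parts-≤ {κ = κ} proper k))

  strict-squares : ∀ {d χ} → ¬ d ∣ c → (κ : Coloring N χ) → IsProper d Γ κ → ∀ k → Colored.squares κ k ℚ.+ 1ℚ ℚ.≤ ι d ℚ.* C
  strict-squares {d} d∤c κ proper k =
    [ (λ d∣sum → contradiction (subst (d ∣_) (trans (sym (∣e∣≡sum-parts (edge k) κ)) (edge-size k)) d∣sum) d∤c)
    , subst (λ z → Colored.squares κ k ℚ.+ 1ℚ ℚ.≤ ι d ℚ.* z) (Colored.sum-p κ k) ]′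
    (squares-dichotomy d (part (edge k) κ) (parts-≤ {κ = κ} proper k))

  -- With χ + 1 colours, (χ + 1)(d - λ₁) - (c - λ₁) = (χ + 1) d - c - χ λ₁, which `eventual-bound`
  -- keeps above - η. Multiplying by the reciprocal r ≤ B costs at most B η = ε.
  hoffman-≤ : ∀ {d} (pos : 0ℝ <ℝ fromℕ d -ℝ λ₁) χ → ProperlyColorable d Γ χ → hoffman c d λ₁ pos ≤ℝ fromℕ χ
  hoffman-≤ pos zero    (κ , _) = ⊥-elim (no-0-coloring κ)
  hoffman-≤ {d} pos (suc χ) (κ , proper) ε 0<ε = estimate (recip-spec (fromℕ d -ℝ λ₁) pos)
    where
    open ≡-Reasoning
    r : ℕ → ℚ
    r = recipSeq (fromℕ d -ℝ λ₁) pos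
    estimate : (∃ λ B → 0ℚ ℚ.< B × Eventually (λ n → 0ℚ ℚ.< ι d ℚ.- seq λ₁ n × (ι d ℚ.- seq λ₁ n) ℚ.* r n ≡ 1ℚ × 0ℚ ℚ.≤ r n × r n ℚ.≤ B)) →
      Eventually (λ n → (C ℚ.- seq λ₁ n) ℚ.* r n ℚ.≤ ι (suc χ) ℚ.+ ε)
    estimate (B , 0<B , spec) =
      let (η , 0<η , Bη≡ε) = quotient->0 0<B 0<ε
      in eventually-map (λ n ((_ , yr≡1 , 0≤r , r≤B) , h) → ≤-by
          (+-≥0 (*-≥0 0≤r (diff-≥0 h)) (*-≥0 (ℚ.<⇒≤ 0<η) (diff-≥0 r≤B)))
          (begin
            r n ℚ.* (((ι (suc χ) ℚ.* ι d ℚ.- C) ℚ.+ η) ℚ.- seq λ₁ n ℚ.* ι χ) ℚ.+ η ℚ.* (B ℚ.- r n)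
              ≡⟨ cong (λ z → r n ℚ.* (((z ℚ.* ι d ℚ.- C) ℚ.+ η) ℚ.- seq λ₁ n ℚ.* ι χ) ℚ.+ η ℚ.* (B ℚ.- r n)) (ι-suc χ) ⟩
            r n ℚ.* ((((1ℚ ℚ.+ ι χ) ℚ.* ι d ℚ.- C) ℚ.+ η) ℚ.- seq λ₁ n ℚ.* ι χ) ℚ.+ η ℚ.* (B ℚ.- r n)
              ≡⟨ solve 7 (λ r x d c η l B → r :* ((((con 1ℚ :+ x) :* d :- c) :+ η) :- l :* x) :+ η :* (B :- r)
                   := ((con 1ℚ :+ x) :* ((d :- l) :* r) :+ B :* η) :- (c :- l) :* r) refl (r n) (ι χ) (ι d) C η (seq λ₁ n) B ⟩
            ((1ℚ ℚ.+ ι χ) ℚ.* ((ι d ℚ.- seq λ₁ n) ℚ.* r n) ℚ.+ B ℚ.* η) ℚ.- (C ℚ.- seq λ₁ n) ℚ.* r n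
              ≡⟨ cong₂ (λ a b → ((1ℚ ℚ.+ ι χ) ℚ.* a ℚ.+ b) ℚ.- (C ℚ.- seq λ₁ n) ℚ.* r n) yr≡1 Bη≡ε ⟩
            ((1ℚ ℚ.+ ι χ) ℚ.* 1ℚ ℚ.+ ε) ℚ.- (C ℚ.- seq λ₁ n) ℚ.* r n
              ≡⟨ cong (λ z → (z ℚ.+ ε) ℚ.- (C ℚ.- seq λ₁ n) ℚ.* r n) (trans (ℚ.*-identityʳ _) (sym (ι-suc χ))) ⟩
            (ι (suc χ) ℚ.+ ε) ℚ.- (C ℚ.- seq λ₁ n) ℚ.* r n ∎))
        (eventually-both spec (eventual-bound κ (ι d) (proper-squares κ proper) 0<η))

  -- If d does not divide c, every edge has σ = 1, which lowers the upper bound for c χ λ₁ by X, the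
  -- number of colours. Exact equality would force X ≤ 0; with error ¼ from `strict` and ½ from the
  -- approximate equality it still forces X ≤ ¾, against X ≥ 1.
  not-sharp : ∀ {d} → ¬ d ∣ c → (pos : 0ℝ <ℝ fromℕ d -ℝ λ₁) → ∀ χ → ProperlyColorable d Γ χ → ¬ (fromℕ χ ≈ℝ hoffman c d λ₁ pos)
  not-sharp d∤c pos zero (κ , _) _ = no-0-coloring κ
  not-sharp {d} d∤c pos (suc χ) (κ , proper) χ≈ = estimate (recip-spec (fromℕ d -ℝ λ₁) pos) (bounded (fromℕ d -ℝ λ₁))
    where
    open ≡-Reasoning
    X : ℚ
    X = ι (suc χ)
    r y : ℕ → ℚ
    r = recipSeq (fromℕ d -ℝ λ₁) pos
    y n = ι d ℚ.- seq λ₁ n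
    0<¼ : 0ℚ ℚ.< ½ ℚ.* ½
    0<¼ = ℚ.positive⁻¹ (½ ℚ.* ½)
    strict : Eventually (λ n → seq λ₁ n ℚ.* (C ℚ.* ι χ) ℚ.≤ (X ℚ.* (ι d ℚ.* C ℚ.- 1ℚ) ℚ.- C ℚ.* C) ℚ.+ ½ ℚ.* ½)
    strict = bound-from-below λ₁ (*-≥0 (ℚ.<⇒≤ 0<C) (ι-≥0 χ))
      (λ q → hoffman-ℚ κ (ι d) 1ℚ (strict-squares d∤c κ proper) {λ₁} smallest {q}) 0<¼
    estimate : (∃ λ B → 0ℚ ℚ.< B × Eventually (λ n → 0ℚ ℚ.< y n × y n ℚ.* r n ≡ 1ℚ × 0ℚ ℚ.≤ r n × r n ℚ.≤ B)) →
      (∃ λ Y → 0ℚ ℚ.< Y × Eventually (λ n → ℚ.∣ y n ∣ ℚ.≤ Y)) → ⊥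
    estimate (B , _ , spec) (Y , 0<Y , y≤Y) = at (eventually-witness
        (eventually-both (eventually-both spec y≤Y) (eventually-both strict (χ≈ η 0<η))))
      where
      -- Clearing the denominator multiplies the error η of the equality by C (d - λ₁), which is at
      -- most C Y.
      scale : ∃ λ η → 0ℚ ℚ.< η × (Y ℚ.* C) ℚ.* η ≡ ½
      scale = quotient->0 (*->0 0<Y 0<C) (ℚ.positive⁻¹ ½)
      η : ℚ
      η = proj₁ scale
      0<η : 0ℚ ℚ.< η
      0<η = proj₁ (proj₂ scale)
      at : ¬ (∃ λ n → ((0ℚ ℚ.< y n × y n ℚ.* r n ≡ 1ℚ × 0ℚ ℚ.≤ r n × r n ℚ.≤ B) × ℚ.∣ y n ∣ ℚ.≤ Y) ×
        (seq λ₁ n ℚ.* (C ℚ.* ι χ) ℚ.≤ (X ℚ.* (ι d ℚ.* C ℚ.- 1ℚ) ℚ.- C ℚ.* C) ℚ.+ ½ ℚ.* ½ ×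
         ℚ.∣ X ℚ.- (C ℚ.- seq λ₁ n) ℚ.* r n ∣ ℚ.≤ η))
      at (n , ((0<y , yr≡1 , _ , _) , ∣y∣≤Y) , (upper , close)) = ≤⇒≯ X≤3/4 3/4<X
        where
        l : ℚ
        l = seq λ₁ n
        X≤3/4 : X ℚ.≤ ½ ℚ.+ ½ ℚ.* ½
        X≤3/4 = ≤-by
          (+-≥0 (+-≥0 (diff-≥0 upper) (*-≥0 (*-≥0 (ℚ.<⇒≤ 0<C) (ℚ.<⇒≤ 0<y)) (diff-≥0 (∣∣≤⇒≤ close))))
                (*-≥0 (*-≥0 (ℚ.<⇒≤ 0<C) (ℚ.<⇒≤ 0<η)) (diff-≥0 (∣∣≤⇒≤ ∣y∣≤Y))))
          (begin
            (((X ℚ.* (ι d ℚ.* C ℚ.- 1ℚ) ℚ.- C ℚ.* C) ℚ.+ ½ ℚ.* ½) ℚ.- l ℚ.* (C ℚ.* ι χ))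
              ℚ.+ (C ℚ.* y n) ℚ.* (η ℚ.- (X ℚ.- (C ℚ.- l) ℚ.* r n)) ℚ.+ (C ℚ.* η) ℚ.* (Y ℚ.- y n)
              ≡⟨ identity X (ι d) C l (ι χ) η (r n) Y ⟩
            ((Y ℚ.* C) ℚ.* η ℚ.+ ½ ℚ.* ½) ℚ.- X ℚ.+ (C ℚ.* l) ℚ.* (X ℚ.- (1ℚ ℚ.+ ι χ)) ℚ.+ (C ℚ.* (C ℚ.- l)) ℚ.* (y n ℚ.* r n ℚ.- 1ℚ)
              ≡⟨ cong₂ (λ a b → ((Y ℚ.* C) ℚ.* η ℚ.+ ½ ℚ.* ½) ℚ.- X ℚ.+ (C ℚ.* l) ℚ.* a ℚ.+ (C ℚ.* (C ℚ.- l)) ℚ.* b)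
                   (trans (cong (ℚ._- (1ℚ ℚ.+ ι χ)) (ι-suc χ)) (ℚ.+-inverseʳ (1ℚ ℚ.+ ι χ)))
                   (cong (ℚ._- 1ℚ) yr≡1) ⟩
            ((Y ℚ.* C) ℚ.* η ℚ.+ ½ ℚ.* ½) ℚ.- X ℚ.+ (C ℚ.* l) ℚ.* 0ℚ ℚ.+ (C ℚ.* (C ℚ.- l)) ℚ.* 0ℚ
              ≡⟨ solve 3 (λ z a b → z :+ a :* con 0ℚ :+ b :* con 0ℚ := z) refl (((Y ℚ.* C) ℚ.* η ℚ.+ ½ ℚ.* ½) ℚ.- X) (C ℚ.* l) (C ℚ.* (C ℚ.- l)) ⟩
            ((Y ℚ.* C) ℚ.* η ℚ.+ ½ ℚ.* ½) ℚ.- X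
              ≡⟨ cong (λ z → (z ℚ.+ ½ ℚ.* ½) ℚ.- X) (proj₂ (proj₂ scale)) ⟩
            (½ ℚ.+ ½ ℚ.* ½) ℚ.- X ∎)
          where
          identity : ∀ X D C l x η r Y →
            (((X ℚ.* (D ℚ.* C ℚ.- 1ℚ) ℚ.- C ℚ.* C) ℚ.+ ½ ℚ.* ½) ℚ.- l ℚ.* (C ℚ.* x))
              ℚ.+ (C ℚ.* (D ℚ.- l)) ℚ.* (η ℚ.- (X ℚ.- (C ℚ.- l) ℚ.* r)) ℚ.+ (C ℚ.* η) ℚ.* (Y ℚ.- (D ℚ.- l))
            ≡ ((Y ℚ.* C) ℚ.* η ℚ.+ ½ ℚ.* ½) ℚ.- X ℚ.+ (C ℚ.* l) ℚ.* (X ℚ.- (1ℚ ℚ.+ x)) ℚ.+ (C ℚ.* (C ℚ.- l)) ℚ.* ((D ℚ.- l) ℚ.* r ℚ.- 1ℚ)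
          identity = solve 8 (λ X D C l x η r Y →
            (((X :* (D :* C :- con 1ℚ) :- C :* C) :+ con ½ :* con ½) :- l :* (C :* x))
              :+ (C :* (D :- l)) :* (η :- (X :- (C :- l) :* r)) :+ (C :* η) :* (Y :- (D :- l))
            := ((Y :* C) :* η :+ con ½ :* con ½) :- X :+ (C :* l) :* (X :- (con 1ℚ :+ x)) :+ (C :* (C :- l)) :* ((D :- l) :* r :- con 1ℚ)) refl
        3/4<X : ½ ℚ.+ ½ ℚ.* ½ ℚ.< X
        3/4<X = ℚ.<-≤-trans (<-by 0<¼ refl) (ι-mono {1} {suc χ} (ℕ.s≤s ℕ.z≤n))

-- Divisibility is decidable, hence stable, so refuting its negation suffices.
sharp⇒∣ : ∀ {c d} → 2 ℕ.≤ c → Sharp c d → d ∣ c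
sharp⇒∣ {c} {d} 2≤c (N , Γ , uniform , nonEmpty , λ₁ , (_ , smallest) , χ , (colorable , _) , pos , eq) =
  decidable-stable (d ∣? c) λ d∤c → Bound.not-sharp Γ 2≤c uniform nonEmpty λ₁ smallest d∤c pos χ colorable eq

-- The extremal example: a single edge

sum-split : ∀ m {n} (f : Fin (m ℕ.+ n) → ℚ) → sum f ≡ sum (λ i → f (i ↑ˡ n)) ℚ.+ sum (λ j → f (m ↑ʳ j))
sum-split zero    f = sym (ℚ.+-identityˡ (sum f))
sum-split (suc m) f = trans (cong (f zero ℚ.+_) (sum-split m (f ∘ suc))) (sym (ℚ.+-assoc (f zero) _ _))

sum-combine : ∀ m {n} (f : Fin (m ℕ.* n) → ℚ) → sum f ≡ sum (λ i → sum (λ j → f (combine {m} {n} i j)))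
sum-combine zero        f = refl
sum-combine (suc m) {n} f = trans (sum-split n f)
  (cong (sum (λ j → f (j ↑ˡ (m ℕ.* n))) ℚ.+_) (sum-combine m (λ i → f (n ↑ʳ i))))

singleEdge : ∀ N → Hypergraph N
singleEdge N = record
  { edges      = ⊤ ∷ []
  ; unique     = [] ∷ []
  ; noIsolated = λ v → ℕ.≤-reflexive (sym (cong length (filter-accept (v ∈?_) {xs = []} (∈⊤ {x = v}))))
  }

module SingleEdge (N : ℕ) where
  open Incidence (singleEdge N)

  inc≡1 : ∀ v → inc zero v ≡ 1ℚ
  inc≡1 v = cong ind (lookup-replicate v true)

  -- The Gram matrix of the one incidence vector is all ones and the degrees are 1. The kernel
  -- therefore consists of the vectors with sum zero.
  laplacian≡1 : ∀ v w → laplacian (singleEdge N) v w ≡ 1ℚ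
  laplacian≡1 v w = begin
    l                                        ≡⟨ ℚ.*-identityˡ l ⟨
    1ℚ ℚ.* l                                 ≡⟨ cong (ℚ._* l) weight≡1 ⟨
    weight v ℚ.* l                           ≡⟨ weighted-laplacian v w ⟩
    inc zero v ℚ.* inc zero w ℚ.+ 0ℚ         ≡⟨ cong₂ (λ a b → a ℚ.* b ℚ.+ 0ℚ) (inc≡1 v) (inc≡1 w) ⟩
    1ℚ                                       ∎
    where
    open ≡-Reasoning
    l : ℚ
    l = laplacian (singleEdge N) v w
    weight≡1 : weight v ≡ 1ℚ
    weight≡1 = trans (ι-degree v) (cong (ℚ._+ 0ℚ) (inc≡1 v))

  smallest-eigenvalue : 2 ℕ.≤ N → IsSmallestEigenvalue (laplacian (singleEdge N)) 0ℝ
  smallest-eigenvalue 2≤N = kernel (balanced 2≤N) , eigenvalue-≥0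
    where
    Balanced : ℕ → Set
    Balanced N = Σ (Fin N → ℚ) λ g → sum g ≡ 0ℚ × ∃ λ v → g v ≡ 1ℚ
    balanced : ∀ {N} → 2 ℕ.≤ N → Balanced N
    balanced (ℕ.s≤s (ℕ.s≤s {n = n} _)) = (1ℚ Vector.∷ ℚ.- 1ℚ Vector.∷ λ _ → 0ℚ) ,
      cong (λ z → 1ℚ ℚ.+ (ℚ.- 1ℚ ℚ.+ z)) (Q.sum-zero {n} (λ _ → 0ℚ) (λ _ → refl)) , zero , refl
    kernel : Balanced N → IsEigenvalue (laplacian (singleEdge N)) 0ℝ
    kernel (g , sum≡0 , v , gᵥ≡1) = (λ w → fromℚ (g w)) ,
      (v , inj₂ (1ℚ , ℚ.positive⁻¹ 1ℚ , 0 , λ _ _ → ℚ.≤-reflexive (sym gᵥ≡1))) ,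
      λ u → ≈-pointwise (∑ (λ w → fromℚ (laplacian (singleEdge N) u w) *ℝ fromℚ (g w))) (0ℝ *ℝ fromℚ (g u)) λ k → begin
        seq (∑ (λ w → fromℚ (laplacian (singleEdge N) u w) *ℝ fromℚ (g w))) k
          ≡⟨ seq-∑ (λ w → fromℚ (laplacian (singleEdge N) u w) *ℝ fromℚ (g w)) k ⟩
        sum (λ w → laplacian (singleEdge N) u w ℚ.* g w)
          ≡⟨ sum-cong-≗ (λ w → trans (cong (ℚ._* g w) (laplacian≡1 u w)) (ℚ.*-identityˡ (g w))) ⟩
        sum g
          ≡⟨ sum≡0 ⟩
        0ℚ
          ≡⟨ ℚ.*-zeroˡ (g u) ⟨
        0ℚ ℚ.* g u ∎
      where open ≡-Reasoning

-- `quotient` colours the vertices in consecutive blocks of length d; reindexing by `combine` makes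
-- the colour independent of the position within a block.
block-part : ∀ m d i → part {m ℕ.* d} ⊤ (quotient {m} d) i ≡ d
block-part m d i = ι-injective (begin
  ι (part {m ℕ.* d} ⊤ (quotient {m} d) i)
    ≡⟨ ι-part {m ℕ.* d} ⊤ (quotient {m} d) i ⟩
  sum (λ v → ind (Vec.lookup (⊤ {m ℕ.* d}) v) ℚ.* δ (quotient {m} d v) i)
    ≡⟨ sum-cong-≗ (λ v → trans (cong (λ b → ind b ℚ.* δ (quotient {m} d v) i) (lookup-replicate v true)) (ℚ.*-identityˡ _)) ⟩
  sum (λ v → δ (quotient {m} d v) i)
    ≡⟨ sum-combine m {d} (λ v → δ (quotient {m} d v) i) ⟩
  sum (λ a → sum {d} (λ b → δ (quotient {m} d (combine {m} {d} a b)) i))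
    ≡⟨ sum-cong-≗ (λ a → trans (sum-cong-≗ {d} (λ b → cong (λ z → δ (proj₁ z) i) (Fin.remQuot-combine {m} {d} a b))) (sum-const d (δ a i))) ⟩
  sum (λ a → ι d ℚ.* δ a i)
    ≡⟨ sum-cong-≗ (λ a → δ-sym (λ _ → ι d) a i) ⟩
  sum (λ a → ι d ℚ.* δ i a)
    ≡⟨ *-distribˡ-sum (ι d) (δ i) ⟨
  ι d ℚ.* sum (δ i)
    ≡⟨ trans (cong (ι d ℚ.*_) (δ-total i)) (ℚ.*-identityʳ (ι d)) ⟩
  ι d ∎)
  where open ≡-Reasoning

sum-≤-* : ∀ {n} d (g : Fin n → ℕ) → (∀ i → g i ℕ.≤ d) → ℕ-Sum.sum g ℕ.≤ n ℕ.* d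
sum-≤-* {zero}  d g g≤d = ℕ.z≤n
sum-≤-* {suc n} d g g≤d = ℕ.+-mono-≤ (g≤d zero) (sum-≤-* d (g ∘ suc) (g≤d ∘ suc))

-- The block colouring attains m, and j classes with at most d vertices each cover at most j d of
-- the m d vertices.
singleEdge-coloringNumber : ∀ m d → 1 ℕ.≤ d → IsColoringNumber d (singleEdge (m ℕ.* d)) m
singleEdge-coloringNumber m d 1≤d =
    (quotient {m} d , (λ i → ℕ.≤-reflexive (block-part m d i)) ∷ [])
  , λ where
      j (κ , parts≤d ∷ []) → ℕ.*-cancelʳ-≤ m j d {{ℕ.>-nonZero 1≤d}}
        (subst (ℕ._≤ j ℕ.* d) (trans (sym (∣e∣≡sum-parts ⊤ κ)) (∣⊤∣≡n (m ℕ.* d))) (sum-≤-* d (part ⊤ κ) parts≤d))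

∣⇒sharp : ∀ {c d} → 2 ℕ.≤ c → 1 ℕ.≤ d → d ∣ c → Sharp c d
∣⇒sharp {d = d} 2≤c 1≤d (divides m refl) =
    N , singleEdge N , ∣⊤∣≡n N ∷ [] , (λ ()) , 0ℝ , SingleEdge.smallest-eigenvalue N 2≤c ,
    m , singleEdge-coloringNumber m d 1≤d , pos , tight (recip-spec y pos)
  where
  open ≡-Reasoning
  N : ℕ
  N = m ℕ.* d
  y : ℝ
  y = fromℕ d -ℝ 0ℝ
  pos : 0ℝ <ℝ y
  pos = ι d , ℚ.<-≤-trans (ℚ.positive⁻¹ 1ℚ) (ι-mono 1≤d) , 0 , λ _ _ → ℚ.≤-reflexive (ℚ.+-comm 0ℚ (ι d))
  r : ℕ → ℚ
  r = recipSeq y pos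
  tight : (∃ λ B → 0ℚ ℚ.< B × Eventually (λ n → 0ℚ ℚ.< seq y n × seq y n ℚ.* r n ≡ 1ℚ × 0ℚ ℚ.≤ r n × r n ℚ.≤ B)) →
    fromℕ m ≈ℝ hoffman N d 0ℝ pos
  tight (_ , _ , spec) ε 0<ε = eventually-map (λ n (_ , yr≡1 , _) → ℚ.≤-trans (ℚ.≤-reflexive (cong ℚ.∣_∣ (begin
    ι m ℚ.- (ι N ℚ.- 0ℚ) ℚ.* r n
      ≡⟨ cong (λ z → ι m ℚ.- (z ℚ.- 0ℚ) ℚ.* r n) (ι-* m d) ⟩
    ι m ℚ.- (ι m ℚ.* ι d ℚ.- 0ℚ) ℚ.* r n
      ≡⟨ solve 3 (λ m d r → m :- (m :* d :- con 0ℚ) :* r := m :* (con 1ℚ :- (d :- con 0ℚ) :* r)) refl (ι m) (ι d) (r n) ⟩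
    ι m ℚ.* (1ℚ ℚ.- (ι d ℚ.- 0ℚ) ℚ.* r n)
      ≡⟨ cong (λ z → ι m ℚ.* (1ℚ ℚ.- z)) yr≡1 ⟩
    ι m ℚ.* 0ℚ
      ≡⟨ ℚ.*-zeroʳ (ι m) ⟩
    0ℚ ∎))) (ℚ.<⇒≤ 0<ε)) spec

mainTheorem6 : (c d : ℕ) → 2 ≤ c → 1 ≤ d → d ≤ c ∸ 1 →
    ( (N : ℕ) (Γ : Hypergraph N) → Uniform c Γ → NonEmpty Γ →
    (λ₁ : ℝ) → IsSmallestEigenvalue (laplacian Γ) λ₁ →
    λ₁ <ℝ 1ℝ ×
    Σ (0ℝ <ℝ fromℕ d -ℝ λ₁) λ pos →
    (χ : ℕ) → IsColoringNumber d Γ χ → hoffman c d λ₁ pos ≤ℝ fromℕ χ )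
    × (Sharp c d ⇔ d ∣ c)
mainTheorem6 c d 2≤c 1≤d _ =
    (λ N Γ uniform nonEmpty λ₁ (_ , smallest) →
      let open Bound Γ 2≤c uniform nonEmpty λ₁ smallest in
      λ₁<1 , d-λ₁>0 1≤d , λ χ (colorable , _) → hoffman-≤ (d-λ₁>0 1≤d) χ colorable)
  , mk⇔ (sharp⇒∣ 2≤c) (∣⇒sharp 2≤c 1≤d)
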